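{- Let $m\ge n\ge 0$ be integers and let $\lambda$ be a partition inside an $n\times m$ board (at most $n$ parts, each at most $m$). Then $$X_\lambda({\bf x},q)=\frac{1}{[m]_n}\sum_{j=0}^{n} H_j^{m,n}(\lambda)\, X_{m^j}({\bf x},q),$$ where $X_\lambda({\bf x},q)$ and $X_{m^j}({\bf x},q)$ are the chromatic quasisymmetric functions of the graphs on $m+n$ vertices associated with $\lambda$ and with the rectangle $m^j$ ($j$ rows of length $m$), and $H_j^{m,n}(\lambda)$ are the $q$-hit numbers of $\lambda$ in the $n\times m$ board.
   Context: $q$-notation: $[x]=(1-q^x)/(1-q)$, $[a]_k=[a][a-1]\cdots[a-k+1]$, $[a]!=[a]_a$, and $(x;q)_k=\prod_{i=0}^{k-1}(1-xq^i)$; $q$ is an indeterminate. Boards and partitions: an $n\times m$ board has $n$ rows and $m$ columns; cell $(i,j)$ is in row $i$ from the top and column $j$ from the left. A partition $\lambda=(\lambda_1\ge\lambda_2\ge\cdots\ge\lambda_n\ge 0)$ with $\lambda_1\le m$ is identified with the set of cells $(i,j)$ with $j\le\lambda_i$; $|\lambda|$ is its number of cells. Graph of $\lambda$: $G(\lambda)$ has vertices $1,\dots,m+n$; all pairs $a<b$ are edges except those with $a\le m<b$ and $a\le\lambda_{m+n+1-b}$ (i.e. cell $(i,a)\in\lambda$ corresponds to the non-edge $\{a,m+n+1-i\}$). This is the graph whose edges correspond to the cells under the abelian Dyck path $\mathsf{n}^m w(\lambda)\mathsf{e}^n$. Chromatic quasisymmetric function: $X_\lambda({\bf x},q)=\sum_\kappa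 q^{\mathrm{asc}(\kappa)}\prod_{v}x_{\kappa(v)}$, the sum over proper colorings $\kappa:\{1,\dots,m+n\}\to\{1,2,3,\dots\}$ of $G(\lambda)$, where $\mathrm{asc}(\kappa)$ is the number of edges $\{a,b\}$ with $a<b$ and $\kappa(a)<\kappa(b)$. $q$-rook numbers: $R_k(\lambda)=\sum_p q^{\mathrm{inv}(p)}$ over all placements $p$ of $k$ non-attacking rooks on cells of $\lambda$ (no two in the same row or column), where $\mathrm{inv}(p)$ is the number of cells of $\lambda$ left after each rook cancels its own cell, the cells of $\lambda$ North of it in its column, and the cells West of it in its row. $q$-hit numbers: for $\lambda$ inside an $n\times m$ board with $n\le m$, the $H_i^{m,n}(\lambda)$ are defined by $$\sum_{i=0}^n H_i^{m,n}(\lambda)x^i=\frac{q^{ -|\lambda|}}{[m-n]!}\sum_{i=0}^n R_i(\lambda)\,[m-i]!\,(-1)^i q^{mi-\binom i2}(x;q)_i .$$ -}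

module Defs where

open import Algebra.Bundles using (RawRing)
open import Data.Fin.Base using (Fin; toℕ; opposite; splitAt)
open import Data.Integer.Base as ℤ using (ℤ; +_)
open import Data.List.Base as List using (List; []; _∷_; length; map; filter; allFin; cartesianProduct; cartesianProductWith)
open import Data.Maybe.Base using (Maybe; just; nothing; is-just)
open import Data.Nat.Base as ℕ using (ℕ; zero; suc; _∸_)
open import Data.Nat.Combinatorics using (_C_)
open import Data.Product.Base using (∃₂; _×_; _,_)
open import Data.Sum.Base using (_⊎_; inj₁; inj₂)
open import Data.Vec.Base as Vec using (Vec; []; _∷_; lookup)
open import Function.Base using (_∘_)
open import Level using (Level; 0ℓ)
open import Relation.Binary.PropositionalEquality using (_≡_; _≢_; refl; sym; trans; cong)
open import Relation.Nullary using (¬_; Dec; yes; no; contradiction)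
open import Relation.Nullary.Decidable using (¬?; _×-dec_; _⊎-dec_; _→-dec_; map′)
import Algebra.Definitions.RawSemiring as RawSemiringDefs
import Data.Fin.Base as Fin
import Data.Fin.Properties as Fin
import Data.Integer.Properties as ℤ
import Data.Maybe.Properties as Maybe
import Data.Nat.Properties as ℕ
import Data.Sum.Properties as Sum

private
  variable
    a c ℓ : Level
    A : Set a
    n m : ℕ

-- A list of coefficients, constant term first.  Trailing zeros are allowed, so
-- equality is equality of all coefficients.
module Polynomial (R : RawRing c ℓ) where
  private module R = RawRing R

  Poly : Set c
  Poly = List R.Carrier

  coeff : Poly → ℕ → R.Carrier
  coeff []      _       = R.0#
  coeff (a ∷ p) zero    = a
  coeff (a ∷ p) (suc k) = coeff p k

  const : R.Carrier → Poly
  const a = a ∷ []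

  var : Poly
  var = R.0# ∷ R.1# ∷ []

  infixl 6 _⊕_
  _⊕_ : Poly → Poly → Poly
  []      ⊕ r       = r
  (a ∷ p) ⊕ []      = a ∷ p
  (a ∷ p) ⊕ (b ∷ r) = (a R.+ b) ∷ (p ⊕ r)

  infixl 7 _⊛_
  _⊛_ : Poly → Poly → Poly
  []      ⊛ r = []
  (a ∷ p) ⊛ r = map (a R.*_) r ⊕ (R.0# ∷ (p ⊛ r))

  rawRing : RawRing c ℓ
  rawRing = record
    { Carrier = Poly
    ; _≈_     = λ p r → ∀ k → coeff p k R.≈ coeff r k
    ; _+_     = _⊕_
    ; _*_     = _⊛_
    ; -_      = map R.-_
    ; 0#      = []
    ; 1#      = const R.1#
    }

module ℤ[q] where
  open Polynomial ℤ.+-*-rawRing public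
  open RawRing rawRing public using (_≈_; _≉_; _+_; _*_; -_; 0#; 1#)

  zero? : (p : Poly) → Dec (p ≈ 0#)
  zero? []      = yes λ _ → refl
  zero? (a ∷ p) = map′
    (λ { (a≡0 , p≈0) zero → a≡0 ; (a≡0 , p≈0) (suc k) → p≈0 k })
    (λ h → h zero , λ k → h (suc k))
    (a ℤ.≟ + 0 ×-dec zero? p)

  private
    coeff-+ : ∀ p r k → coeff (p + r) k ≡ coeff p k ℤ.+ coeff r k
    coeff-+ []      r       k       = sym (ℤ.+-identityˡ _)
    coeff-+ (a ∷ p) []      k       = sym (ℤ.+-identityʳ _)
    coeff-+ (a ∷ p) (b ∷ r) zero    = refl
    coeff-+ (a ∷ p) (b ∷ r) (suc k) = coeff-+ p r k

    coeff-scale : ∀ a r k → coeff (map (a ℤ.*_) r) k ≡ a ℤ.* coeff r k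
    coeff-scale a []      k       = sym (ℤ.*-zeroʳ a)
    coeff-scale a (b ∷ r) zero    = refl
    coeff-scale a (b ∷ r) (suc k) = coeff-scale a r k

    coeff-∷* : ∀ a p r k →
      coeff ((a ∷ p) * r) k ≡ a ℤ.* coeff r k ℤ.+ coeff (+ 0 ∷ (p * r)) k
    coeff-∷* a p r k = trans
      (coeff-+ (map (a ℤ.*_) r) (+ 0 ∷ (p * r)) k)
      (cong (ℤ._+ _) (coeff-scale a r k))

    coeff-*-zero : ∀ p r → coeff (p * (+ 0 ∷ r)) 0 ≡ + 0
    coeff-*-zero []      r = refl
    coeff-*-zero (a ∷ p) r = trans (coeff-∷* a p (+ 0 ∷ r) 0)
      (trans (ℤ.+-identityʳ _) (ℤ.*-zeroʳ a))

    coeff-*-suc : ∀ p r k → coeff (p * (+ 0 ∷ r)) (suc k) ≡ coeff (p * r) k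
    coeff-*-suc []      r k = refl
    coeff-*-suc (a ∷ p) r k = trans (coeff-∷* a p (+ 0 ∷ r) (suc k))
      (trans (cong (ℤ._+_ (a ℤ.* coeff r k)) (shift k)) (sym (coeff-∷* a p r k)))
      where
      shift : ∀ k → coeff (p * (+ 0 ∷ r)) k ≡ coeff (+ 0 ∷ (p * r)) k
      shift zero    = coeff-*-zero p r
      shift (suc k) = coeff-*-suc p r k

    cancel-nonzero-constant : ∀ a p r → a ≢ + 0 → (a ∷ p) * r ≈ 0# → r ≈ 0#
    cancel-nonzero-constant a p []      a≢0 h k = refl
    cancel-nonzero-constant a p (b ∷ r) a≢0 h
      with ℤ.i*j≡0⇒i≡0∨j≡0 a
             (trans (sym (ℤ.+-identityʳ (a ℤ.* b))) (h 0))
    ... | inj₁ a≡0  = contradiction a≡0 a≢0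
    ... | inj₂ refl = λ
      { zero    → refl
      ; (suc k) → cancel-nonzero-constant a p r a≢0
          (λ j → trans (sym (coeff-*-suc (a ∷ p) r j)) (h (suc j))) k
      }

  *≈0⇒≈0 : ∀ p r → p * r ≈ 0# → p ≈ 0# ⊎ r ≈ 0#
  *≈0⇒≈0 []      r h = inj₁ λ _ → refl
  *≈0⇒≈0 (a ∷ p) r h with a ℤ.≟ + 0
  ... | no  a≢0  = inj₂ (cancel-nonzero-constant a p r a≢0 h)
  ... | yes refl
    with *≈0⇒≈0 p r (λ k → trans
           (sym (trans (coeff-∷* (+ 0) p r (suc k)) (ℤ.+-identityˡ _)))
           (h (suc k)))
  ...   | inj₁ p≈0 = inj₁ λ { zero → refl ; (suc k) → p≈0 k }
  ...   | inj₂ r≈0 = inj₂ r≈0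

  *-≉0 : ∀ p r → p ≉ 0# → r ≉ 0# → p * r ≉ 0#
  *-≉0 p r p≉0 r≉0 pr≈0 with *≈0⇒≈0 p r pr≈0
  ... | inj₁ p≈0 = p≉0 p≈0
  ... | inj₂ r≈0 = r≉0 r≈0

  1≉0 : 1# ≉ 0#
  1≉0 h with () ← h 0

-- ℚ(q), as the field of fractions of ℤ[q]; equality is by cross multiplication.
record ℚ⟨q⟩ : Set where
  field
    num   : ℤ[q].Poly
    den   : ℤ[q].Poly
    den≉0 : den ℤ[q].≉ ℤ[q].0#

open ℚ⟨q⟩

fromPoly : ℤ[q].Poly → ℚ⟨q⟩
fromPoly p = record { num = p ; den = ℤ[q].1# ; den≉0 = ℤ[q].1≉0 }

ℚ⟨q⟩-rawRing : RawRing 0ℓ 0ℓ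
ℚ⟨q⟩-rawRing = record
  { Carrier = ℚ⟨q⟩
  ; _≈_     = λ f g → num f ℤ[q].* den g ℤ[q].≈ num g ℤ[q].* den f
  ; _+_     = λ f g → record
    { num   = num f ℤ[q].* den g ℤ[q].+ num g ℤ[q].* den f
    ; den   = den f ℤ[q].* den g
    ; den≉0 = ℤ[q].*-≉0 (den f) (den g) (den≉0 f) (den≉0 g)
    }
  ; _*_     = λ f g → record
    { num   = num f ℤ[q].* num g
    ; den   = den f ℤ[q].* den g
    ; den≉0 = ℤ[q].*-≉0 (den f) (den g) (den≉0 f) (den≉0 g)
    }
  ; -_      = λ f → record { num = ℤ[q].- num f ; den = den f ; den≉0 = den≉0 f }
  ; 0#      = fromPoly ℤ[q].0#
  ; 1#      = fromPoly ℤ[q].1#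
  }

open RawRing ℚ⟨q⟩-rawRing public using (_≈_; _+_; _*_; -_; 0#; 1#; rawSemiring)
open RawSemiringDefs rawSemiring public using (_^_; sum; product)

infixl 6 _-_
_-_ : ℚ⟨q⟩ → ℚ⟨q⟩ → ℚ⟨q⟩
f - g = f + (- g)

-- Total, with 0 ⁻¹ = 0.  The elements inverted below are 1 - q, powers of q,
-- [m - n]! and [m]ₙ with n ≤ m, all of them nonzero.
infix 8 _⁻¹
_⁻¹ : ℚ⟨q⟩ → ℚ⟨q⟩
f ⁻¹ with ℤ[q].zero? (num f)
... | yes _     = 0#
... | no  num≉0 = record { num = den f ; den = num f ; den≉0 = num≉0 }

q : ℚ⟨q⟩
q = fromPoly ℤ[q].var

∑ : List ℚ⟨q⟩ → ℚ⟨q⟩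
∑ = List.foldr _+_ 0#

[_] : ℕ → ℚ⟨q⟩
[ x ] = (1# - q ^ x) * (1# - q) ⁻¹

-- [a][a-1]⋯[a-k+1], used for k ≤ a only, so that the subtraction is exact
[_]↓_ : ℕ → ℕ → ℚ⟨q⟩
[ a ]↓ k = product {k} λ i → [ a ∸ toℕ i ]

[_]! : ℕ → ℚ⟨q⟩
[ a ]! = [ a ]↓ a

-- Rows and columns are numbered from 0.
Cell : ℕ → ℕ → Set
Cell n m = Fin n × Fin m

record Partition (n m : ℕ) : Set where
  field
    part       : Fin n → ℕ
    decreasing : ∀ {i j} → i Fin.≤ j → part j ℕ.≤ part i
    bounded    : ∀ i → part i ℕ.≤ m

open Partition public

infix 4 _∈_ _∈?_
_∈_ : Cell n m → Partition n m → Set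
(i , j) ∈ ν = toℕ j ℕ.< part ν i

_∈?_ : (x : Cell n m) (ν : Partition n m) → Dec (x ∈ ν)
(i , j) ∈? ν = toℕ j ℕ.<? part ν i

cells : Partition n m → List (Cell n m)
cells {n} {m} ν = filter (_∈? ν) (cartesianProduct (allFin n) (allFin m))

∣_∣ : Partition n m → ℕ
∣ ν ∣ = length (cells ν)

rectangle : (j : ℕ) → Partition n m
rectangle {n} {m} j = record
  { part       = length-of-row
  ; decreasing = λ {i} {k} → row-decreasing i k
  ; bounded    = row-bounded
  }
  where
  length-of-row : Fin n → ℕ
  length-of-row i with toℕ i ℕ.<? j
  ... | yes _ = m
  ... | no  _ = 0

  row-decreasing : ∀ i k → i Fin.≤ k → length-of-row k ℕ.≤ length-of-row i
  row-decreasing i k i≤k with toℕ i ℕ.<? j | toℕ k ℕ.<? j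
  ... | yes _  | yes _   = ℕ.≤-refl
  ... | _      | no  _   = ℕ.z≤n
  ... | no i≮j | yes k<j = contradiction (ℕ.≤-<-trans i≤k k<j) i≮j

  row-bounded : ∀ i → length-of-row i ℕ.≤ m
  row-bounded i with toℕ i ℕ.<? j
  ... | yes _ = ℕ.≤-refl
  ... | no  _ = ℕ.z≤n

vectors : List A → (k : ℕ) → List (Vec A k)
vectors xs zero    = [] ∷ []
vectors xs (suc k) = cartesianProductWith _∷_ xs (vectors xs k)

-- Records for each row the column of its rook, if there is one, so that no two
-- rooks share a row.
Placement : ℕ → ℕ → Set
Placement n m = Vec (Maybe (Fin m)) n

HasRook : Placement n m → Cell n m → Set
HasRook p (i , j) = lookup p i ≡ just j

hasRook? : (p : Placement n m) (x : Cell n m) → Dec (HasRook p x)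
hasRook? p (i , j) = Maybe.≡-dec Fin._≟_ (lookup p i) (just j)

OnBoard : Partition n m → Placement n m → Set
OnBoard ν p = ∀ i j → HasRook p (i , j) → (i , j) ∈ ν

onBoard? : (ν : Partition n m) (p : Placement n m) → Dec (OnBoard ν p)
onBoard? ν p = Fin.all? λ i → Fin.all? λ j →
  hasRook? p (i , j) →-dec ((i , j) ∈? ν)

NonAttacking : Placement n m → Set
NonAttacking p = ∀ i k j → HasRook p (i , j) → HasRook p (k , j) → i ≡ k

nonAttacking? : (p : Placement n m) → Dec (NonAttacking p)
nonAttacking? p = Fin.all? λ i → Fin.all? λ k → Fin.all? λ j →
  hasRook? p (i , j) →-dec (hasRook? p (k , j) →-dec (i Fin.≟ k))

rookCount : Placement n m → ℕ
rookCount = Vec.countᵇ is-just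

placements : ℕ → Partition n m → List (Placement n m)
placements {n} {m} k ν =
  filter (λ p → onBoard? ν p ×-dec nonAttacking? p ×-dec (rookCount p ℕ.≟ k))
    (vectors (nothing ∷ map just (allFin m)) n)

-- The cell (i , j) holds the rook (r , c), or lies North of it in its column,
-- or West of it in its row.
Cancelled : Placement n m → Cell n m → Set
Cancelled p (i , j) = ∃₂ λ r c → HasRook p (r , c) ×
  (j ≡ c × i Fin.≤ r ⊎ i ≡ r × j Fin.≤ c)

cancelled? : (p : Placement n m) (x : Cell n m) → Dec (Cancelled p x)
cancelled? p (i , j) = Fin.any? λ r → Fin.any? λ c → hasRook? p (r , c) ×-dec
  ((j Fin.≟ c ×-dec i Fin.≤? r) ⊎-dec (i Fin.≟ r ×-dec j Fin.≤? c))

inv : Partition n m → Placement n m → ℕ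
inv ν p = length (filter (¬? ∘ cancelled? p) (cells ν))

R : ℕ → Partition n m → ℚ⟨q⟩
R k ν = ∑ (map (λ p → q ^ inv ν p) (placements k ν))

module ℚ⟨q⟩[x] where
  open Polynomial ℚ⟨q⟩-rawRing public
  open RawRing rawRing public
    using (_+_; _*_; -_; 0#; 1#) renaming (rawSemiring to polynomialRawSemiring)
  open RawSemiringDefs polynomialRawSemiring public using (sum; product)

open ℚ⟨q⟩[x] using (coeff; const)

-- (x;q)ₖ, as a polynomial in x
qPochhammer : ℕ → ℚ⟨q⟩[x].Poly
qPochhammer k = ℚ⟨q⟩[x].product {k} λ i →
  ℚ⟨q⟩[x].1# ℚ⟨q⟩[x].+ (ℚ⟨q⟩[x].- (ℚ⟨q⟩[x].var ℚ⟨q⟩[x].* const (q ^ toℕ i)))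

-- The truncated subtraction in the exponent of q is exact, since i ≤ n and the
-- numbers are used for n ≤ m only.
hitPolynomial : Partition n m → ℚ⟨q⟩[x].Poly
hitPolynomial {n} {m} ν =
  const ((q ^ ∣ ν ∣) ⁻¹ * [ m ∸ n ]! ⁻¹) ℚ⟨q⟩[x].*
  ℚ⟨q⟩[x].sum {suc n} λ i → let k = toℕ i in
    const (R k ν * [ m ∸ k ]! * (- 1#) ^ k * q ^ (m ℕ.* k ∸ k C 2))
      ℚ⟨q⟩[x].* qPochhammer k

H : ℕ → Partition n m → ℚ⟨q⟩
H j ν = coeff (hitPolynomial ν) j

Vertex : ℕ → ℕ → Set
Vertex n m = Fin (m ℕ.+ n)

-- Vertices are numbered from 0: the first m are the columns of the board, from
-- left to right, and the last n are its rows, from bottom to top.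
NonEdge : Partition n m → Vertex n m → Vertex n m → Set
NonEdge {n} {m} ν a b = ∃₂ λ i j →
  splitAt m a ≡ inj₁ j × splitAt m b ≡ inj₂ (opposite i) × (i , j) ∈ ν

Edge : Partition n m → Vertex n m → Vertex n m → Set
Edge ν a b = a Fin.< b × ¬ NonEdge ν a b

edge? : (ν : Partition n m) (a b : Vertex n m) → Dec (Edge ν a b)
edge? {n} {m} ν a b = a Fin.<? b ×-dec ¬? (Fin.any? λ i → Fin.any? λ j →
  (splitAt m a ≟ inj₁ j) ×-dec (splitAt m b ≟ inj₂ (opposite i)) ×-dec (i , j) ∈? ν)
  where
  _≟_ : (s t : Fin m ⊎ Fin n) → Dec (s ≡ t)
  _≟_ = Sum.≡-dec Fin._≟_ Fin._≟_

-- Series are in the variables x₁, x₂, x₃, …, given by their coefficients.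
-- The list e₁ ∷ … ∷ eᵣ ∷ [] stands for the monomial x₁^e₁ ⋯ xᵣ^eᵣ.
Monomial : Set
Monomial = List ℕ

Series : Set
Series = Monomial → ℚ⟨q⟩

infix 4 _≋_
_≋_ : Series → Series → Set
F ≋ G = ∀ e → F e ≈ G e

infixr 7 _•_
_•_ : ℚ⟨q⟩ → Series → Series
(f • F) e = f * F e

sumSeries : (Fin n → Series) → Series
sumSeries F e = sum λ i → F i e

Coloring : ℕ → ℕ → Set
Coloring N r = Vec (Fin r) N

Proper : ∀ {r} → Partition n m → Coloring (m ℕ.+ n) r → Set
Proper ν κ = ∀ a b → Edge ν a b → lookup κ a ≢ lookup κ b

proper? : ∀ {r} (ν : Partition n m) (κ : Coloring (m ℕ.+ n) r) → Dec (Proper ν κ)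
proper? ν κ = Fin.all? λ a → Fin.all? λ b →
  edge? ν a b →-dec ¬? (lookup κ a Fin.≟ lookup κ b)

asc : ∀ {r} → Partition n m → Coloring (m ℕ.+ n) r → ℕ
asc {n} {m} ν κ = length
  (filter (λ (a , b) → edge? ν a b ×-dec lookup κ a Fin.<? lookup κ b)
    (cartesianProduct (allFin (m ℕ.+ n)) (allFin (m ℕ.+ n))))

HasMonomial : (e : Monomial) → Coloring n (length e) → Set
HasMonomial e κ = ∀ c → Vec.count (c Fin.≟_) κ ≡ List.lookup e c

hasMonomial? : (e : Monomial) (κ : Coloring n (length e)) → Dec (HasMonomial e κ)
hasMonomial? e κ = Fin.all? λ c → Vec.count (c Fin.≟_) κ ℕ.≟ List.lookup e c

-- A coloring contributes to the coefficient of x₁^e₁ ⋯ xᵣ^eᵣ only if all its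
-- colors are among the first r, so finitely many colorings are relevant.
X : Partition n m → Series
X {n} {m} ν e = ∑ (map (λ κ → q ^ asc ν κ)
  (filter (λ κ → proper? ν κ ×-dec hasMonomial? e κ)
    (vectors (allFin (length e)) (m ℕ.+ n))))

module Submission where

-- Write X(λ) for the coefficient of a fixed monomial in the chromatic function
-- of the partition with list of row lengths λ.  Both sides are functions f of λ
-- that satisfy the modular law
--   (1 + q) f(λ¹) = q f(λ²) + f(λ⁰)
-- in two situations: for two consecutive rows, of lengths (x , x) in λ⁰,
-- (x + 1 , x) in λ¹ and (x + 1 , x + 1) in λ²; and for a last row of length x,
-- x + 1, x + 2 below rows of length at least x + 2.
--
-- A function that satisfies these laws and vanishes on the rectangles with j
-- rows of length m, 0 ≤ j ≤ n, vanishes on every partition in the board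
-- (vanishes-on-rectangles).  By induction on n, it vanishes on the partitions
-- whose first row has length m and on those with fewer than n rows; hence, by
-- the row law, also on the rectangle with n ≥ 2 rows of length m - 1, and
-- induction on m applies.  For one row the law is a linear recurrence, whose
-- solutions are determined by two values because no positive power of q is 1.
--
-- The chromatic functions satisfy the laws (coloringSum-rowLaw,
-- coloringSum-columnLaw).  In both situations two consecutive vertices have the
-- same neighbors except for one further vertex, and exchanging the colors of
-- these two vertices changes the sign of the contribution of a coloring to
-- (1 + q) X(λ¹) - q X(λ²) - X(λ⁰), so that this difference is 0 (modular-law).
--
-- The rook numbers, divided by the power of q whose exponent is the size of the
-- partition, satisfy a recursion that adds a first row of length x, in which x
-- enters through an affine function of the power of q with exponent - x
-- (R-normalized).  This implies the two laws for them, and so for the hit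
-- numbers, which are linear combinations of them (row-law, column-law).  By the
-- same recursion, a first row of length m multiplies the hit polynomial by its
-- variable, up to the factorials (unscaledHit-full-row), so that the j-th hit
-- number of the rectangle with i rows is [m]ₙ if i = j and 0 otherwise
-- (hit-rectangle).
-- Therefore the difference of [m]ₙ X(λ) and the sum of the products of hit
-- numbers and chromatic functions of rectangles satisfies the laws and vanishes
-- on all rectangles.

open import Algebra.Bundles using (CommutativeRing)
open import Algebra.Solver.Ring.AlmostCommutativeRing using (fromCommutativeRing; _-Raw-AlmostCommutative⟶_)
open import Data.Bool.Base using (true; false; if_then_else_)
open import Data.Fin.Base as Fin using (Fin; zero; suc; toℕ; fromℕ<; inject₁; opposite; _↑ˡ_; _↑ʳ_)
open import Data.Integer.Base as ℤ using (ℤ; +_; -[1+_])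
open import Data.List.Base as List using (List; []; _∷_; map; filter; length; foldr; _++_; replicate; allFin; tabulate; cartesianProduct; cartesianProductWith)
open import Data.List.Relation.Unary.All as All using (All; []; _∷_)
open import Data.Maybe.Base using (Maybe; just; nothing)
open import Data.Maybe.Properties using (just-injective)
open import Data.Nat.Base as ℕ using (ℕ; zero; suc; _∸_; _≤_; _<_; z≤n; s≤s)
open import Data.Nat.Combinatorics using (_C_; nCk+nC[k+1]≡[n+1]C[k+1]; nC1≡n)
open import Data.Product.Base using (∃; _×_; _,_; proj₁; proj₂)
open import Data.Sum.Base using (_⊎_; inj₁; inj₂; [_,_]′)
open import Data.Sum.Properties using (inj₁-injective; inj₂-injective)
open import Data.Vec.Base as Vec using (Vec; []; _∷_; lookup)
open import Data.Vec.Properties using (lookup-++ˡ; lookup-++ʳ)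
open import Function.Base using (_∘_; id)
open import Function.Bundles using (mk⇔)
open import Level using (Level; _⊔_; 0ℓ) renaming (suc to lsuc)
open import Relation.Binary.Bundles using (Setoid)
open import Relation.Binary.Core using (Rel)
open import Relation.Binary.Definitions using (tri<; tri≈; tri>)
open import Relation.Binary.PropositionalEquality as ≡ using (_≡_; _≢_)
open import Relation.Binary.Structures using (IsEquivalence)
open import Relation.Nullary using (Dec; does; yes; no; ¬_; contradiction)
open import Relation.Nullary.Decidable using (does-⇔; _×-dec_; _→-dec_; ¬?; dec-true; dec-false)
open import Relation.Unary using (Pred; Decidable)
import Algebra.Properties.AbelianGroup
import Algebra.Properties.CommutativeMonoid.Sum
import Algebra.Properties.CommutativeSemigroup
import Algebra.Properties.Ring
import Algebra.Properties.Semiring.Exp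
import Algebra.Properties.Semiring.Mult.TCOptimised
import Algebra.Properties.Semiring.Sum
import Algebra.Solver.Ring
import Data.Fin.Properties as Fin
import Data.Integer.Properties as ℤ
import Data.List.Properties as List
import Data.List.Relation.Unary.All.Properties as All
import Data.Nat.Properties as ℕ
import Relation.Binary.Reasoning.Setoid
open import Defs using (module Polynomial; vectors; Partition; part; decreasing; bounded; rectangle; Cell; cells; ∣_∣; _∈_; _∈?_; Placement; HasRook; hasRook?; OnBoard; onBoard?; NonAttacking; nonAttacking?; rookCount; placements; Cancelled; cancelled?; inv; Edge; edge?; proper?; hasMonomial?; asc)

-- Integer coefficients in the ring solver, and polynomial rings

-- The ring solver with integer coefficients, so that cancellation of
-- opposite terms is recognised in an arbitrary commutative ring.
module IntegerSolver {c ℓ} (A : CommutativeRing c ℓ) where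
  open CommutativeRing A
  open Algebra.Properties.Ring ring
  open Algebra.Properties.AbelianGroup +-abelianGroup using (⁻¹-∙-comm)
  open Algebra.Properties.Semiring.Mult.TCOptimised semiring
    using (×-homo-+; ×1-homo-*) renaming (_×_ to _·_)
  open Relation.Binary.Reasoning.Setoid setoid

  private
    ⟦_⟧ : ℤ → Carrier
    ⟦ + n ⟧      = n · 1#
    ⟦ -[1+ n ] ⟧ = - (suc n · 1#)

    suc-homo : ∀ n → suc n · 1# ≈ 1# + n · 1#
    suc-homo n = ×-homo-+ 1# 1 n

    cancel-one : ∀ x y → x - y ≈ (1# + x) - (1# + y)
    cancel-one x y = begin
      x - y                    ≈⟨ +-congʳ (+-identityˡ x) ⟨
      0# + x - y               ≈⟨ +-congʳ (+-congʳ (-‿inverseʳ 1#)) ⟨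
      1# - 1# + x - y          ≈⟨ +-congʳ (+-assoc _ _ _) ⟩
      1# + (- 1# + x) - y      ≈⟨ +-congʳ (+-congˡ (+-comm _ _)) ⟩
      1# + (x - 1#) - y        ≈⟨ +-congʳ (+-assoc _ _ _) ⟨
      1# + x - 1# - y          ≈⟨ +-assoc _ _ _ ⟩
      1# + x + (- 1# - y)      ≈⟨ +-congˡ (⁻¹-∙-comm 1# y) ⟩
      (1# + x) - (1# + y)      ∎

    ⊖-homo : ∀ m n → ⟦ m ℤ.⊖ n ⟧ ≈ m · 1# - n · 1#
    ⊖-homo zero    zero    = sym (-‿inverseʳ 0#)
    ⊖-homo zero    (suc n) = sym (+-identityˡ _)
    ⊖-homo (suc m) zero    = sym (trans (+-congˡ -0#≈0#) (+-identityʳ _))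
    ⊖-homo (suc m) (suc n) = begin
      ⟦ suc m ℤ.⊖ suc n ⟧            ≡⟨ ≡.cong ⟦_⟧ (ℤ.[1+m]⊖[1+n]≡m⊖n m n) ⟩
      ⟦ m ℤ.⊖ n ⟧                    ≈⟨ ⊖-homo m n ⟩
      m · 1# - n · 1#                ≈⟨ cancel-one _ _ ⟩
      (1# + m · 1#) - (1# + n · 1#)  ≈⟨ +-cong (suc-homo m) (-‿cong (suc-homo n)) ⟨
      suc m · 1# - suc n · 1#        ∎

    -‿homo : ∀ i → ⟦ ℤ.- i ⟧ ≈ - ⟦ i ⟧
    -‿homo (+ zero)  = sym -0#≈0#
    -‿homo (+ suc n) = refl
    -‿homo -[1+ n ]  = sym (-‿involutive _)

    +-homo : ∀ i j → ⟦ i ℤ.+ j ⟧ ≈ ⟦ i ⟧ + ⟦ j ⟧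
    +-homo (+ m)    (+ n)    = ×-homo-+ 1# m n
    +-homo (+ m)    -[1+ n ] = ⊖-homo m (suc n)
    +-homo -[1+ m ] (+ n)    = trans (⊖-homo n (suc m)) (+-comm _ _)
    +-homo -[1+ m ] -[1+ n ] = trans
      (-‿cong (trans (suc-homo (suc (m ℕ.+ n)))
        (trans (+-congˡ (×-homo-+ 1# (suc m) n))
          (trans (sym (+-assoc _ _ _))
            (trans (+-congʳ (+-comm _ _))
              (trans (+-assoc _ _ _) (+-congˡ (sym (suc-homo n)))))))))
      (sym (⁻¹-∙-comm _ _))

    *-homo-+ : ∀ m n → ⟦ + m ℤ.* + n ⟧ ≈ m · 1# * n · 1#
    *-homo-+ m n = trans (reflexive (≡.cong ⟦_⟧ (≡.sym (ℤ.pos-* m n)))) (×1-homo-* m n)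

    *-homo : ∀ i j → ⟦ i ℤ.* j ⟧ ≈ ⟦ i ⟧ * ⟦ j ⟧
    *-homo (+ m)    (+ n)    = *-homo-+ m n
    *-homo (+ m)    -[1+ n ] = begin
      ⟦ + m ℤ.* -[1+ n ] ⟧        ≡⟨ ≡.cong ⟦_⟧ (ℤ.neg-distribʳ-* (+ m) (+ suc n)) ⟨
      ⟦ ℤ.- (+ m ℤ.* + suc n) ⟧   ≈⟨ -‿homo (+ m ℤ.* + suc n) ⟩
      - ⟦ + m ℤ.* + suc n ⟧       ≈⟨ -‿cong (*-homo-+ m (suc n)) ⟩
      - (m · 1# * suc n · 1#)     ≈⟨ -‿distribʳ-* _ _ ⟩
      m · 1# * - (suc n · 1#)     ∎
    *-homo -[1+ m ] (+ n)    = begin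
      ⟦ -[1+ m ] ℤ.* + n ⟧        ≡⟨ ≡.cong ⟦_⟧ (ℤ.neg-distribˡ-* (+ suc m) (+ n)) ⟨
      ⟦ ℤ.- (+ suc m ℤ.* + n) ⟧   ≈⟨ -‿homo (+ suc m ℤ.* + n) ⟩
      - ⟦ + suc m ℤ.* + n ⟧       ≈⟨ -‿cong (*-homo-+ (suc m) n) ⟩
      - (suc m · 1# * n · 1#)     ≈⟨ -‿distribˡ-* _ _ ⟩
      - (suc m · 1#) * n · 1#     ∎
    *-homo -[1+ m ] -[1+ n ] = begin
      ⟦ + suc m ℤ.* + suc n ⟧              ≈⟨ *-homo-+ (suc m) (suc n) ⟩
      suc m · 1# * suc n · 1#              ≈⟨ -‿involutive _ ⟨
      - - (suc m · 1# * suc n · 1#)        ≈⟨ -‿cong (-‿distribʳ-* _ _) ⟩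
      - (suc m · 1# * - (suc n · 1#))      ≈⟨ -‿distribˡ-* _ _ ⟩
      - (suc m · 1#) * - (suc n · 1#)      ∎

    homomorphism : ℤ.+-*-rawRing -Raw-AlmostCommutative⟶ fromCommutativeRing A
    homomorphism = record
      { ⟦_⟧    = ⟦_⟧
      ; +-homo = +-homo
      ; *-homo = *-homo
      ; -‿homo = -‿homo
      ; 0-homo = refl
      ; 1-homo = refl
      }

    coefficient-≟ : ∀ i j → Maybe (⟦ i ⟧ ≈ ⟦ j ⟧)
    coefficient-≟ i j with i ℤ.≟ j
    ... | yes ≡.refl = just refl
    ... | no  _      = nothing

  open Algebra.Solver.Ring ℤ.+-*-rawRing (fromCommutativeRing A) homomorphism coefficient-≟ public
    using (solve; _:=_; _:+_; _:*_; :-_; _:-_; con)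

-- The ring of polynomials over a commutative ring.
module PolynomialRing {c ℓ} (A : CommutativeRing c ℓ) where
  private module A = CommutativeRing A
  open Polynomial A.rawRing public
  open Algebra.Properties.Ring A.ring using (-0#≈0#)

  infix 4 _≃_
  -- Equality of all coefficients, as a record so that both polynomials can be
  -- inferred from a proof.
  record _≃_ (p r : Poly) : Set ℓ where
    constructor coefficients
    field at : ∀ k → coeff p k A.≈ coeff r k
  open _≃_ public

  coeff-⊕ : ∀ p r k → coeff (p ⊕ r) k A.≈ coeff p k A.+ coeff r k
  coeff-⊕ []      r       k       = A.sym (A.+-identityˡ _)
  coeff-⊕ (a ∷ p) []      k       = A.sym (A.+-identityʳ _)
  coeff-⊕ (a ∷ p) (b ∷ r) zero    = A.refl
  coeff-⊕ (a ∷ p) (b ∷ r) (suc k) = coeff-⊕ p r k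

  coeff-map* : ∀ a r k → coeff (map (a A.*_) r) k A.≈ a A.* coeff r k
  coeff-map* a []      k       = A.sym (A.zeroʳ a)
  coeff-map* a (b ∷ r) zero    = A.refl
  coeff-map* a (b ∷ r) (suc k) = coeff-map* a r k

  coeff-neg : ∀ p k → coeff (map (A.-_) p) k A.≈ A.- coeff p k
  coeff-neg []      k       = A.sym -0#≈0#
  coeff-neg (a ∷ p) zero    = A.refl
  coeff-neg (a ∷ p) (suc k) = coeff-neg p k

  ≃-isEquivalence : IsEquivalence _≃_
  ≃-isEquivalence = record
    { refl  = coefficients λ _ → A.refl
    ; sym   = λ h → coefficients λ k → A.sym (at h k)
    ; trans = λ h h′ → coefficients λ k → A.trans (at h k) (at h′ k)
    }

  open IsEquivalence ≃-isEquivalence using (refl; sym; trans)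

  private
    ≃-setoid : Setoid c ℓ
    ≃-setoid = record { isEquivalence = ≃-isEquivalence }
  open Relation.Binary.Reasoning.Setoid ≃-setoid

  ⊕-cong : ∀ {p p′ r r′} → p ≃ p′ → r ≃ r′ → p ⊕ r ≃ p′ ⊕ r′
  ⊕-cong {p} {p′} {r} {r′} h h′ = coefficients λ k →
    A.trans (coeff-⊕ p r k) (A.trans (A.+-cong (at h k) (at h′ k)) (A.sym (coeff-⊕ p′ r′ k)))

  ∷-cong : ∀ {a b p r} → a A.≈ b → p ≃ r → a ∷ p ≃ b ∷ r
  ∷-cong h h′ = coefficients λ { zero → h ; (suc k) → at h′ k }

  map*-cong : ∀ {a b p r} → a A.≈ b → p ≃ r → map (a A.*_) p ≃ map (b A.*_) r
  map*-cong {a} {b} {p} {r} h h′ = coefficients λ k →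
    A.trans (coeff-map* a p k) (A.trans (A.*-cong h (at h′ k)) (A.sym (coeff-map* b r k)))

  ⊕-assoc : ∀ p r s → (p ⊕ r) ⊕ s ≃ p ⊕ (r ⊕ s)
  ⊕-assoc p r s = coefficients λ k → A.trans (coeff-⊕ (p ⊕ r) s k)
    (A.trans (A.+-congʳ (coeff-⊕ p r k))
    (A.trans (A.+-assoc _ _ _)
    (A.trans (A.+-congˡ (A.sym (coeff-⊕ r s k))) (A.sym (coeff-⊕ p (r ⊕ s) k)))))

  ⊕-comm : ∀ p r → p ⊕ r ≃ r ⊕ p
  ⊕-comm p r = coefficients λ k →
    A.trans (coeff-⊕ p r k) (A.trans (A.+-comm _ _) (A.sym (coeff-⊕ r p k)))

  ⊕-identityʳ : ∀ p → p ⊕ [] ≃ p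
  ⊕-identityʳ p = coefficients λ k → A.trans (coeff-⊕ p [] k) (A.+-identityʳ _)

  ⊕-inverseˡ : ∀ p → map (A.-_) p ⊕ p ≃ []
  ⊕-inverseˡ p = coefficients λ k → A.trans (coeff-⊕ (map (A.-_) p) p k)
    (A.trans (A.+-congʳ (coeff-neg p k)) (A.-‿inverseˡ _))

  neg-cong : ∀ {p r} → p ≃ r → map (A.-_) p ≃ map (A.-_) r
  neg-cong {p} {r} h = coefficients λ k →
    A.trans (coeff-neg p k) (A.trans (A.-‿cong (at h k)) (A.sym (coeff-neg r k)))

  ⊕-interchange : ∀ p r s t → (p ⊕ r) ⊕ (s ⊕ t) ≃ (p ⊕ s) ⊕ (r ⊕ t)
  ⊕-interchange p r s t = begin
    (p ⊕ r) ⊕ (s ⊕ t)  ≈⟨ ⊕-assoc p r (s ⊕ t) ⟩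
    p ⊕ (r ⊕ (s ⊕ t))  ≈⟨ ⊕-cong (refl {p}) (sym (⊕-assoc r s t)) ⟩
    p ⊕ ((r ⊕ s) ⊕ t)  ≈⟨ ⊕-cong (refl {p}) (⊕-cong (⊕-comm r s) refl) ⟩
    p ⊕ ((s ⊕ r) ⊕ t)  ≈⟨ ⊕-cong (refl {p}) (⊕-assoc s r t) ⟩
    p ⊕ (s ⊕ (r ⊕ t))  ≈⟨ ⊕-assoc p s (r ⊕ t) ⟨
    (p ⊕ s) ⊕ (r ⊕ t)  ∎

  private
    0∷[] : A.0# ∷ [] ≃ []
    0∷[] = coefficients λ { zero → A.refl ; (suc k) → A.refl }

    0∷-⊕ : ∀ p r → A.0# ∷ (p ⊕ r) ≃ (A.0# ∷ p) ⊕ (A.0# ∷ r)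
    0∷-⊕ p r = ∷-cong (A.sym (A.+-identityˡ _)) refl

    map*-⊕ : ∀ a p r → map (a A.*_) (p ⊕ r) ≃ map (a A.*_) p ⊕ map (a A.*_) r
    map*-⊕ a p r = coefficients λ k → A.trans (coeff-map* a (p ⊕ r) k)
      (A.trans (A.*-congˡ (coeff-⊕ p r k))
      (A.trans (A.distribˡ _ _ _)
      (A.trans (A.sym (A.+-cong (coeff-map* a p k) (coeff-map* a r k)))
        (A.sym (coeff-⊕ (map (a A.*_) p) (map (a A.*_) r) k)))))

    map*-* : ∀ a b p → map ((a A.* b) A.*_) p ≃ map (a A.*_) (map (b A.*_) p)
    map*-* a b p = coefficients λ k → A.trans (coeff-map* (a A.* b) p k)
      (A.trans (A.*-assoc _ _ _)
      (A.trans (A.*-congˡ (A.sym (coeff-map* b p k)))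
        (A.sym (coeff-map* a (map (b A.*_) p) k))))

    map*-0 : ∀ p → map (A.0# A.*_) p ≃ []
    map*-0 p = coefficients λ k → A.trans (coeff-map* A.0# p k) (A.zeroˡ _)

    map*-1 : ∀ p → map (A.1# A.*_) p ≃ p
    map*-1 p = coefficients λ k → A.trans (coeff-map* A.1# p k) (A.*-identityˡ _)

  ⊛-congˡ : ∀ p {r s} → r ≃ s → p ⊛ r ≃ p ⊛ s
  ⊛-congˡ []      h = refl
  ⊛-congˡ (a ∷ p) h = ⊕-cong (map*-cong A.refl h) (∷-cong A.refl (⊛-congˡ p h))

  ⊛-zeroʳ : ∀ p → p ⊛ [] ≃ []
  ⊛-zeroʳ []      = refl
  ⊛-zeroʳ (a ∷ p) = trans (∷-cong A.refl (⊛-zeroʳ p)) 0∷[]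

  ⊛-∷ʳ : ∀ p b r → p ⊛ (b ∷ r) ≃ map (b A.*_) p ⊕ (A.0# ∷ (p ⊛ r))
  ⊛-∷ʳ []      b r = sym 0∷[]
  ⊛-∷ʳ (a ∷ p) b r = ∷-cong (A.+-congʳ (A.*-comm a b)) (begin
    map (a A.*_) r ⊕ (p ⊛ (b ∷ r))
      ≈⟨ ⊕-cong (refl {map (a A.*_) r}) (⊛-∷ʳ p b r) ⟩
    map (a A.*_) r ⊕ (map (b A.*_) p ⊕ (A.0# ∷ (p ⊛ r)))
      ≈⟨ ⊕-assoc (map (a A.*_) r) (map (b A.*_) p) _ ⟨
    (map (a A.*_) r ⊕ map (b A.*_) p) ⊕ (A.0# ∷ (p ⊛ r))
      ≈⟨ ⊕-cong (⊕-comm (map (a A.*_) r) (map (b A.*_) p)) refl ⟩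
    (map (b A.*_) p ⊕ map (a A.*_) r) ⊕ (A.0# ∷ (p ⊛ r))
      ≈⟨ ⊕-assoc (map (b A.*_) p) (map (a A.*_) r) _ ⟩
    map (b A.*_) p ⊕ ((a ∷ p) ⊛ r)
      ∎)

  ⊛-comm : ∀ p r → p ⊛ r ≃ r ⊛ p
  ⊛-comm []      r = sym (⊛-zeroʳ r)
  ⊛-comm (a ∷ p) r = trans
    (⊕-cong (refl {map (a A.*_) r}) (∷-cong A.refl (⊛-comm p r)))
    (sym (⊛-∷ʳ r a p))

  ⊛-cong : ∀ {p p′ r r′} → p ≃ p′ → r ≃ r′ → p ⊛ r ≃ p′ ⊛ r′
  ⊛-cong {p} {p′} {r} {r′} h h′ = begin
    p ⊛ r    ≈⟨ ⊛-congˡ p h′ ⟩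
    p ⊛ r′   ≈⟨ ⊛-comm p r′ ⟩
    r′ ⊛ p   ≈⟨ ⊛-congˡ r′ h ⟩
    r′ ⊛ p′  ≈⟨ ⊛-comm r′ p′ ⟩
    p′ ⊛ r′  ∎

  ⊛-distribˡ : ∀ p r s → p ⊛ (r ⊕ s) ≃ (p ⊛ r) ⊕ (p ⊛ s)
  ⊛-distribˡ []      r s = refl
  ⊛-distribˡ (a ∷ p) r s = begin
    map (a A.*_) (r ⊕ s) ⊕ (A.0# ∷ (p ⊛ (r ⊕ s)))
      ≈⟨ ⊕-cong (map*-⊕ a r s) (trans (∷-cong A.refl (⊛-distribˡ p r s)) (0∷-⊕ (p ⊛ r) (p ⊛ s))) ⟩
    (map (a A.*_) r ⊕ map (a A.*_) s) ⊕ ((A.0# ∷ (p ⊛ r)) ⊕ (A.0# ∷ (p ⊛ s)))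
      ≈⟨ ⊕-interchange (map (a A.*_) r) (map (a A.*_) s) (A.0# ∷ (p ⊛ r)) (A.0# ∷ (p ⊛ s)) ⟩
    ((a ∷ p) ⊛ r) ⊕ ((a ∷ p) ⊛ s)
      ∎

  ⊛-distribʳ : ∀ s p r → (p ⊕ r) ⊛ s ≃ (p ⊛ s) ⊕ (r ⊛ s)
  ⊛-distribʳ s p r = begin
    (p ⊕ r) ⊛ s          ≈⟨ ⊛-comm (p ⊕ r) s ⟩
    s ⊛ (p ⊕ r)          ≈⟨ ⊛-distribˡ s p r ⟩
    (s ⊛ p) ⊕ (s ⊛ r)    ≈⟨ ⊕-cong (⊛-comm s p) (⊛-comm s r) ⟩
    (p ⊛ s) ⊕ (r ⊛ s)    ∎

  map*-⊛ : ∀ a p r → map (a A.*_) p ⊛ r ≃ map (a A.*_) (p ⊛ r)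
  map*-⊛ a []      r = refl
  map*-⊛ a (b ∷ p) r = begin
    map ((a A.* b) A.*_) r ⊕ (A.0# ∷ (map (a A.*_) p ⊛ r))
      ≈⟨ ⊕-cong (map*-* a b r) (∷-cong (A.sym (A.zeroʳ a)) (map*-⊛ a p r)) ⟩
    map (a A.*_) (map (b A.*_) r) ⊕ map (a A.*_) (A.0# ∷ (p ⊛ r))
      ≈⟨ map*-⊕ a (map (b A.*_) r) (A.0# ∷ (p ⊛ r)) ⟨
    map (a A.*_) ((b ∷ p) ⊛ r)
      ∎

  0∷-⊛ : ∀ p r → (A.0# ∷ p) ⊛ r ≃ A.0# ∷ (p ⊛ r)
  0∷-⊛ p r = ⊕-cong (map*-0 r) refl

  ⊛-assoc : ∀ p r s → (p ⊛ r) ⊛ s ≃ p ⊛ (r ⊛ s)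
  ⊛-assoc []      r s = refl
  ⊛-assoc (a ∷ p) r s = begin
    (map (a A.*_) r ⊕ (A.0# ∷ (p ⊛ r))) ⊛ s
      ≈⟨ ⊛-distribʳ s (map (a A.*_) r) (A.0# ∷ (p ⊛ r)) ⟩
    (map (a A.*_) r ⊛ s) ⊕ ((A.0# ∷ (p ⊛ r)) ⊛ s)
      ≈⟨ ⊕-cong (map*-⊛ a r s) (trans (0∷-⊛ (p ⊛ r) s) (∷-cong A.refl (⊛-assoc p r s))) ⟩
    (a ∷ p) ⊛ (r ⊛ s)
      ∎

  const-⊛ : ∀ a p → const a ⊛ p ≃ map (a A.*_) p
  const-⊛ a p = trans (⊕-cong (refl {map (a A.*_) p}) 0∷[]) (⊕-identityʳ _)

  coeff-const-⊛ : ∀ a p k → coeff (const a ⊛ p) k A.≈ a A.* coeff p k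
  coeff-const-⊛ a p k = A.trans (at (const-⊛ a p) k) (coeff-map* a p k)

  ⊛-identityˡ : ∀ p → const A.1# ⊛ p ≃ p
  ⊛-identityˡ p = trans (const-⊛ A.1# p) (map*-1 p)

  commutativeRing : CommutativeRing c ℓ
  commutativeRing = record
    { Carrier = Poly
    ; _≈_     = _≃_
    ; _+_     = _⊕_
    ; _*_     = _⊛_
    ; -_      = map (A.-_)
    ; 0#      = []
    ; 1#      = const A.1#
    ; isCommutativeRing = record
      { isRing = record
        { +-isAbelianGroup = record
          { isGroup = record
            { isMonoid = record
              { isSemigroup = record
                { isMagma = record { isEquivalence = ≃-isEquivalence ; ∙-cong = ⊕-cong }
                ; assoc   = ⊕-assoc
                }
              ; identity = (λ _ → refl) , ⊕-identityʳ
              }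
            ; inverse = ⊕-inverseˡ , (λ p → trans (⊕-comm p _) (⊕-inverseˡ p))
            ; ⁻¹-cong = neg-cong
            }
          ; comm = ⊕-comm
          }
        ; *-cong     = ⊛-cong
        ; *-assoc    = ⊛-assoc
        ; *-identity = ⊛-identityˡ , (λ p → trans (⊛-comm p _) (⊛-identityˡ p))
        ; distrib    = ⊛-distribˡ , ⊛-distribʳ
        }
      ; *-comm = ⊛-comm
      }
    }

-- Fields with a parameter q, and the field of rational functions in q

-- A field of characteristic different from 2 with a nonzero element q, no
-- positive power of which is 1.  The value of the inverse at 0 is arbitrary.
record QField c ℓ : Set (lsuc (c ⊔ ℓ)) where
  infix 8 _⁻¹
  field
    commutativeRing : CommutativeRing c ℓ
  open CommutativeRing commutativeRing hiding (zero) public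
  open Algebra.Properties.Semiring.Exp semiring using (_^_)
  field
    q         : Carrier
    _⁻¹       : Carrier → Carrier
    *-inverse : ∀ x → ¬ x ≈ 0# → x * x ⁻¹ ≈ 1#
    q≉0       : ¬ q ≈ 0#
    1-q^≉0    : ∀ k → ¬ 1# - q ^ suc k ≈ 0#
    1+1≉0     : ¬ 1# + 1# ≈ 0#
    1≉0       : ¬ 1# ≈ 0#

  open Relation.Binary.Reasoning.Setoid setoid

  *-inverseˡ : ∀ x → ¬ x ≈ 0# → x ⁻¹ * x ≈ 1#
  *-inverseˡ x x≉0 = trans (*-comm _ _) (*-inverse x x≉0)

  cancel-≉0 : ∀ x y → ¬ x ≈ 0# → x * y ≈ 0# → y ≈ 0#
  cancel-≉0 x y x≉0 h = begin
    y                 ≈⟨ *-identityˡ y ⟨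
    1# * y            ≈⟨ *-congʳ (*-inverseˡ x x≉0) ⟨
    x ⁻¹ * x * y      ≈⟨ *-assoc _ _ _ ⟩
    x ⁻¹ * (x * y)    ≈⟨ *-congˡ h ⟩
    x ⁻¹ * 0#         ≈⟨ zeroʳ _ ⟩
    0#                ∎

  *-≉0 : ∀ x y → ¬ x ≈ 0# → ¬ y ≈ 0# → ¬ x * y ≈ 0#
  *-≉0 x y x≉0 y≉0 h = y≉0 (cancel-≉0 x y x≉0 h)

  ⁻¹-≉0 : ∀ x → ¬ x ≈ 0# → ¬ x ⁻¹ ≈ 0#
  ⁻¹-≉0 x x≉0 h = 1≉0 (trans (sym (*-inverse x x≉0)) (trans (*-congˡ h) (zeroʳ x)))

  halve : ∀ x → x + x ≈ 0# → x ≈ 0#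
  halve x h = cancel-≉0 (1# + 1#) x 1+1≉0 (begin
    (1# + 1#) * x     ≈⟨ distribʳ _ _ _ ⟩
    1# * x + 1# * x   ≈⟨ +-cong (*-identityˡ x) (*-identityˡ x) ⟩
    x + x             ≈⟨ h ⟩
    0#                ∎)

-- The identities between numerators and denominators that make the fractions
-- over an integral domain a commutative ring.
module CrossMultiplication {c ℓ} (A : CommutativeRing c ℓ) where
  open CommutativeRing A
  open Algebra.Properties.Ring ring using (x∙y⁻¹≈ε⇒x≈y)
  open IntegerSolver A
  open Relation.Binary.Reasoning.Setoid setoid

  cross-difference : ∀ a b c d e f → a * d ≈ c * b → c * f ≈ e * d →
    d * (a * f - e * b) ≈ 0#
  cross-difference a b c d e f h h′ = begin
    d * (a * f - e * b)
      ≈⟨ solve 5 (λ a b d e f →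
           d :* (a :* f :- e :* b) := (a :* d) :* f :- (e :* d) :* b) refl a b d e f ⟩
    (a * d) * f - (e * d) * b
      ≈⟨ +-cong (*-congʳ h) (-‿cong (*-congʳ (sym h′))) ⟩
    (c * b) * f - (c * f) * b
      ≈⟨ solve 3 (λ b c f → (c :* b) :* f :- (c :* f) :* b := con (+ 0)) refl b c f ⟩
    0#
      ∎

  cross-trans : (∀ x y → x * y ≈ 0# → x ≈ 0# ⊎ y ≈ 0#) →
    ∀ a b c d e f → ¬ d ≈ 0# → a * d ≈ c * b → c * f ≈ e * d → a * f ≈ e * b
  cross-trans integral a b c d e f d≉0 h h′ =
    [ (λ d≈0 → contradiction d≈0 d≉0) , x∙y⁻¹≈ε⇒x≈y _ _ ]′
      (integral d (a * f - e * b) (cross-difference a b c d e f h h′))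

  cross-+ : ∀ a b c d a′ b′ c′ d′ → a * b′ ≈ a′ * b → c * d′ ≈ c′ * d →
    (a * d + c * b) * (b′ * d′) ≈ (a′ * d′ + c′ * b′) * (b * d)
  cross-+ a b c d a′ b′ c′ d′ h h′ = begin
    (a * d + c * b) * (b′ * d′)
      ≈⟨ solve 6 (λ a b c d b′ d′ → (a :* d :+ c :* b) :* (b′ :* d′)
           := (a :* b′) :* (d :* d′) :+ (c :* d′) :* (b :* b′)) refl a b c d b′ d′ ⟩
    (a * b′) * (d * d′) + (c * d′) * (b * b′)
      ≈⟨ +-cong (*-congʳ h) (*-congʳ h′) ⟩
    (a′ * b) * (d * d′) + (c′ * d) * (b * b′)
      ≈⟨ solve 6 (λ a b c d b′ d′ → (a :* b) :* (d :* d′) :+ (c :* d) :* (b :* b′)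
           := (a :* d′ :+ c :* b′) :* (b :* d)) refl a′ b c′ d b′ d′ ⟩
    (a′ * d′ + c′ * b′) * (b * d)
      ∎

  cross-* : ∀ a b c d a′ b′ c′ d′ → a * b′ ≈ a′ * b → c * d′ ≈ c′ * d →
    (a * c) * (b′ * d′) ≈ (a′ * c′) * (b * d)
  cross-* a b c d a′ b′ c′ d′ h h′ = begin
    (a * c) * (b′ * d′)
      ≈⟨ solve 4 (λ a c b′ d′ → (a :* c) :* (b′ :* d′) := (a :* b′) :* (c :* d′)) refl a c b′ d′ ⟩
    (a * b′) * (c * d′)
      ≈⟨ *-cong h h′ ⟩
    (a′ * b) * (c′ * d)
      ≈⟨ solve 4 (λ a c b d → (a :* b) :* (c :* d) := (a :* c) :* (b :* d)) refl a′ c′ b d ⟩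
    (a′ * c′) * (b * d)
      ∎

  cross-neg : ∀ a b a′ b′ → a * b′ ≈ a′ * b → - a * b′ ≈ - a′ * b
  cross-neg a b a′ b′ h = begin
    - a * b′    ≈⟨ solve 2 (λ a b → :- a :* b := :- (a :* b)) refl a b′ ⟩
    - (a * b′)  ≈⟨ -‿cong h ⟩
    - (a′ * b)  ≈⟨ solve 2 (λ a b → :- (a :* b) := :- a :* b) refl a′ b ⟩
    - a′ * b    ∎

  cross-+-assoc : ∀ a b c d e f →
    ((a * d + c * b) * f + e * (b * d)) * (b * (d * f)) ≈
    (a * (d * f) + (c * f + e * d) * b) * ((b * d) * f)
  cross-+-assoc = solve 6 (λ a b c d e f →
    ((a :* d :+ c :* b) :* f :+ e :* (b :* d)) :* (b :* (d :* f)) :=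
    (a :* (d :* f) :+ (c :* f :+ e :* d) :* b) :* ((b :* d) :* f)) refl

  cross-+-comm : ∀ a b c d → (a * d + c * b) * (d * b) ≈ (c * b + a * d) * (b * d)
  cross-+-comm = solve 4 (λ a b c d →
    (a :* d :+ c :* b) :* (d :* b) := (c :* b :+ a :* d) :* (b :* d)) refl

  cross-+-identityˡ : ∀ a b → (0# * b + a * 1#) * b ≈ a * (1# * b)
  cross-+-identityˡ = solve 2 (λ a b →
    (con (+ 0) :* b :+ a :* con (+ 1)) :* b := a :* (con (+ 1) :* b)) refl

  cross-inverseˡ : ∀ a b → (- a * b + a * b) * 1# ≈ 0# * (b * b)
  cross-inverseˡ = solve 2 (λ a b →
    (:- a :* b :+ a :* b) :* con (+ 1) := con (+ 0) :* (b :* b)) refl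

  cross-*-assoc : ∀ a b c d e f →
    ((a * c) * e) * (b * (d * f)) ≈ (a * (c * e)) * ((b * d) * f)
  cross-*-assoc = solve 6 (λ a b c d e f →
    ((a :* c) :* e) :* (b :* (d :* f)) := (a :* (c :* e)) :* ((b :* d) :* f)) refl

  cross-*-comm : ∀ a b c d → (a * c) * (d * b) ≈ (c * a) * (b * d)
  cross-*-comm = solve 4 (λ a b c d →
    (a :* c) :* (d :* b) := (c :* a) :* (b :* d)) refl

  cross-*-identityˡ : ∀ a b → (1# * a) * b ≈ a * (1# * b)
  cross-*-identityˡ = solve 2 (λ a b →
    (con (+ 1) :* a) :* b := a :* (con (+ 1) :* b)) refl

  cross-distribˡ : ∀ a b c d e f →
    (a * (c * f + e * d)) * ((b * d) * (b * f)) ≈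
    ((a * c) * (b * f) + (a * e) * (b * d)) * (b * (d * f))
  cross-distribˡ = solve 6 (λ a b c d e f →
    (a :* (c :* f :+ e :* d)) :* ((b :* d) :* (b :* f)) :=
    ((a :* c) :* (b :* f) :+ (a :* e) :* (b :* d)) :* (b :* (d :* f))) refl

  cross-inverse : ∀ a b → (a * b) * 1# ≈ 1# * (b * a)
  cross-inverse = solve 2 (λ a b →
    (a :* b) :* con (+ 1) := con (+ 1) :* (b :* a)) refl

-- The same ring with an equivalent equality.  Equality of fractions is handled
-- as a record below, but polynomials over the field of fractions are formed with
-- the underlying relation, which is not a record.
withEquality : ∀ {c ℓ} (A : CommutativeRing c ℓ) (_∼_ : Rel (CommutativeRing.Carrier A) ℓ) →
  (∀ {x y} → CommutativeRing._≈_ A x y → x ∼ y) →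
  (∀ {x y} → x ∼ y → CommutativeRing._≈_ A x y) → CommutativeRing c ℓ
withEquality A _∼_ to from = record
  { Carrier = A.Carrier
  ; _≈_     = _∼_
  ; _+_     = A._+_
  ; _*_     = A._*_
  ; -_      = A.-_
  ; 0#      = A.0#
  ; 1#      = A.1#
  ; isCommutativeRing = record
    { isRing = record
      { +-isAbelianGroup = record
        { isGroup = record
          { isMonoid = record
            { isSemigroup = record
              { isMagma = record
                { isEquivalence = record
                  { refl  = to A.refl
                  ; sym   = λ h → to (A.sym (from h))
                  ; trans = λ h h′ → to (A.trans (from h) (from h′))
                  }
                ; ∙-cong = λ h h′ → to (A.+-cong (from h) (from h′))
                }
              ; assoc = λ x y z → to (A.+-assoc x y z)
              }
            ; identity = (λ x → to (A.+-identityˡ x)) , (λ x → to (A.+-identityʳ x))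
            }
          ; inverse = (λ x → to (A.-‿inverseˡ x)) , (λ x → to (A.-‿inverseʳ x))
          ; ⁻¹-cong = λ h → to (A.-‿cong (from h))
          }
        ; comm = λ x y → to (A.+-comm x y)
        }
      ; *-cong     = λ h h′ → to (A.*-cong (from h) (from h′))
      ; *-assoc    = λ x y z → to (A.*-assoc x y z)
      ; *-identity = (λ x → to (A.*-identityˡ x)) , (λ x → to (A.*-identityʳ x))
      ; distrib    = (λ x y z → to (A.distribˡ x y z)) , (λ x y z → to (A.distribʳ x y z))
      }
    ; *-comm = λ x y → to (A.*-comm x y)
    }
  }
  where module A = CommutativeRing A

-- The field of fractions of ℤ[q].
module ℚ⟨q⟩-Ring where
  open Defs
  open PolynomialRing ℤ.+-*-commutativeRing public
    using (_≃_; coefficients; at) renaming (commutativeRing to ℤ[q]-ring)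
  private
    module P = CommutativeRing ℤ[q]-ring
  open CrossMultiplication ℤ[q]-ring
  open ℚ⟨q⟩

  infix 4 _≐_
  -- Equality of fractions, as a record so that both sides can be inferred from
  -- a proof.
  record _≐_ (f g : ℚ⟨q⟩) : Set where
    constructor cross
    field cross⁻ : num f ℤ[q].* den g ≃ num g ℤ[q].* den f
  open _≐_ public

  ≐⇒≈ : ∀ {f g} → f ≐ g → f ≈ g
  ≐⇒≈ h = at (cross⁻ h)

  ≈⇒≐ : ∀ {f g} → f ≈ g → f ≐ g
  ≈⇒≐ h = cross (coefficients h)

  integral : ∀ p r → p ℤ[q].* r ≃ [] → p ≃ [] ⊎ r ≃ []
  integral p r h with ℤ[q].*≈0⇒≈0 p r (at h)
  ... | inj₁ p≈0 = inj₁ (coefficients p≈0)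
  ... | inj₂ r≈0 = inj₂ (coefficients r≈0)

  private
    trans : ∀ f g h → f ≐ g → g ≐ h → f ≐ h
    trans f g h (cross p) (cross r) = cross
      (cross-trans integral (num f) (den f) (num g) (den g) (num h) (den h)
        (λ d≈0 → den≉0 g (at d≈0)) p r)

    +-cong : ∀ f f′ g g′ → f ≐ f′ → g ≐ g′ → f + g ≐ f′ + g′
    +-cong f f′ g g′ (cross h) (cross h′) = cross
      (cross-+ (num f) (den f) (num g) (den g) (num f′) (den f′) (num g′) (den g′) h h′)

    *-cong : ∀ f f′ g g′ → f ≐ f′ → g ≐ g′ → f * g ≐ f′ * g′
    *-cong f f′ g g′ (cross h) (cross h′) = cross
      (cross-* (num f) (den f) (num g) (den g) (num f′) (den f′) (num g′) (den g′) h h′)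

    neg-cong : ∀ f g → f ≐ g → - f ≐ - g
    neg-cong f g (cross h) = cross (cross-neg (num f) (den f) (num g) (den g) h)

    +-assoc : ∀ f g h → (f + g) + h ≐ f + (g + h)
    +-assoc f g h = cross
      (cross-+-assoc (num f) (den f) (num g) (den g) (num h) (den h))

    *-assoc : ∀ f g h → (f * g) * h ≐ f * (g * h)
    *-assoc f g h = cross
      (cross-*-assoc (num f) (den f) (num g) (den g) (num h) (den h))

    +-comm : ∀ f g → f + g ≐ g + f
    +-comm f g = cross (cross-+-comm (num f) (den f) (num g) (den g))

    +-identityˡ : ∀ f → 0# + f ≐ f
    +-identityˡ f = cross (cross-+-identityˡ (num f) (den f))

    +-inverseˡ : ∀ f → - f + f ≐ 0#
    +-inverseˡ f = cross (cross-inverseˡ (num f) (den f))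

    *-comm : ∀ f g → f * g ≐ g * f
    *-comm f g = cross (cross-*-comm (num f) (den f) (num g) (den g))

    *-identityˡ : ∀ f → 1# * f ≐ f
    *-identityˡ f = cross (cross-*-identityˡ (num f) (den f))

    *-distribˡ : ∀ f g h → f * (g + h) ≐ f * g + f * h
    *-distribˡ f g h = cross
      (cross-distribˡ (num f) (den f) (num g) (den g) (num h) (den h))

  ring : CommutativeRing 0ℓ 0ℓ
  ring = record
    { Carrier = ℚ⟨q⟩
    ; _≈_     = _≐_
    ; _+_     = _+_
    ; _*_     = _*_
    ; -_      = -_
    ; 0#      = 0#
    ; 1#      = 1#
    ; isCommutativeRing = record
      { isRing = record
        { +-isAbelianGroup = record
          { isGroup = record
            { isMonoid = record
              { isSemigroup = record
                { isMagma = record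
                  { isEquivalence = record
                    { refl  = cross P.refl
                    ; sym   = λ h → cross (P.sym (cross⁻ h))
                    ; trans = λ {f} {g} {h} → trans f g h
                    }
                  ; ∙-cong = λ {f} {f′} {g} {g′} → +-cong f f′ g g′
                  }
                ; assoc = +-assoc
                }
              ; identity = +-identityˡ , λ f → trans (f + 0#) (0# + f) f (+-comm f 0#) (+-identityˡ f)
              }
            ; inverse = +-inverseˡ , λ f → trans (f + - f) (- f + f) 0# (+-comm f (- f)) (+-inverseˡ f)
            ; ⁻¹-cong = λ {f} {g} → neg-cong f g
            }
          ; comm = +-comm
          }
        ; *-cong = λ {f} {f′} {g} {g′} → *-cong f f′ g g′
        ; *-assoc = *-assoc
        ; *-identity = *-identityˡ , λ f → trans (f * 1#) (1# * f) f (*-comm f 1#) (*-identityˡ f)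
        ; distrib = *-distribˡ , λ f g h →
            trans ((g + h) * f) (f * (g + h)) (g * f + h * f) (*-comm (g + h) f)
              (trans (f * (g + h)) (f * g + f * h) (g * f + h * f) (*-distribˡ f g h)
                (+-cong (f * g) (g * f) (f * h) (h * f) (*-comm f g) (*-comm f h)))
        }
      ; *-comm = *-comm
      }
    }
  private
    module K = CommutativeRing ring

  num≉0 : ∀ f → ¬ f ≐ 0# → num f ℤ[q].≉ ℤ[q].0#
  num≉0 f f≉0 h = f≉0 (cross (P.trans (P.*-identityʳ (num f)) (coefficients h)))

  *-inverseʳ : ∀ f → ¬ f ≐ 0# → f * f ⁻¹ ≐ 1#
  *-inverseʳ f f≉0 with ℤ[q].zero? (num f)
  ... | yes num≈0 = contradiction num≈0 (num≉0 f f≉0)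
  ... | no  _     = cross (cross-inverse (num f) (den f))

  fromPoly-cong : ∀ {p r} → p ≃ r → fromPoly p ≐ fromPoly r
  fromPoly-cong h = cross (P.*-congʳ h)

  fromPoly≐0 : ∀ {p} → fromPoly p ≐ 0# → p ≃ []
  fromPoly≐0 {p} (cross h) = P.trans (P.sym (P.*-identityʳ p)) h

  fromPoly-+ : ∀ p r → fromPoly p + fromPoly r ≐ fromPoly (p ℤ[q].+ r)
  fromPoly-+ p r = cross (P.*-cong
    (P.+-cong (P.*-identityʳ p) (P.*-identityʳ r)) (P.sym (P.*-identityˡ ℤ[q].1#)))

  fromPoly-* : ∀ p r → fromPoly p * fromPoly r ≐ fromPoly (p ℤ[q].* r)
  fromPoly-* p r = cross (P.*-congˡ {p ℤ[q].* r} (P.sym (P.*-identityˡ ℤ[q].1#)))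

  fromPoly≉0 : ∀ p k → ℤ[q].coeff p k ≢ + 0 → ¬ fromPoly p ≐ 0#
  fromPoly≉0 p k h h′ = h (at (fromPoly≐0 {p} h′) k)

  -- The power of q with exponent k, as a list of coefficients.
  monomial : ℕ → ℤ[q].Poly
  monomial zero    = ℤ[q].1#
  monomial (suc k) = + 0 ∷ monomial k

  private
    var-* : ∀ p → ℤ[q].var ℤ[q].* p ≃ + 0 ∷ p
    var-* p = P.trans {ℤ[q].var ℤ[q].* p} {+ 0 ∷ (ℤ[q].1# ℤ[q].* p)}
      (PolynomialRing.0∷-⊛ ℤ.+-*-commutativeRing ℤ[q].1# p)
      (PolynomialRing.∷-cong ℤ.+-*-commutativeRing ≡.refl (P.*-identityˡ p))

  q^≐monomial : ∀ k → q ^ k ≐ fromPoly (monomial k)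
  q^≐monomial zero    = K.refl {1#}
  q^≐monomial (suc k) =
    trans (q * q ^ k) (q * fromPoly (monomial k)) (fromPoly (monomial (suc k)))
      (*-cong q q (q ^ k) (fromPoly (monomial k)) (K.refl {q}) (q^≐monomial k))
      (trans (q * fromPoly (monomial k)) (fromPoly (ℤ[q].var ℤ[q].* monomial k)) (fromPoly (monomial (suc k)))
        (fromPoly-* ℤ[q].var (monomial k))
        (fromPoly-cong (var-* (monomial k))))

  1-q^≐ : ∀ k → 1# - q ^ k ≐ fromPoly (ℤ[q].1# ℤ[q].+ ℤ[q].- monomial k)
  1-q^≐ k = trans (1# - q ^ k) (1# - fromPoly (monomial k)) _
    (+-cong 1# 1# (- (q ^ k)) (- fromPoly (monomial k)) (K.refl {1#})
      (neg-cong (q ^ k) (fromPoly (monomial k)) (q^≐monomial k)))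
    (fromPoly-+ ℤ[q].1# (ℤ[q].- monomial k))

  1-q^≉0 : ∀ k → ¬ 1# - q ^ suc k ≐ 0#
  1-q^≉0 k h = fromPoly≉0 (ℤ[q].1# ℤ[q].+ ℤ[q].- monomial (suc k)) 0 (λ ())
    (trans (fromPoly (ℤ[q].1# ℤ[q].+ ℤ[q].- monomial (suc k))) (1# - q ^ suc k) 0#
      (K.sym {1# - q ^ suc k} (1-q^≐ (suc k))) h)

  q≉0 : ¬ q ≐ 0#
  q≉0 = fromPoly≉0 ℤ[q].var 1 λ ()

  2≉0 : ¬ 1# + 1# ≐ 0#
  2≉0 h = fromPoly≉0 (ℤ[q].1# ℤ[q].+ ℤ[q].1#) 0 (λ ())
    (trans (fromPoly (ℤ[q].1# ℤ[q].+ ℤ[q].1#)) (1# + 1#) 0#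
      (K.sym {1# + 1#} (fromPoly-+ ℤ[q].1# ℤ[q].1#)) h)

  1≉0 : ¬ 1# ≐ 0#
  1≉0 = fromPoly≉0 ℤ[q].1# 0 λ ()

  qField : QField 0ℓ 0ℓ
  qField = record
    { commutativeRing = withEquality ring _≈_ ≐⇒≈ ≈⇒≐
    ; q         = q
    ; _⁻¹       = _⁻¹
    ; *-inverse = λ f f≉0 → ≐⇒≈ (*-inverseʳ f λ h → f≉0 (≐⇒≈ h))
    ; q≉0       = λ h → q≉0 (≈⇒≐ {q} {0#} h)
    ; 1-q^≉0    = λ k h → 1-q^≉0 k (≈⇒≐ {1# - q ^ suc k} {0#} h)
    ; 1+1≉0     = λ h → 2≉0 (≈⇒≐ {1# + 1#} {0#} h)
    ; 1≉0       = λ h → 1≉0 (≈⇒≐ {1#} {0#} h)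
    }

-- Finite sums and products

module Sums {c ℓ} (K : CommutativeRing c ℓ) where
  open CommutativeRing K hiding (zero)
  open Algebra.Properties.Semiring.Sum semiring public
    using (sum; *-distribˡ-sum)
  open Algebra.Properties.CommutativeMonoid.Sum *-commutativeMonoid public
    using () renaming
    (sum to product; ∑-distrib-+ to product-*; ∑-comm to product-comm)
  open Algebra.Properties.Semiring.Exp semiring public using (_^_; ^-homo-*)
  open Algebra.Properties.CommutativeSemigroup *-commutativeSemigroup public
    using () renaming (interchange to *-interchange; x∙yz≈y∙xz to x*[y*z]≈y*[x*z])
  open Algebra.Properties.CommutativeSemigroup +-commutativeSemigroup public
    using () renaming (interchange to +-interchange)
  open Relation.Binary.Reasoning.Setoid setoid
  private
    variable
      p : Level
      n m : ℕ

  sum-cong : {f g : Fin n → Carrier} → (∀ i → f i ≈ g i) → sum f ≈ sum g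
  sum-cong = Algebra.Properties.Semiring.Sum.sum-cong-≋ semiring

  product-cong : {f g : Fin n → Carrier} → (∀ i → f i ≈ g i) → product f ≈ product g
  product-cong = Algebra.Properties.CommutativeMonoid.Sum.sum-cong-≋ *-commutativeMonoid

  sum-0 : {f : Fin n → Carrier} → (∀ i → f i ≈ 0#) → sum f ≈ 0#
  sum-0 {zero}  h = refl
  sum-0 {suc n} h = trans (+-cong (h zero) (sum-0 (h ∘ suc))) (+-identityˡ 0#)

  product-1 : {f : Fin n → Carrier} → (∀ i → f i ≈ 1#) → product f ≈ 1#
  product-1 {zero}  h = refl
  product-1 {suc n} h = trans (*-cong (h zero) (product-1 (h ∘ suc))) (*-identityˡ 1#)

  product-++ : ∀ m {n} (f : Fin (m ℕ.+ n) → Carrier) →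
    product f ≈ product (λ i → f (i ↑ˡ n)) * product (λ j → f (m ↑ʳ j))
  product-++ zero    f = sym (*-identityˡ _)
  product-++ (suc m) f = trans (*-congˡ (product-++ m (f ∘ suc))) (sym (*-assoc _ _ _))

  -- Two products that differ in one factor only, which is 1 in the second.
  product-insert : (i : Fin n) (f g : Fin n → Carrier) → (∀ k → k ≢ i → f k ≈ g k) → g i ≈ 1# →
    product f ≈ f i * product g
  product-insert zero    f g h gi = *-congˡ (trans (product-cong (λ k → h (suc k) λ ()))
    (trans (sym (*-identityˡ _)) (*-congʳ (sym gi))))
  product-insert (suc i) f g h gi = begin
    f zero * product (f ∘ suc)                ≈⟨ *-cong (h zero λ ())
      (product-insert i (f ∘ suc) (g ∘ suc) (λ k k≢i → h (suc k) (k≢i ∘ Fin.suc-injective)) gi) ⟩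
    g zero * (f (suc i) * product (g ∘ suc))  ≈⟨ x*[y*z]≈y*[x*z] _ _ _ ⟩
    f (suc i) * (g zero * product (g ∘ suc))  ∎

  -- x if the decided proposition holds, y otherwise.
  choose : {P : Set p} → Dec P → Carrier → Carrier → Carrier
  choose d x y = if does d then x else y

  -- The indicator of a decided proposition.
  χ : {P : Set p} → Dec P → Carrier
  χ d = choose d 1# 0#

  choose-⇔ : ∀ {p q} {P : Set p} {Q : Set q} (d : Dec P) (e : Dec Q) {x y} → (P → Q) → (Q → P) →
    choose d x y ≈ choose e x y
  choose-⇔ d e f g = reflexive (≡.cong (λ b → if b then _ else _) (does-⇔ (mk⇔ f g) d e))

  choose-yes : {P : Set p} (d : Dec P) {x y : Carrier} → P → choose d x y ≈ x
  choose-yes d h = reflexive (≡.cong (λ b → if b then _ else _) (dec-true d h))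

  choose-no : {P : Set p} (d : Dec P) {x y : Carrier} → ¬ P → choose d x y ≈ y
  choose-no d h = reflexive (≡.cong (λ b → if b then _ else _) (dec-false d h))

  choose-cong : {P : Set p} (d : Dec P) {x x′ y y′ : Carrier} → (P → x ≈ x′) → (¬ P → y ≈ y′) →
    choose d x y ≈ choose d x′ y′
  choose-cong (yes h) f g = f h
  choose-cong (no h)  f g = g h

  χ-× : ∀ {p q} {P : Set p} {Q : Set q} (d : Dec P) (e : Dec Q) → χ (d ×-dec e) ≈ χ d * χ e
  χ-× (yes _) e = sym (*-identityˡ _)
  χ-× (no _)  e = sym (zeroˡ _)

  χ-all : {P : Fin n → Set p} (d : ∀ i → Dec (P i)) → χ (Fin.all? d) ≈ product (λ i → χ (d i))
  χ-all {n = zero}  d = refl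
  χ-all {n = suc n} d = begin
    χ (Fin.all? d)
      ≈⟨ choose-⇔ (Fin.all? d) (d zero ×-dec Fin.all? (d ∘ suc))
           (λ h → h zero , h ∘ suc)
           (λ { (h , hs) zero → h ; (h , hs) (suc i) → hs i }) ⟩
    χ (d zero ×-dec Fin.all? (d ∘ suc))      ≈⟨ χ-× (d zero) (Fin.all? (d ∘ suc)) ⟩
    χ (d zero) * χ (Fin.all? (d ∘ suc))      ≈⟨ *-congˡ (χ-all (d ∘ suc)) ⟩
    product (λ i → χ (d i))                  ∎

  module _ {a} {A : Set a} where

    -- Sums and products over a list.
    ∑ : List A → (A → Carrier) → Carrier
    ∑ xs f = foldr _+_ 0# (map f xs)

    ∏ : List A → (A → Carrier) → Carrier
    ∏ xs f = foldr _*_ 1# (map f xs)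

    ∑-cong : ∀ xs {f g : A → Carrier} → (∀ x → f x ≈ g x) → ∑ xs f ≈ ∑ xs g
    ∑-cong []       h = refl
    ∑-cong (x ∷ xs) h = +-cong (h x) (∑-cong xs h)

    ∑-++ : ∀ xs ys (f : A → Carrier) → ∑ (xs ++ ys) f ≈ ∑ xs f + ∑ ys f
    ∑-++ []       ys f = sym (+-identityˡ _)
    ∑-++ (x ∷ xs) ys f = trans (+-congˡ (∑-++ xs ys f)) (sym (+-assoc _ _ _))

    ∏-++ : ∀ xs ys (f : A → Carrier) → ∏ (xs ++ ys) f ≈ ∏ xs f * ∏ ys f
    ∏-++ []       ys f = sym (*-identityˡ _)
    ∏-++ (x ∷ xs) ys f = trans (*-congˡ (∏-++ xs ys f)) (sym (*-assoc _ _ _))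

    ∑-+ : ∀ xs (f g : A → Carrier) → ∑ xs (λ x → f x + g x) ≈ ∑ xs f + ∑ xs g
    ∑-+ []       f g = sym (+-identityˡ 0#)
    ∑-+ (x ∷ xs) f g = trans (+-congˡ (∑-+ xs f g)) (+-interchange _ _ _ _)

    ∑-* : ∀ k xs (f : A → Carrier) → ∑ xs (λ x → k * f x) ≈ k * ∑ xs f
    ∑-* k []       f = sym (zeroʳ k)
    ∑-* k (x ∷ xs) f = trans (+-congˡ (∑-* k xs f)) (sym (distribˡ _ _ _))

    ∑-0 : ∀ xs {f : A → Carrier} → (∀ x → f x ≈ 0#) → ∑ xs f ≈ 0#
    ∑-0 []       h = refl
    ∑-0 (x ∷ xs) h = trans (+-cong (h x) (∑-0 xs h)) (+-identityˡ 0#)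

    ∑-filter : ∀ {P : A → Set p} (P? : ∀ x → Dec (P x)) xs f →
      ∑ (filter P? xs) f ≈ ∑ xs (λ x → χ (P? x) * f x)
    ∑-filter P? []       f = refl
    ∑-filter P? (x ∷ xs) f with does (P? x)
    ... | true  = +-cong (sym (*-identityˡ _)) (∑-filter P? xs f)
    ... | false = trans (∑-filter P? xs f) (trans (sym (+-identityˡ _)) (+-congʳ (sym (zeroˡ _))))

    ^-length-filter : ∀ {P : A → Set p} q (P? : ∀ x → Dec (P x)) xs →
      q ^ length (filter P? xs) ≈ ∏ xs (λ x → choose (P? x) q 1#)
    ^-length-filter q P? []       = refl
    ^-length-filter q P? (x ∷ xs) with does (P? x)
    ... | true  = *-congˡ (^-length-filter q P? xs)
    ... | false = trans (^-length-filter q P? xs) (sym (*-identityˡ _))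

    ∏-filter : ∀ {P : A → Set p} (P? : ∀ x → Dec (P x)) xs f →
      ∏ (filter P? xs) f ≈ ∏ xs (λ x → choose (P? x) (f x) 1#)
    ∏-filter P? []       f = refl
    ∏-filter P? (x ∷ xs) f with does (P? x)
    ... | true  = *-congˡ (∏-filter P? xs f)
    ... | false = trans (∏-filter P? xs f) (sym (*-identityˡ _))

    ∏-cong : ∀ xs {f g : A → Carrier} → (∀ x → f x ≈ g x) → ∏ xs f ≈ ∏ xs g
    ∏-cong []       h = refl
    ∏-cong (x ∷ xs) h = *-cong (h x) (∏-cong xs h)

  module _ {a b} {A : Set a} {B : Set b} where

    ∑-map : ∀ (g : A → B) xs f → ∑ (map g xs) f ≈ ∑ xs (f ∘ g)
    ∑-map g []       f = refl
    ∑-map g (x ∷ xs) f = +-congˡ (∑-map g xs f)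

    ∏-map : ∀ (g : A → B) xs f → ∏ (map g xs) f ≈ ∏ xs (f ∘ g)
    ∏-map g []       f = refl
    ∏-map g (x ∷ xs) f = *-congˡ (∏-map g xs f)

    ∑-swap : ∀ xs ys (f : A → B → Carrier) →
      ∑ xs (λ x → ∑ ys (f x)) ≈ ∑ ys (λ y → ∑ xs (λ x → f x y))
    ∑-swap []       ys f = sym (∑-0 ys λ _ → refl)
    ∑-swap (x ∷ xs) ys f = trans (+-congˡ (∑-swap xs ys f)) (sym (∑-+ ys _ _))

  module _ {a b} {A : Set a} {B : Set b} where

    ∏-cartesianProduct : ∀ xs ys (f : A × B → Carrier) →
      ∏ (cartesianProduct xs ys) f ≈ ∏ xs (λ x → ∏ ys (λ y → f (x , y)))
    ∏-cartesianProduct []       ys f = refl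
    ∏-cartesianProduct (x ∷ xs) ys f = trans (∏-++ (map (x ,_) ys) _ f)
      (*-cong (∏-map (x ,_) ys f) (∏-cartesianProduct xs ys f))

  ∏-tabulate : ∀ {a} {A : Set a} (g : Fin n → A) f → ∏ (tabulate g) f ≈ product (f ∘ g)
  ∏-tabulate {n = zero}  g f = refl
  ∏-tabulate {n = suc n} g f = *-congˡ (∏-tabulate (g ∘ suc) f)

  ∑-tabulate : ∀ {a} {A : Set a} (g : Fin n → A) f → ∑ (tabulate g) f ≈ sum (f ∘ g)
  ∑-tabulate {n = zero}  g f = refl
  ∑-tabulate {n = suc n} g f = +-congˡ (∑-tabulate (g ∘ suc) f)

  ∏-allPairs : ∀ (f : Fin n × Fin m → Carrier) →
    ∏ (cartesianProduct (allFin n) (allFin m)) f ≈ product (λ i → product (λ j → f (i , j)))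
  ∏-allPairs {n} {m} f = trans (∏-cartesianProduct (allFin n) (allFin m) f)
    (trans (∏-tabulate id (λ i → ∏ (allFin m) (λ j → f (i , j))))
      (product-cong λ i → ∏-tabulate id (λ j → f (i , j))))

  module _ {a} {A : Set a} (xs : List A) where

    ∑-vectors-suc : ∀ n (f : Vec A (suc n) → Carrier) →
      ∑ (vectors xs (suc n)) f ≈ ∑ xs (λ x → ∑ (vectors xs n) (λ v → f (x ∷ v)))
    ∑-vectors-suc n f = go xs
      where
      go : ∀ ys → ∑ (cartesianProductWith _∷_ ys (vectors xs n)) f ≈
                  ∑ ys (λ x → ∑ (vectors xs n) (λ v → f (x ∷ v)))
      go []       = refl
      go (y ∷ ys) = trans (∑-++ (map (y ∷_) (vectors xs n)) _ f)
        (+-cong (∑-map (y ∷_) (vectors xs n) f) (go ys))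

    ∑-vectors-++ : ∀ m n (f : Vec A (m ℕ.+ n) → Carrier) →
      ∑ (vectors xs (m ℕ.+ n)) f ≈
      ∑ (vectors xs m) (λ u → ∑ (vectors xs n) (λ w → f (u Vec.++ w)))
    ∑-vectors-++ zero    n f = sym (+-identityʳ _)
    ∑-vectors-++ (suc m) n f = begin
      ∑ (vectors xs (suc m ℕ.+ n)) f
        ≈⟨ ∑-vectors-suc (m ℕ.+ n) f ⟩
      ∑ xs (λ x → ∑ (vectors xs (m ℕ.+ n)) (λ v → f (x ∷ v)))
        ≈⟨ ∑-cong xs (λ x → ∑-vectors-++ m n (λ v → f (x ∷ v))) ⟩
      ∑ xs (λ x → ∑ (vectors xs m) (λ u → ∑ (vectors xs n) (λ w → f ((x ∷ u) Vec.++ w))))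
        ≈⟨ ∑-vectors-suc m (λ u → ∑ (vectors xs n) (λ w → f (u Vec.++ w))) ⟨
      ∑ (vectors xs (suc m)) (λ u → ∑ (vectors xs n) (λ w → f (u Vec.++ w)))
        ∎

-- Exchanging the colors of two consecutive vertices

-- The exchange of the entries i and i + 1.
swapAt : ∀ {a n} {A : Set a} → Fin n → Vec A (suc n) → Vec A (suc n)
swapAt zero    (x ∷ y ∷ v) = y ∷ x ∷ v
swapAt (suc i) (x ∷ v)     = x ∷ swapAt i v

count-swapAt : ∀ {a p n} {A : Set a} {P : Pred A p} (P? : Decidable P) (i : Fin n) (v : Vec A (suc n)) →
  Vec.count P? (swapAt i v) ≡ Vec.count P? v
count-swapAt P? zero    (x ∷ y ∷ v) with does (P? x) | does (P? y)
... | true  | true  = ≡.refl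
... | true  | false = ≡.refl
... | false | true  = ≡.refl
... | false | false = ≡.refl
count-swapAt P? (suc i) (x ∷ v) with does (P? x)
... | true  = ≡.cong suc (count-swapAt P? i v)
... | false = count-swapAt P? i v

count-++ : ∀ {a p m n} {A : Set a} {P : Pred A p} (P? : Decidable P) (u : Vec A m) (v : Vec A n) →
  Vec.count P? (u Vec.++ v) ≡ Vec.count P? u ℕ.+ Vec.count P? v
count-++ P? []      v = ≡.refl
count-++ P? (x ∷ u) v with does (P? x)
... | true  = ≡.cong suc (count-++ P? u v)
... | false = count-++ P? u v

-- Colorings of a clique with r colors.
module Twins {c ℓ} (F : QField c ℓ) (r : ℕ) where
  open QField F renaming (commutativeRing to K)
  open Sums K
  open IntegerSolver K
  open Algebra.Properties.Ring ring using (x∙y⁻¹≈ε⇒x≈y)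
  open Relation.Binary.Reasoning.Setoid setoid
  private
    variable
      n : ℕ

  -- The factor contributed by an edge from a vertex of color c to a larger
  -- vertex of color d: q for an ascent, 0 for equal colors, 1 otherwise.
  g : Fin r → Fin r → Carrier
  g c d = choose (c Fin.<? d) q (choose (c Fin.≟ d) 0# 1#)

  g-< : ∀ {c d} → c Fin.< d → g c d ≈ q
  g-< {c} {d} c<d = choose-yes (c Fin.<? d) c<d

  g-≡ : ∀ {c d} → c ≡ d → g c d ≈ 0#
  g-≡ {c} {d} c≡d = trans (choose-no (c Fin.<? d) (Fin.<-irrefl c≡d)) (choose-yes (c Fin.≟ d) c≡d)

  g-> : ∀ {c d} → d Fin.< c → g c d ≈ 1#
  g-> {c} {d} d<c = trans (choose-no (c Fin.<? d) (Fin.<-asym d<c))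
    (choose-no (c Fin.≟ d) λ c≡d → Fin.<-irrefl (≡.sym c≡d) d<c)

  -- The weight of the edges from a vertex to the vertices of a clique above it,
  -- and of the edges inside a clique.
  joinWeight : Fin r → Vec (Fin r) n → Carrier
  joinWeight x []      = 1#
  joinWeight x (y ∷ w) = g x y * joinWeight x w

  cliqueWeight : Vec (Fin r) n → Carrier
  cliqueWeight []      = 1#
  cliqueWeight (x ∷ w) = joinWeight x w * cliqueWeight w

  -- The weight of a colored clique, with a factor φ b y for the color y of its
  -- vertex b.
  weight : (Fin n → Fin r → Carrier) → Vec (Fin r) n → Carrier
  weight φ w = cliqueWeight w * product (λ b → φ b (lookup w b))

  joinWeight-swapAt : ∀ x (i : Fin n) w → joinWeight x (swapAt i w) ≈ joinWeight x w
  joinWeight-swapAt x zero    (y ∷ z ∷ w) = x*[y*z]≈y*[x*z] _ _ _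
  joinWeight-swapAt x (suc i) (y ∷ w)     = *-congˡ (joinWeight-swapAt x i w)

  ∑-swapAt : ∀ (xs : List (Fin r)) (i : Fin n) (f : Vec (Fin r) (suc n) → Carrier) →
    ∑ (vectors xs (suc n)) (f ∘ swapAt i) ≈ ∑ (vectors xs (suc n)) f
  ∑-swapAt {n = suc n} xs zero    f = begin
    ∑ (vectors xs (suc (suc n))) (f ∘ swapAt zero)
      ≈⟨ twoFirst (f ∘ swapAt zero) ⟩
    ∑ xs (λ x → ∑ xs (λ y → ∑ (vectors xs n) (λ w → f (y ∷ x ∷ w))))
      ≈⟨ ∑-swap xs xs (λ x y → ∑ (vectors xs n) (λ w → f (y ∷ x ∷ w))) ⟩
    ∑ xs (λ y → ∑ xs (λ x → ∑ (vectors xs n) (λ w → f (y ∷ x ∷ w))))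
      ≈⟨ twoFirst f ⟨
    ∑ (vectors xs (suc (suc n))) f
      ∎
    where
    twoFirst : ∀ f → ∑ (vectors xs (suc (suc n))) f ≈
      ∑ xs (λ x → ∑ xs (λ y → ∑ (vectors xs n) (λ w → f (x ∷ y ∷ w))))
    twoFirst f = trans (∑-vectors-suc xs (suc n) f)
      (∑-cong xs λ x → ∑-vectors-suc xs n (λ w → f (x ∷ w)))
  ∑-swapAt {n = suc n} xs (suc i) f = begin
    ∑ (vectors xs (suc (suc n))) (f ∘ swapAt (suc i))
      ≈⟨ ∑-vectors-suc xs (suc n) (f ∘ swapAt (suc i)) ⟩
    ∑ xs (λ x → ∑ (vectors xs (suc n)) (λ w → f (x ∷ swapAt i w)))
      ≈⟨ ∑-cong xs (λ x → ∑-swapAt xs i (λ w → f (x ∷ w))) ⟩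
    ∑ xs (λ x → ∑ (vectors xs (suc n)) (λ w → f (x ∷ w)))
      ≈⟨ ∑-vectors-suc xs (suc n) f ⟨
    ∑ (vectors xs (suc (suc n))) f
      ∎

  module _ (φ₀ φ₁ φ₂ : Fin (suc n) → Fin r → Carrier) where

    -- The combination of the factors at the vertices i and i + 1, of colors y and
    -- z, that corresponds to the modular law.
    modular : Fin n → Fin r → Fin r → Carrier
    modular i y z =
      (1# + q) * (φ₁ (inject₁ i) y * φ₁ (suc i) z) -
      (q * (φ₂ (inject₁ i) y * φ₂ (suc i) z) + φ₀ (inject₁ i) y * φ₀ (suc i) z)

    -- The combination of the weights that corresponds to the modular law.
    difference : Vec (Fin r) (suc n) → Carrier
    difference w = (1# + q) * weight φ₁ w - (q * weight φ₂ w + weight φ₀ w)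

  -- The three families of factors agree except at the vertices i and i + 1, where
  -- exchanging the colors y and z changes the sign of the modular combination.
  record Twins (φ₀ φ₁ φ₂ : Fin (suc n) → Fin r → Carrier) (i : Fin n) : Set ℓ where
    field
      agree₁    : ∀ b → b ≢ inject₁ i → b ≢ suc i → ∀ y → φ₁ b y ≈ φ₀ b y
      agree₂    : ∀ b → b ≢ inject₁ i → b ≢ suc i → ∀ y → φ₂ b y ≈ φ₀ b y
      cancel    : ∀ y z → g y z * modular φ₀ φ₁ φ₂ i y z + g z y * modular φ₀ φ₁ φ₂ i z y ≈ 0#
  open Twins

  -- All factors other than those at i and i + 1 can be taken out of the
  -- difference, and are symmetric in the two colors.
  difference-swapAt : (φ₀ φ₁ φ₂ : Fin (suc n) → Fin r → Carrier) (i : Fin n) → Twins φ₀ φ₁ φ₂ i →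
    ∀ w → difference φ₀ φ₁ φ₂ w + difference φ₀ φ₁ φ₂ (swapAt i w) ≈ 0#
  difference-swapAt {n = suc n} φ₀ φ₁ φ₂ zero t (y ∷ z ∷ w) = begin
    difference φ₀ φ₁ φ₂ (y ∷ z ∷ w) + difference φ₀ φ₁ φ₂ (z ∷ y ∷ w)
      ≈⟨ +-cong (split y z) (split z y) ⟩
    (J y * J z * B) * (g y z * M y z) + (J z * J y * B) * (g z y * M z y)
      ≈⟨ solve 5 (λ a b c x x′ → a :* b :* c :* x :+ b :* a :* c :* x′ := a :* b :* c :* (x :+ x′))
           refl (J y) (J z) B (g y z * M y z) (g z y * M z y) ⟩
    (J y * J z * B) * (g y z * M y z + g z y * M z y)
      ≈⟨ *-congˡ (cancel t y z) ⟩
    (J y * J z * B) * 0#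
      ≈⟨ zeroʳ _ ⟩
    0#
      ∎
    where
    J : Fin r → Carrier
    J x = joinWeight x w

    rest : (Fin (suc (suc n)) → Fin r → Carrier) → Carrier
    rest φ = product (λ b → φ (suc (suc b)) (lookup w b))

    B : Carrier
    B = cliqueWeight w * rest φ₀

    M : Fin r → Fin r → Carrier
    M = modular φ₀ φ₁ φ₂ zero

    rest₁ : rest φ₁ ≈ rest φ₀
    rest₁ = product-cong λ b → agree₁ t (suc (suc b)) (λ ()) (λ ()) (lookup w b)

    rest₂ : rest φ₂ ≈ rest φ₀
    rest₂ = product-cong λ b → agree₂ t (suc (suc b)) (λ ()) (λ ()) (lookup w b)

    split : ∀ y z → difference φ₀ φ₁ φ₂ (y ∷ z ∷ w) ≈ (J y * J z * B) * (g y z * M y z)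
    split y z = begin
      difference φ₀ φ₁ φ₂ (y ∷ z ∷ w)
        ≈⟨ +-cong (*-congˡ (*-congˡ (*-congˡ (*-congˡ rest₁))))
             (-‿cong (+-congʳ (*-congˡ (*-congˡ (*-congˡ (*-congˡ rest₂)))))) ⟩
      (1# + q) * (L * (φ₁ zero y * (φ₁ (suc zero) z * R))) -
      (q * (L * (φ₂ zero y * (φ₂ (suc zero) z * R))) + L * (φ₀ zero y * (φ₀ (suc zero) z * R)))
        ≈⟨ solve 12 (λ q gyz ay az l r f f′ h h′ k k′ →
             let L = (gyz :* ay) :* (az :* l) in
             (con (+ 1) :+ q) :* (L :* (f :* (f′ :* r))) :-
             (q :* (L :* (h :* (h′ :* r))) :+ L :* (k :* (k′ :* r))) :=
             (ay :* az :* (l :* r)) :* (gyz :*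
               ((con (+ 1) :+ q) :* (f :* f′) :- (q :* (h :* h′) :+ k :* k′))))
             refl q (g y z) (J y) (J z) (cliqueWeight w) R
             (φ₁ zero y) (φ₁ (suc zero) z) (φ₂ zero y) (φ₂ (suc zero) z)
             (φ₀ zero y) (φ₀ (suc zero) z) ⟩
      (J y * J z * B) * (g y z * M y z)
        ∎
      where
      L R : Carrier
      L = (g y z * J y) * (J z * cliqueWeight w)
      R = rest φ₀
  difference-swapAt {n = suc n} φ₀ φ₁ φ₂ (suc i) t (x ∷ w) = begin
    difference φ₀ φ₁ φ₂ (x ∷ w) + difference φ₀ φ₁ φ₂ (x ∷ swapAt i w)
      ≈⟨ +-cong (split w) (trans (split (swapAt i w)) (*-congʳ (*-congʳ (joinWeight-swapAt x i w)))) ⟩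
    joinWeight x w * φ₀ zero x * D w + joinWeight x w * φ₀ zero x * D (swapAt i w)
      ≈⟨ distribˡ _ _ _ ⟨
    joinWeight x w * φ₀ zero x * (D w + D (swapAt i w))
      ≈⟨ *-congˡ (difference-swapAt (φ₀ ∘ suc) (φ₁ ∘ suc) (φ₂ ∘ suc) i tail w) ⟩
    joinWeight x w * φ₀ zero x * 0#
      ≈⟨ zeroʳ _ ⟩
    0#
      ∎
    where
    D : Vec (Fin r) (suc n) → Carrier
    D = difference (φ₀ ∘ suc) (φ₁ ∘ suc) (φ₂ ∘ suc)

    tail : Twins (φ₀ ∘ suc) (φ₁ ∘ suc) (φ₂ ∘ suc) i
    tail = record
      { agree₁ = λ b b≢i b≢i+1 → agree₁ t (suc b) (b≢i ∘ Fin.suc-injective) (b≢i+1 ∘ Fin.suc-injective)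
      ; agree₂ = λ b b≢i b≢i+1 → agree₂ t (suc b) (b≢i ∘ Fin.suc-injective) (b≢i+1 ∘ Fin.suc-injective)
      ; cancel = cancel t
      }

    split : ∀ w → difference φ₀ φ₁ φ₂ (x ∷ w) ≈ joinWeight x w * φ₀ zero x * D w
    split w = begin
      difference φ₀ φ₁ φ₂ (x ∷ w)
        ≈⟨ +-cong (*-congˡ (*-congˡ (*-congʳ (agree₁ t zero (λ ()) (λ ()) x))))
             (-‿cong (+-congʳ (*-congˡ (*-congˡ (*-congʳ (agree₂ t zero (λ ()) (λ ()) x)))))) ⟩
      (1# + q) * (J * L * (φ₀ zero x * R φ₁)) -
      (q * (J * L * (φ₀ zero x * R φ₂)) + J * L * (φ₀ zero x * R φ₀))
        ≈⟨ solve 7 (λ q a c f r₁ r₂ r₀ →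
             (con (+ 1) :+ q) :* (a :* c :* (f :* r₁)) :-
             (q :* (a :* c :* (f :* r₂)) :+ a :* c :* (f :* r₀)) :=
             a :* f :* ((con (+ 1) :+ q) :* (c :* r₁) :- (q :* (c :* r₂) :+ c :* r₀)))
             refl q J L (φ₀ zero x) (R φ₁) (R φ₂) (R φ₀) ⟩
      joinWeight x w * φ₀ zero x * D w
        ∎
      where
      J L : Carrier
      J = joinWeight x w
      L = cliqueWeight w
      R : (Fin (suc (suc n)) → Fin r → Carrier) → Carrier
      R φ = product (λ b → φ (suc b) (lookup w b))

  -- Exchanging the colors of i and i + 1 permutes the colorings and changes the
  -- sign of every term of the difference of the two sides, so that twice the
  -- difference is 0.
  modular-law : (φ₀ φ₁ φ₂ : Fin (suc n) → Fin r → Carrier) (i : Fin n) → Twins φ₀ φ₁ φ₂ i →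
    (h : Vec (Fin r) (suc n) → Carrier) → (∀ w → h (swapAt i w) ≈ h w) → ∀ xs →
    (1# + q) * ∑ (vectors xs (suc n)) (λ w → h w * weight φ₁ w) ≈
    q * ∑ (vectors xs (suc n)) (λ w → h w * weight φ₂ w) + ∑ (vectors xs (suc n)) (λ w → h w * weight φ₀ w)
  modular-law {n = n} φ₀ φ₁ φ₂ i t h h-swapAt xs = x∙y⁻¹≈ε⇒x≈y _ _ (begin
    (1# + q) * S φ₁ - (q * S φ₂ + S φ₀)
      ≈⟨ solve 4 (λ q a b c → (con (+ 1) :+ q) :* a :- (q :* b :+ c) :=
           (con (+ 1) :+ q) :* a :+ (:- q :* b :+ :- con (+ 1) :* c)) refl q (S φ₁) (S φ₂) (S φ₀) ⟩
    (1# + q) * S φ₁ + (- q * S φ₂ + - 1# * S φ₀)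
      ≈⟨ +-cong (∑-* _ vs (term φ₁)) (+-cong (∑-* _ vs (term φ₂)) (∑-* _ vs (term φ₀))) ⟨
    ∑ vs (λ w → (1# + q) * term φ₁ w) + (∑ vs (λ w → - q * term φ₂ w) + ∑ vs (λ w → - 1# * term φ₀ w))
      ≈⟨ +-congˡ (∑-+ vs _ _) ⟨
    ∑ vs (λ w → (1# + q) * term φ₁ w) + ∑ vs (λ w → - q * term φ₂ w + - 1# * term φ₀ w)
      ≈⟨ ∑-+ vs _ _ ⟨
    ∑ vs (λ w → (1# + q) * term φ₁ w + (- q * term φ₂ w + - 1# * term φ₀ w))
      ≈⟨ ∑-cong vs (λ w → solve 5 (λ q h a b c →
           (con (+ 1) :+ q) :* (h :* a) :+ (:- q :* (h :* b) :+ :- con (+ 1) :* (h :* c)) :=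
           h :* ((con (+ 1) :+ q) :* a :- (q :* b :+ c)))
           refl q (h w) (weight φ₁ w) (weight φ₂ w) (weight φ₀ w)) ⟩
    ∑ vs D
      ≈⟨ halve (∑ vs D) (begin
           ∑ vs D + ∑ vs D                        ≈⟨ +-congˡ (∑-swapAt xs i D) ⟨
           ∑ vs D + ∑ vs (D ∘ swapAt i)           ≈⟨ ∑-+ vs _ _ ⟨
           ∑ vs (λ w → D w + D (swapAt i w))      ≈⟨ ∑-0 vs pair ⟩
           0#                                     ∎) ⟩
    0#
      ∎)
    where
    vs : List (Vec (Fin r) (suc n))
    vs = vectors xs (suc n)
    term : (Fin (suc n) → Fin r → Carrier) → Vec (Fin r) (suc n) → Carrier
    term φ w = h w * weight φ w
    S : (Fin (suc n) → Fin r → Carrier) → Carrier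
    S φ = ∑ vs (term φ)
    D : Vec (Fin r) (suc n) → Carrier
    D w = h w * difference φ₀ φ₁ φ₂ w
    pair : ∀ w → D w + D (swapAt i w) ≈ 0#
    pair w = begin
      D w + D (swapAt i w)
        ≈⟨ +-congˡ (*-congʳ (h-swapAt w)) ⟩
      h w * difference φ₀ φ₁ φ₂ w + h w * difference φ₀ φ₁ φ₂ (swapAt i w)
        ≈⟨ distribˡ _ _ _ ⟨
      h w * (difference φ₀ φ₁ φ₂ w + difference φ₀ φ₁ φ₂ (swapAt i w))
        ≈⟨ *-congˡ (difference-swapAt φ₀ φ₁ φ₂ i t w) ⟩
      h w * 0#
        ≈⟨ zeroʳ _ ⟩
      0#
        ∎

-- The modular law for colorings of two joined cliques

-- Colorings, with content e, of a clique with m vertices and a clique with n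
-- vertices.  The vertices of the first clique correspond to the columns of the
-- board, those of the second one to its rows, from bottom to top, and len b is
-- the length of the row b.
module TwoCliques {c ℓ} (F : QField c ℓ) (e : List ℕ) (m n : ℕ) where
  open QField F renaming (commutativeRing to K)
  open Sums K
  open Twins F (length e) public

  Color : Set
  Color = Fin (length e)

  -- The column j and the row b are joined by an edge if the cell in their
  -- intersection lies outside the partition.
  crossFactor : (Fin n → ℕ) → Vec Color m → Vec Color n → Fin m → Fin n → Carrier
  crossFactor len u w j b = choose (toℕ j ℕ.<? len b) 1# (g (lookup u j) (lookup w b))

  -- 1 if the coloring contributes to the monomial e, and 0 otherwise.
  content : Vec Color m → Vec Color n → Carrier
  content u w = χ (hasMonomial? e (u Vec.++ w))

  -- The generating function, by the number of ascents, of the proper colorings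
  -- u, w with content e.
  coloringSum : (Fin n → ℕ) → Carrier
  coloringSum len =
    ∑ (vectors (allFin _) m) λ u → ∑ (vectors (allFin _) n) λ w →
      content u w * (cliqueWeight u * (cliqueWeight w *
        product (λ j → product (λ b → crossFactor len u w j b))))

  coloringSum-cong : ∀ {len len′} → (∀ b → len b ≡ len′ b) → coloringSum len ≈ coloringSum len′
  coloringSum-cong h = ∑-cong (vectors (allFin _) m) λ u → ∑-cong (vectors (allFin _) n) λ w →
    *-congˡ (*-congˡ (*-congˡ (product-cong λ j → product-cong λ b →
      reflexive (≡.cong (λ l → choose (toℕ j ℕ.<? l) 1# (g (lookup u j) (lookup w b))) (h b)))))

  -- The factor of all edges from a row of length l and color y to the columns,
  -- and the factor of all edges from the column j of color x to the rows.
  rowFactor : Vec Color m → ℕ → Color → Carrier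
  rowFactor u l y = product (λ j → choose (toℕ j ℕ.<? l) 1# (g (lookup u j) y))

  columnFactor : (Fin n → ℕ) → Vec Color n → Fin m → Color → Carrier
  columnFactor len w j x = product (λ b → choose (toℕ j ℕ.<? len b) 1# (g x (lookup w b)))

  -- The sum is organized as one over the colorings of the rows for fixed colors
  -- of the columns, and the other way round.
  rowForm : ∀ len → coloringSum len ≈
    ∑ (vectors (allFin _) m) λ u → ∑ (vectors (allFin _) n) λ w →
      content u w * cliqueWeight u * weight (λ b → rowFactor u (len b)) w
  rowForm len = ∑-cong (vectors (allFin _) m) λ u → ∑-cong (vectors (allFin _) n) λ w →
    trans (sym (*-assoc _ _ _)) (*-congˡ (*-congˡ (product-comm (crossFactor len u w))))

  columnForm : ∀ len → coloringSum len ≈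
    ∑ (vectors (allFin _) n) λ w → ∑ (vectors (allFin _) m) λ u →
      content u w * cliqueWeight w * weight (columnFactor len w) u
  columnForm len = trans (∑-swap (vectors (allFin _) m) (vectors (allFin _) n) _)
    (∑-cong (vectors (allFin _) n) λ w → ∑-cong (vectors (allFin _) m) λ u →
      trans (*-congˡ (x*[y*z]≈y*[x*z] _ _ _)) (sym (*-assoc _ _ _)))

  -- The cancellation condition on pairs of colors is symmetric, and trivial on
  -- the diagonal because equal colors have weight 0.
  cancel-from-< : (B : Color → Color → Carrier) →
    (∀ y z → y Fin.< z → g y z * B y z + g z y * B z y ≈ 0#) →
    ∀ y z → g y z * B y z + g z y * B z y ≈ 0#
  cancel-from-< B h y z with Fin.<-cmp y z
  ... | tri< y<z _ _ = h y z y<z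
  ... | tri> _ _ z<y = trans (+-comm _ _) (h z y z<y)
  ... | tri≈ _ y≡z _ = trans
    (+-cong (trans (*-congʳ (g-≡ y≡z)) (zeroˡ _)) (trans (*-congʳ (g-≡ (≡.sym y≡z))) (zeroˡ _)))
    (+-identityˡ 0#)

  content-cong : ∀ u w u′ w′ →
    (∀ c → Vec.count (c Fin.≟_) (u Vec.++ w) ≡ Vec.count (c Fin.≟_) (u′ Vec.++ w′)) →
    content u w ≈ content u′ w′
  content-cong u w u′ w′ h = choose-⇔ (hasMonomial? e (u Vec.++ w)) (hasMonomial? e (u′ Vec.++ w′))
    (λ p c → ≡.trans (≡.sym (h c)) (p c)) (λ p c → ≡.trans (h c) (p c))

module RowLaw {c ℓ} (F : QField c ℓ) (e : List ℕ) (m n : ℕ) where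
  open QField F renaming (commutativeRing to K)
  open Sums K
  open IntegerSolver K
  open TwoCliques F e m (suc n)
  open Relation.Binary.Reasoning.Setoid setoid

  content-swapAt : ∀ i u w → content u (swapAt i w) ≈ content u w
  content-swapAt i u w = content-cong u (swapAt i w) u w λ c →
    ≡.trans (count-++ (c Fin.≟_) u (swapAt i w))
      (≡.trans (≡.cong (Vec.count (c Fin.≟_) u ℕ.+_) (count-swapAt (c Fin.≟_) i w))
        (≡.sym (count-++ (c Fin.≟_) u w)))

  -- The row of length x differs from the row of length x + 1 by the factor of
  -- the column x.
  rowFactor-suc : ∀ u (j : Fin m) y →
    rowFactor u (toℕ j) y ≈ g (lookup u j) y * rowFactor u (suc (toℕ j)) y
  rowFactor-suc u j y = trans
    (product-insert j _ (λ k → choose (toℕ k ℕ.<? suc (toℕ j)) 1# (g (lookup u k) y))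
      (λ k k≢j → choose-⇔ (toℕ k ℕ.<? toℕ j) (toℕ k ℕ.<? suc (toℕ j)) ℕ.m<n⇒m<1+n
        (λ k<1+j → ℕ.≤∧≢⇒< (ℕ.s≤s⁻¹ k<1+j) (k≢j ∘ Fin.toℕ-injective)))
      (choose-yes (toℕ j ℕ.<? suc (toℕ j)) (ℕ.n<1+n (toℕ j))))
    (*-congʳ (choose-no (toℕ j ℕ.<? toℕ j) (ℕ.<-irrefl ≡.refl)))

  -- One of the factors of (g c y - 1) (q - g c z) vanishes if y < z.
  g-row : ∀ c y z → y Fin.< z → q * g c y + g c z ≈ q + g c y * g c z
  g-row c y z y<z with c Fin.<? z
  ... | yes c<z = begin
    q * g c y + g c z      ≈⟨ +-congˡ (g-< c<z) ⟩
    q * g c y + q          ≈⟨ solve 2 (λ q x → q :* x :+ q := q :+ x :* q) refl q (g c y) ⟩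
    q + g c y * q          ≈⟨ +-congˡ (*-congˡ (g-< c<z)) ⟨
    q + g c y * g c z      ∎
  ... | no c≮z = begin
    q * g c y + g c z      ≈⟨ +-congʳ (*-congˡ (g-> y<c)) ⟩
    q * 1# + g c z         ≈⟨ +-cong (*-identityʳ q) (sym (*-identityˡ _)) ⟩
    q + 1# * g c z         ≈⟨ +-congˡ (*-congʳ (g-> y<c)) ⟨
    q + g c y * g c z      ∎
    where
    y<c : y Fin.< c
    y<c = ℕ.<-≤-trans y<z (ℕ.≮⇒≥ c≮z)

  row-cancel : ∀ c y z (t t′ : Carrier) → y Fin.< z →
    g y z * ((1# + q) * (g c y * t * t′) - (q * (t * t′) + g c y * t * (g c z * t′))) +
    g z y * ((1# + q) * (g c z * t′ * t) - (q * (t′ * t) + g c z * t′ * (g c y * t))) ≈ 0#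
  row-cancel c y z t t′ y<z = begin
    g y z * ((1# + q) * (g c y * t * t′) - (q * (t * t′) + g c y * t * (g c z * t′))) +
    g z y * ((1# + q) * (g c z * t′ * t) - (q * (t′ * t) + g c z * t′ * (g c y * t)))
      ≈⟨ +-cong (*-congʳ (g-< y<z)) (*-congʳ (g-> y<z)) ⟩
    q * ((1# + q) * (g c y * t * t′) - (q * (t * t′) + g c y * t * (g c z * t′))) +
    1# * ((1# + q) * (g c z * t′ * t) - (q * (t′ * t) + g c z * t′ * (g c y * t)))
      ≈⟨ solve 5 (λ q x x′ t t′ →
           q :* ((con (+ 1) :+ q) :* (x :* t :* t′) :- (q :* (t :* t′) :+ x :* t :* (x′ :* t′))) :+
           con (+ 1) :* ((con (+ 1) :+ q) :* (x′ :* t′ :* t) :- (q :* (t′ :* t) :+ x′ :* t′ :* (x :* t))) :=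
           (con (+ 1) :+ q) :* (t :* t′) :* ((q :* x :+ x′) :- (q :+ x :* x′)))
           refl q (g c y) (g c z) t t′ ⟩
    (1# + q) * (t * t′) * ((q * g c y + g c z) - (q + g c y * g c z))
      ≈⟨ *-congˡ (+-congʳ (g-row c y z y<z)) ⟩
    (1# + q) * (t * t′) * ((q + g c y * g c z) - (q + g c y * g c z))
      ≈⟨ *-congˡ (-‿inverseʳ _) ⟩
    (1# + q) * (t * t′) * 0#
      ≈⟨ zeroʳ _ ⟩
    0#
      ∎

  -- The consecutive rows i + 1 and i, where i + 1 is the upper one, have lengths
  -- x and x, x + 1 and x, x + 1 and x + 1.
  record Rows (len₀ len₁ len₂ : Fin (suc n) → ℕ) (i : Fin n) (x : ℕ) : Set where
    field
      off₁   : ∀ b → b ≢ inject₁ i → b ≢ suc i → len₁ b ≡ len₀ b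
      off₂   : ∀ b → b ≢ inject₁ i → b ≢ suc i → len₂ b ≡ len₀ b
      lower₀ : len₀ (inject₁ i) ≡ x
      upper₀ : len₀ (suc i) ≡ x
      lower₁ : len₁ (inject₁ i) ≡ x
      upper₁ : len₁ (suc i) ≡ suc x
      lower₂ : len₂ (inject₁ i) ≡ suc x
      upper₂ : len₂ (suc i) ≡ suc x

  coloringSum-rowLaw : ∀ len₀ len₁ len₂ i (j : Fin m) → Rows len₀ len₁ len₂ i (toℕ j) →
    (1# + q) * coloringSum len₁ ≈ q * coloringSum len₂ + coloringSum len₀
  coloringSum-rowLaw len₀ len₁ len₂ i j rows = begin
    (1# + q) * coloringSum len₁
      ≈⟨ *-congˡ (rowForm len₁) ⟩
    (1# + q) * ∑ us (inner len₁)
      ≈⟨ ∑-* _ us (inner len₁) ⟨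
    ∑ us (λ u → (1# + q) * inner len₁ u)
      ≈⟨ ∑-cong us (λ u → modular-law (φ len₀ u) (φ len₁ u) (φ len₂ u) i (twins u)
           (λ w → content u w * cliqueWeight u) (λ w → *-congʳ (content-swapAt i u w)) (allFin _)) ⟩
    ∑ us (λ u → q * inner len₂ u + inner len₀ u)
      ≈⟨ ∑-+ us _ (inner len₀) ⟩
    ∑ us (λ u → q * inner len₂ u) + ∑ us (inner len₀)
      ≈⟨ +-congʳ (∑-* q us (inner len₂)) ⟩
    q * ∑ us (inner len₂) + ∑ us (inner len₀)
      ≈⟨ +-cong (*-congˡ (rowForm len₂)) (rowForm len₀) ⟨
    q * coloringSum len₂ + coloringSum len₀
      ∎
    where
    open Rows rows

    us : List (Vec Color m)
    us = vectors (allFin _) m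

    φ : (Fin (suc n) → ℕ) → Vec Color m → Fin (suc n) → Color → Carrier
    φ len u b = rowFactor u (len b)

    inner : (Fin (suc n) → ℕ) → Vec Color m → Carrier
    inner len u = ∑ (vectors (allFin _) (suc n)) λ w →
      content u w * cliqueWeight u * weight (φ len u) w

    row-≡ : ∀ u y {l l′} → l ≡ l′ → rowFactor u l y ≈ rowFactor u l′ y
    row-≡ u y h = reflexive (≡.cong (λ l → rowFactor u l y) h)

    twins : ∀ u → Twins (φ len₀ u) (φ len₁ u) (φ len₂ u) i
    twins u = record
      { agree₁ = λ b b≢i b≢i+1 y → row-≡ u y (off₁ b b≢i b≢i+1)
      ; agree₂ = λ b b≢i b≢i+1 y → row-≡ u y (off₂ b b≢i b≢i+1)
      ; cancel = cancel-from-< _ λ y z y<z → trans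
          (+-cong (*-congˡ (B≈ y z)) (*-congˡ (B≈ z y)))
          (row-cancel (lookup u j) y z (θ y) (θ z) y<z)
      }
      where
      -- the factor of the edges from a row of length x + 1
      θ : Color → Carrier
      θ = rowFactor u (suc (toℕ j))

      short : ∀ y {l} → l ≡ toℕ j → rowFactor u l y ≈ g (lookup u j) y * θ y
      short y h = trans (row-≡ u y h) (rowFactor-suc u j y)

      B≈ : ∀ y z → modular (φ len₀ u) (φ len₁ u) (φ len₂ u) i y z ≈
        (1# + q) * (g (lookup u j) y * θ y * θ z) -
        (q * (θ y * θ z) + g (lookup u j) y * θ y * (g (lookup u j) z * θ z))
      B≈ y z = +-cong (*-congˡ (*-cong (short y lower₁) (row-≡ u z upper₁)))
        (-‿cong (+-cong (*-congˡ (*-cong (row-≡ u y lower₂) (row-≡ u z upper₂)))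
          (*-cong (short y lower₀) (short z upper₀))))

module ColumnLaw {c ℓ} (F : QField c ℓ) (e : List ℕ) (m n : ℕ) where
  open QField F renaming (commutativeRing to K)
  open Sums K
  open IntegerSolver K
  open TwoCliques F e (suc m) n
  open Relation.Binary.Reasoning.Setoid setoid

  content-swapAt : ∀ i u w → content (swapAt i u) w ≈ content u w
  content-swapAt i u w = content-cong (swapAt i u) w u w λ c →
    ≡.trans (count-++ (c Fin.≟_) (swapAt i u) w)
      (≡.trans (≡.cong (ℕ._+ Vec.count (c Fin.≟_) w) (count-swapAt (c Fin.≟_) i u))
        (≡.sym (count-++ (c Fin.≟_) u w)))

  -- One of the factors of (q - g y d) (g z d - 1) vanishes if y < z.
  g-column : ∀ d y z → y Fin.< z → q * g z d + g y d ≈ q + g y d * g z d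
  g-column d y z y<z with y Fin.<? d
  ... | yes y<d = begin
    q * g z d + g y d      ≈⟨ +-congˡ (g-< y<d) ⟩
    q * g z d + q          ≈⟨ +-comm _ _ ⟩
    q + q * g z d          ≈⟨ +-congˡ (*-congʳ (g-< y<d)) ⟨
    q + g y d * g z d      ∎
  ... | no y≮d = begin
    q * g z d + g y d      ≈⟨ +-congʳ (*-congˡ (g-> d<z)) ⟩
    q * 1# + g y d         ≈⟨ +-cong (*-identityʳ q) (sym (*-identityʳ _)) ⟩
    q + g y d * 1#         ≈⟨ +-congˡ (*-congˡ (g-> d<z)) ⟨
    q + g y d * g z d      ∎
    where
    d<z : d Fin.< z
    d<z = ℕ.≤-<-trans (ℕ.≮⇒≥ y≮d) y<z

  column-cancel : ∀ d y z (t t′ : Carrier) → y Fin.< z →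
    g y z * ((1# + q) * (t * (g z d * t′)) - (q * (t * t′) + g y d * t * (g z d * t′))) +
    g z y * ((1# + q) * (t′ * (g y d * t)) - (q * (t′ * t) + g z d * t′ * (g y d * t))) ≈ 0#
  column-cancel d y z t t′ y<z = begin
    g y z * ((1# + q) * (t * (g z d * t′)) - (q * (t * t′) + g y d * t * (g z d * t′))) +
    g z y * ((1# + q) * (t′ * (g y d * t)) - (q * (t′ * t) + g z d * t′ * (g y d * t)))
      ≈⟨ +-cong (*-congʳ (g-< y<z)) (*-congʳ (g-> y<z)) ⟩
    q * ((1# + q) * (t * (g z d * t′)) - (q * (t * t′) + g y d * t * (g z d * t′))) +
    1# * ((1# + q) * (t′ * (g y d * t)) - (q * (t′ * t) + g z d * t′ * (g y d * t)))
      ≈⟨ solve 5 (λ q x x′ t t′ →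
           q :* ((con (+ 1) :+ q) :* (t :* (x′ :* t′)) :- (q :* (t :* t′) :+ x :* t :* (x′ :* t′))) :+
           con (+ 1) :* ((con (+ 1) :+ q) :* (t′ :* (x :* t)) :- (q :* (t′ :* t) :+ x′ :* t′ :* (x :* t))) :=
           (con (+ 1) :+ q) :* (t :* t′) :* ((q :* x′ :+ x) :- (q :+ x :* x′)))
           refl q (g y d) (g z d) t t′ ⟩
    (1# + q) * (t * t′) * ((q * g z d + g y d) - (q + g y d * g z d))
      ≈⟨ *-congˡ (+-congʳ (g-column d y z y<z)) ⟩
    (1# + q) * (t * t′) * ((q + g y d * g z d) - (q + g y d * g z d))
      ≈⟨ *-congˡ (-‿inverseʳ _) ⟩
    (1# + q) * (t * t′) * 0#
      ≈⟨ zeroʳ _ ⟩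
    0#
      ∎

  -- The row b has length x, x + 1, x + 2, and no other row ends at the column x.
  record Columns (len₀ len₁ len₂ : Fin n → ℕ) (b : Fin n) (x : ℕ) : Set where
    field
      off₁    : ∀ k → k ≢ b → len₁ k ≡ len₀ k
      off₂    : ∀ k → k ≢ b → len₂ k ≡ len₀ k
      no-end  : ∀ k → k ≢ b → x ℕ.< len₀ k → suc x ℕ.< len₀ k
      length₀ : len₀ b ≡ x
      length₁ : len₁ b ≡ suc x
      length₂ : len₂ b ≡ suc (suc x)

  coloringSum-columnLaw : ∀ len₀ len₁ len₂ b (j : Fin m) → Columns len₀ len₁ len₂ b (toℕ j) →
    (1# + q) * coloringSum len₁ ≈ q * coloringSum len₂ + coloringSum len₀
  coloringSum-columnLaw len₀ len₁ len₂ b j columns = begin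
    (1# + q) * coloringSum len₁
      ≈⟨ *-congˡ (columnForm len₁) ⟩
    (1# + q) * ∑ ws (inner len₁)
      ≈⟨ ∑-* _ ws (inner len₁) ⟨
    ∑ ws (λ w → (1# + q) * inner len₁ w)
      ≈⟨ ∑-cong ws (λ w → modular-law (φ len₀ w) (φ len₁ w) (φ len₂ w) j (twins w)
           (λ u → content u w * cliqueWeight w) (λ u → *-congʳ (content-swapAt j u w)) (allFin _)) ⟩
    ∑ ws (λ w → q * inner len₂ w + inner len₀ w)
      ≈⟨ ∑-+ ws _ (inner len₀) ⟩
    ∑ ws (λ w → q * inner len₂ w) + ∑ ws (inner len₀)
      ≈⟨ +-congʳ (∑-* q ws (inner len₂)) ⟩
    q * ∑ ws (inner len₂) + ∑ ws (inner len₀)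
      ≈⟨ +-cong (*-congˡ (columnForm len₂)) (columnForm len₀) ⟨
    q * coloringSum len₂ + coloringSum len₀
      ∎
    where
    open Columns columns
    x : ℕ
    x = toℕ j

    ws : List (Vec Color n)
    ws = vectors (allFin _) n

    φ : (Fin n → ℕ) → Vec Color n → Fin (suc m) → Color → Carrier
    φ = columnFactor

    inner : (Fin n → ℕ) → Vec Color n → Carrier
    inner len w = ∑ (vectors (allFin _) (suc m)) λ u →
      content u w * cliqueWeight w * weight (φ len w) u

    module _ (w : Vec Color n) where
      d : Color
      d = lookup w b

      -- the factor of the edges from the column x or x + 1 to the rows other
      -- than b
      θ : Color → Carrier
      θ = φ len₂ w (suc j)

      -- For the columns other than x and x + 1 the length of the row b makes no
      -- difference.
      agree : ∀ len t → (∀ k → k ≢ b → len k ≡ len₀ k) → len b ≡ t →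
        ∀ k → (toℕ k ℕ.< x → toℕ k ℕ.< t) → (toℕ k ℕ.< t → toℕ k ℕ.< x) →
        ∀ y → φ len w k y ≈ φ len₀ w k y
      agree len t off len-b k f f⁻¹ y = product-cong factor
        where
        factor : ∀ k′ → choose (toℕ k ℕ.<? len k′) 1# (g y (lookup w k′)) ≈
                        choose (toℕ k ℕ.<? len₀ k′) 1# (g y (lookup w k′))
        factor k′ with k′ Fin.≟ b
        ... | no k′≢b = reflexive
          (≡.cong (λ l → choose (toℕ k ℕ.<? l) 1# (g y (lookup w k′))) (off k′ k′≢b))
        ... | yes ≡.refl = choose-⇔ (toℕ k ℕ.<? len b) (toℕ k ℕ.<? len₀ b)
          (λ k<len → ≡.subst (toℕ k ℕ.<_) (≡.sym length₀) (f⁻¹ (≡.subst (toℕ k ℕ.<_) len-b k<len)))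
          (λ k<len → ≡.subst (toℕ k ℕ.<_) (≡.sym len-b) (f (≡.subst (toℕ k ℕ.<_) length₀ k<len)))

      -- The columns x and x + 1 meet the same rows other than b.
      other : ∀ len (k : Fin (suc m)) → (∀ k′ → k′ ≢ b → len k′ ≡ len₀ k′) →
        x ℕ.≤ toℕ k → toℕ k ℕ.≤ suc x → ∀ y k′ → k′ ≢ b →
        choose (toℕ k ℕ.<? len k′) 1# (g y (lookup w k′)) ≈
        choose (toℕ (suc j) ℕ.<? len₂ k′) 1# (g y (lookup w k′))
      other len k off x≤k k≤1+x y k′ k′≢b = choose-⇔ (toℕ k ℕ.<? len k′) (suc x ℕ.<? len₂ k′)
        (λ k<len → ≡.subst (suc x ℕ.<_) (≡.sym (off₂ k′ k′≢b))
          (no-end k′ k′≢b (ℕ.≤-<-trans x≤k (≡.subst (toℕ k ℕ.<_) (off k′ k′≢b) k<len))))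
        (λ x<len → ≡.subst (toℕ k ℕ.<_) (≡.trans (off₂ k′ k′≢b) (≡.sym (off k′ k′≢b)))
          (ℕ.≤-<-trans k≤1+x x<len))

      θ-b : ∀ y → choose (toℕ (suc j) ℕ.<? len₂ b) 1# (g y d) ≈ 1#
      θ-b y = choose-yes (suc x ℕ.<? len₂ b) (≡.subst (suc x ℕ.<_) (≡.sym length₂) (ℕ.n<1+n (suc x)))

      -- A column beyond the end of the row b has the further factor of the edge
      -- to b.
      below : ∀ len k → (∀ k′ → k′ ≢ b → len k′ ≡ len₀ k′) → x ℕ.≤ toℕ k → toℕ k ℕ.≤ suc x →
        len b ℕ.≤ toℕ k → ∀ y → φ len w k y ≈ g y d * θ y
      below len k off x≤k k≤1+x len≤k y = trans
        (product-insert b _ _ (other len k off x≤k k≤1+x y) (θ-b y))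
        (*-congʳ (choose-no (toℕ k ℕ.<? len b) (ℕ.≤⇒≯ len≤k)))

      inside : ∀ len k → (∀ k′ → k′ ≢ b → len k′ ≡ len₀ k′) → x ℕ.≤ toℕ k → toℕ k ℕ.≤ suc x →
        toℕ k ℕ.< len b → ∀ y → φ len w k y ≈ θ y
      inside len k off x≤k k≤1+x k<len y = trans
        (product-insert b _ _ (other len k off x≤k k≤1+x y) (θ-b y))
        (trans (*-congʳ (choose-yes (toℕ k ℕ.<? len b) k<len)) (*-identityˡ _))

      off₀ : ∀ k → k ≢ b → len₀ k ≡ len₀ k
      off₀ _ _ = ≡.refl

      x≤j : x ℕ.≤ toℕ (inject₁ j)
      x≤j = ℕ.≤-reflexive (≡.sym (Fin.toℕ-inject₁ j))

      j≤x : toℕ (inject₁ j) ℕ.≤ x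
      j≤x = ℕ.≤-reflexive (Fin.toℕ-inject₁ j)

      B≈ : ∀ y z → modular (φ len₀ w) (φ len₁ w) (φ len₂ w) j y z ≈
        (1# + q) * (θ y * (g z d * θ z)) - (q * (θ y * θ z) + g y d * θ y * (g z d * θ z))
      B≈ y z = +-cong
        (*-congˡ (*-cong
          (inside len₁ (inject₁ j) off₁ x≤j (ℕ.m≤n⇒m≤1+n j≤x)
            (ℕ.≤-trans (ℕ.s≤s j≤x) (ℕ.≤-reflexive (≡.sym length₁))) y)
          (below len₁ (suc j) off₁ (ℕ.n≤1+n x) ℕ.≤-refl (ℕ.≤-reflexive length₁) z)))
        (-‿cong (+-cong
          (*-congˡ (*-congʳ
            (inside len₂ (inject₁ j) off₂ x≤j (ℕ.m≤n⇒m≤1+n j≤x)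
              (ℕ.≤-trans (ℕ.s≤s (ℕ.m≤n⇒m≤1+n j≤x)) (ℕ.≤-reflexive (≡.sym length₂))) y)))
          (*-cong
            (below len₀ (inject₁ j) off₀ x≤j (ℕ.m≤n⇒m≤1+n j≤x)
              (ℕ.≤-trans (ℕ.≤-reflexive length₀) x≤j) y)
            (below len₀ (suc j) off₀ (ℕ.n≤1+n x) ℕ.≤-refl
              (ℕ.≤-trans (ℕ.≤-reflexive length₀) (ℕ.n≤1+n x)) z))))

      k≢x : ∀ {k : Fin (suc m)} → k ≢ inject₁ j → toℕ k ≢ x
      k≢x k≢j k≡x = k≢j (Fin.toℕ-injective (≡.trans k≡x (≡.sym (Fin.toℕ-inject₁ j))))

      twins : Twins (φ len₀ w) (φ len₁ w) (φ len₂ w) j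
      twins = record
        { agree₁ = λ k k≢j k≢j+1 → agree len₁ (suc x) off₁ length₁ k ℕ.m<n⇒m<1+n
            (λ k<1+x → ℕ.≤∧≢⇒< (ℕ.s≤s⁻¹ k<1+x) (k≢x k≢j))
        ; agree₂ = λ k k≢j k≢j+1 → agree len₂ (suc (suc x)) off₂ length₂ k
            (λ k<x → ℕ.m<n⇒m<1+n (ℕ.m<n⇒m<1+n k<x))
            (λ k<2+x → ℕ.≤∧≢⇒<
              (ℕ.s≤s⁻¹ (ℕ.≤∧≢⇒< (ℕ.s≤s⁻¹ k<2+x) (k≢j+1 ∘ Fin.toℕ-injective)))
              (k≢x k≢j))
        ; cancel = cancel-from-< _ λ y z y<z → trans
            (+-cong (*-congˡ (B≈ y z)) (*-congˡ (B≈ z y)))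
            (column-cancel d y z (θ y) (θ z) y<z)
        }

-- Chromatic functions as weighted sums over colorings of two cliques

-- The coefficient of the monomial e in the chromatic function of a partition, as
-- the sum over the colorings of two joined cliques.
module Chromatic {c ℓ} (F : QField c ℓ) (e : List ℕ) (m n : ℕ) where
  open QField F renaming (commutativeRing to K)
  open Sums K
  open TwoCliques F e m n
  open Relation.Binary.Reasoning.Setoid setoid

  joinWeight-product : ∀ {k} x (u : Vec Color k) → joinWeight x u ≈ product (λ j → g x (lookup u j))
  joinWeight-product x []      = refl
  joinWeight-product x (y ∷ u) = *-congˡ (joinWeight-product x u)

  cliqueWeight-product : ∀ {k} (u : Vec Color k) → cliqueWeight u ≈
    product (λ i → product (λ j → choose (i Fin.<? j) (g (lookup u i) (lookup u j)) 1#))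
  cliqueWeight-product []              = refl
  cliqueWeight-product {suc k} (x ∷ u) = sym (begin
    factor zero zero * product (factor zero ∘ suc) *
    product (λ i → factor (suc i) zero * product (factor (suc i) ∘ suc))
      ≈⟨ *-cong
           (trans (*-identityˡ _)
             (product-cong {n = k} λ j → refl))
           (product-cong {n = k} λ i → trans (*-identityˡ _)
             (product-cong {n = k} λ j → choose-⇔ (suc i Fin.<? suc j) (i Fin.<? j) ℕ.s<s⁻¹ ℕ.s<s)) ⟩
    product (λ j → g x (lookup u j)) *
    product (λ i → product (λ j → choose (i Fin.<? j) (g (lookup u i) (lookup u j)) 1#))
      ≈⟨ *-cong (joinWeight-product x u) (cliqueWeight-product u) ⟨
    cliqueWeight (x ∷ u)
      ∎)
    where
    factor : Fin (suc k) → Fin (suc k) → Carrier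
    factor i j = choose (i Fin.<? j) (g (lookup (x ∷ u) i) (lookup (x ∷ u) j)) 1#

  module _ (ν : Partition n m) where

    -- the lengths of the rows from bottom to top
    len : Fin n → ℕ
    len b = part ν (opposite b)

    column-column : ∀ j k → Edge ν (j ↑ˡ n) (k ↑ˡ n) → j Fin.< k
    column-column j k (j<k , _) = ≡.subst₂ ℕ._<_ (Fin.toℕ-↑ˡ j n) (Fin.toℕ-↑ˡ k n) j<k

    column-column⁻ : ∀ j k → j Fin.< k → Edge ν (j ↑ˡ n) (k ↑ˡ n)
    column-column⁻ j k j<k =
      ≡.subst₂ ℕ._<_ (≡.sym (Fin.toℕ-↑ˡ j n)) (≡.sym (Fin.toℕ-↑ˡ k n)) j<k ,
      λ (_ , _ , _ , k≡ , _) → contradiction (≡.trans (≡.sym k≡) (Fin.splitAt-↑ˡ m k n)) λ ()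

    row-row : ∀ b d → Edge ν (m ↑ʳ b) (m ↑ʳ d) → b Fin.< d
    row-row b d (b<d , _) = ℕ.+-cancelˡ-< m (toℕ b) (toℕ d)
      (≡.subst₂ ℕ._<_ (Fin.toℕ-↑ʳ m b) (Fin.toℕ-↑ʳ m d) b<d)

    row-row⁻ : ∀ b d → b Fin.< d → Edge ν (m ↑ʳ b) (m ↑ʳ d)
    row-row⁻ b d b<d =
      ≡.subst₂ ℕ._<_ (≡.sym (Fin.toℕ-↑ʳ m b)) (≡.sym (Fin.toℕ-↑ʳ m d)) (ℕ.+-monoʳ-< m b<d) ,
      λ (_ , _ , b≡ , _) → contradiction (≡.trans (≡.sym b≡) (Fin.splitAt-↑ʳ m n b)) λ ()

    column<row : (j : Fin m) (b : Fin n) → (j ↑ˡ n) Fin.< (m ↑ʳ b)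
    column<row j b = ≡.subst₂ ℕ._<_ (≡.sym (Fin.toℕ-↑ˡ j n)) (≡.sym (Fin.toℕ-↑ʳ m b))
      (ℕ.<-≤-trans (Fin.toℕ<n j) (ℕ.m≤m+n m (toℕ b)))

    column-row : ∀ j b → Edge ν (j ↑ˡ n) (m ↑ʳ b) → ¬ toℕ j ℕ.< len b
    column-row j b (_ , edge) j<len = edge (opposite b , j , Fin.splitAt-↑ˡ m j n ,
      ≡.trans (Fin.splitAt-↑ʳ m n b) (≡.cong inj₂ (≡.sym (Fin.opposite-involutive b))) , j<len)

    column-row⁻ : ∀ j b → ¬ toℕ j ℕ.< len b → Edge ν (j ↑ˡ n) (m ↑ʳ b)
    column-row⁻ j b j≮len = column<row j b , λ (i , k , j≡ , b≡ , k<i) →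
      let k≡j = inj₁-injective (≡.trans (≡.sym j≡) (Fin.splitAt-↑ˡ m j n))
          i≡b = inj₂-injective (≡.trans (≡.sym b≡) (Fin.splitAt-↑ʳ m n b))
          i≡  = ≡.trans (≡.sym (Fin.opposite-involutive i)) (≡.cong opposite i≡b)
      in j≮len (≡.subst₂ ℕ._<_ (≡.cong toℕ (≡.sym (≡.sym k≡j))) (≡.cong (part ν) i≡) k<i)

    -- The factor of a pair of vertices, in increasing order if they are joined.
    pairFactor : Vec Color (m ℕ.+ n) → Fin (m ℕ.+ n) → Fin (m ℕ.+ n) → Carrier
    pairFactor κ a b = choose (edge? ν a b) (g (lookup κ a) (lookup κ b)) 1#

    pairFactors : ∀ u w → product (λ a → product (λ b → pairFactor (u Vec.++ w) a b)) ≈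
      cliqueWeight u * (cliqueWeight w * product (λ j → product (λ b → crossFactor len u w j b)))
    pairFactors u w = begin
      product (λ a → product (λ b → pairFactor κ a b))
        ≈⟨ product-++ m (λ a → product (λ b → pairFactor κ a b)) ⟩
      product (λ j → product (λ b → pairFactor κ (j ↑ˡ n) b)) *
      product (λ b → product (λ d → pairFactor κ (m ↑ʳ b) d))
        ≈⟨ *-cong
             (trans (product-cong λ j → product-++ m (λ b → pairFactor κ (j ↑ˡ n) b))
               (product-* (λ j → product (λ k → pairFactor κ (j ↑ˡ n) (k ↑ˡ n))) _))
             (trans (product-cong λ b → product-++ m (λ d → pairFactor κ (m ↑ʳ b) d))
               (product-* (λ b → product (λ j → pairFactor κ (m ↑ʳ b) (j ↑ˡ n))) _)) ⟩
      (product (λ j → product (λ k → pairFactor κ (j ↑ˡ n) (k ↑ˡ n))) *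
       product (λ j → product (λ b → pairFactor κ (j ↑ˡ n) (m ↑ʳ b)))) *
      (product (λ b → product (λ j → pairFactor κ (m ↑ʳ b) (j ↑ˡ n))) *
       product (λ b → product (λ d → pairFactor κ (m ↑ʳ b) (m ↑ʳ d))))
        ≈⟨ *-cong (*-cong columns cross) (*-cong none rows) ⟩
      (cliqueWeight u * X) * (1# * cliqueWeight w)
        ≈⟨ *-congˡ (*-identityˡ _) ⟩
      (cliqueWeight u * X) * cliqueWeight w
        ≈⟨ *-assoc _ _ _ ⟩
      cliqueWeight u * (X * cliqueWeight w)
        ≈⟨ *-congˡ (*-comm _ _) ⟩
      cliqueWeight u * (cliqueWeight w * X)
        ∎
      where
      κ : Vec Color (m ℕ.+ n)
      κ = u Vec.++ w

      X : Carrier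
      X = product (λ j → product (λ b → crossFactor len u w j b))

      g-≡≡ : ∀ {x x′ y y′} → x ≡ x′ → y ≡ y′ → g x y ≈ g x′ y′
      g-≡≡ ≡.refl ≡.refl = refl

      columns : product (λ j → product (λ k → pairFactor κ (j ↑ˡ n) (k ↑ˡ n))) ≈ cliqueWeight u
      columns = trans
        (product-cong λ j → product-cong λ k → trans
          (choose-⇔ (edge? ν (j ↑ˡ n) (k ↑ˡ n)) (j Fin.<? k) (column-column j k) (column-column⁻ j k))
          (choose-cong (j Fin.<? k) (λ _ → g-≡≡ (lookup-++ˡ u w j) (lookup-++ˡ u w k)) (λ _ → refl)))
        (sym (cliqueWeight-product u))

      rows : product (λ b → product (λ d → pairFactor κ (m ↑ʳ b) (m ↑ʳ d))) ≈ cliqueWeight w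
      rows = trans
        (product-cong λ b → product-cong λ d → trans
          (choose-⇔ (edge? ν (m ↑ʳ b) (m ↑ʳ d)) (b Fin.<? d) (row-row b d) (row-row⁻ b d))
          (choose-cong (b Fin.<? d) (λ _ → g-≡≡ (lookup-++ʳ u w b) (lookup-++ʳ u w d)) (λ _ → refl)))
        (sym (cliqueWeight-product w))

      none : product (λ b → product (λ j → pairFactor κ (m ↑ʳ b) (j ↑ˡ n))) ≈ 1#
      none = product-1 λ b → product-1 λ j →
        choose-no (edge? ν (m ↑ʳ b) (j ↑ˡ n)) λ (b<j , _) → ℕ.<-asym b<j (column<row j b)

      cross : product (λ j → product (λ b → pairFactor κ (j ↑ˡ n) (m ↑ʳ b))) ≈ X
      cross = product-cong λ j → product-cong λ b → begin
        pairFactor κ (j ↑ˡ n) (m ↑ʳ b)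
          ≈⟨ choose-⇔ (edge? ν (j ↑ˡ n) (m ↑ʳ b)) (¬? (toℕ j ℕ.<? len b)) (column-row j b) (column-row⁻ j b) ⟩
        choose (¬? (toℕ j ℕ.<? len b)) (g (lookup κ (j ↑ˡ n)) (lookup κ (m ↑ʳ b))) 1#
          ≈⟨ choose-cong (¬? (toℕ j ℕ.<? len b)) (λ _ → g-≡≡ (lookup-++ˡ u w j) (lookup-++ʳ u w b)) (λ _ → refl) ⟩
        choose (¬? (toℕ j ℕ.<? len b)) (g (lookup u j) (lookup w b)) 1#
          ≈⟨ choose-¬ (toℕ j ℕ.<? len b) ⟩
        crossFactor len u w j b
          ∎
        where
        choose-¬ : ∀ {P : Set} (d : Dec P) {x y} → choose (¬? d) x y ≈ choose d y x
        choose-¬ (yes _) = refl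
        choose-¬ (no _)  = refl

    weight-of-proper : ∀ κ → χ (proper? ν κ) * q ^ asc ν κ ≈
      product (λ a → product (λ b → pairFactor κ a b))
    weight-of-proper κ = begin
      χ (proper? ν κ) * q ^ asc ν κ
        ≈⟨ *-cong
             (trans (χ-all (λ a → Fin.all? (λ b → d a b))) (product-cong λ a → χ-all (λ b → d a b)))
             (trans (^-length-filter q (λ (a , b) → edge? ν a b ×-dec lookup κ a Fin.<? lookup κ b)
                 (cartesianProduct (allFin (m ℕ.+ n)) (allFin (m ℕ.+ n))))
               (∏-allPairs (λ (a , b) → choose (edge? ν a b ×-dec lookup κ a Fin.<? lookup κ b) q 1#))) ⟩
      product (λ a → product (λ b → χ (d a b))) *
      product (λ a → product (λ b → choose (edge? ν a b ×-dec lookup κ a Fin.<? lookup κ b) q 1#))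
        ≈⟨ product-* (λ a → product (λ b → χ (d a b))) _ ⟨
      product (λ a → product (λ b → χ (d a b)) *
        product (λ b → choose (edge? ν a b ×-dec lookup κ a Fin.<? lookup κ b) q 1#))
        ≈⟨ product-cong (λ a → trans (sym (product-* (λ b → χ (d a b)) _))
             (product-cong λ b → pair (edge? ν a b) (lookup κ a) (lookup κ b))) ⟩
      product (λ a → product (λ b → pairFactor κ a b))
        ∎
      where
      d : ∀ a b → Dec (Edge ν a b → lookup κ a ≢ lookup κ b)
      d a b = edge? ν a b →-dec ¬? (lookup κ a Fin.≟ lookup κ b)

      pair : ∀ {P : Set} (d : Dec P) x y →
        χ (d →-dec ¬? (x Fin.≟ y)) * choose (d ×-dec x Fin.<? y) q 1# ≈ choose d (g x y) 1#
      pair (no _)  x y = *-identityˡ 1#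
      pair (yes _) x y = edge (x Fin.<? y) (x Fin.≟ y)
        where
        edge : (l : Dec (x Fin.< y)) (eq : Dec (x ≡ y)) →
          χ (¬? eq) * choose l q 1# ≈ choose l q (choose eq 0# 1#)
        edge (yes x<y) (yes x≡y) = contradiction x<y (Fin.<-irrefl x≡y)
        edge (yes _)   (no _)    = *-identityˡ q
        edge (no _)    (yes _)   = zeroˡ 1#
        edge (no _)    (no _)    = *-identityˡ 1#

    -- The left-hand side is the coefficient of e in the chromatic function.
    chromatic : ∑ (filter (λ κ → proper? ν κ ×-dec hasMonomial? e κ)
        (vectors (allFin (length e)) (m ℕ.+ n))) (λ κ → q ^ asc ν κ) ≈ coloringSum len
    chromatic = begin
      ∑ (filter (λ κ → proper? ν κ ×-dec hasMonomial? e κ) κs) (λ κ → q ^ asc ν κ)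
        ≈⟨ ∑-filter (λ κ → proper? ν κ ×-dec hasMonomial? e κ) κs (λ κ → q ^ asc ν κ) ⟩
      ∑ κs (λ κ → χ (proper? ν κ ×-dec hasMonomial? e κ) * q ^ asc ν κ)
        ≈⟨ ∑-cong κs (λ κ → begin
             χ (proper? ν κ ×-dec hasMonomial? e κ) * q ^ asc ν κ
               ≈⟨ *-congʳ (trans (χ-× (proper? ν κ) (hasMonomial? e κ)) (*-comm _ _)) ⟩
             χ (hasMonomial? e κ) * χ (proper? ν κ) * q ^ asc ν κ
               ≈⟨ *-assoc _ _ _ ⟩
             χ (hasMonomial? e κ) * (χ (proper? ν κ) * q ^ asc ν κ)
               ≈⟨ *-congˡ (weight-of-proper κ) ⟩
             term κ
               ∎) ⟩
      ∑ κs term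
        ≈⟨ ∑-vectors-++ (allFin _) m n term ⟩
      ∑ (vectors (allFin _) m) (λ u → ∑ (vectors (allFin _) n) (λ w → term (u Vec.++ w)))
        ≈⟨ ∑-cong (vectors (allFin _) m) (λ u → ∑-cong (vectors (allFin _) n) λ w →
             *-congˡ (pairFactors u w)) ⟩
      coloringSum len
        ∎
      where
      κs : List (Vec Color (m ℕ.+ n))
      κs = vectors (allFin _) (m ℕ.+ n)
      term : Vec Color (m ℕ.+ n) → Carrier
      term κ = χ (hasMonomial? e κ) * product (λ a → product (λ b → pairFactor κ a b))

-- Rook numbers

module Powers {c ℓ} (F : QField c ℓ) where
  open QField F renaming (commutativeRing to K)
  open Sums K

  -- The inverses of q and of 1 - q.
  q⁻ s : Carrier
  q⁻ = q ⁻¹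
  s  = (1# - q) ⁻¹

  1-q≉0 : ¬ 1# - q ≈ 0#
  1-q≉0 h = 1-q^≉0 0 (trans (+-congˡ (-‿cong (*-identityʳ q))) h)

  [1-q]s : (1# - q) * s ≈ 1#
  [1-q]s = *-inverse (1# - q) 1-q≉0

  qq⁻ : q * q⁻ ≈ 1#
  qq⁻ = *-inverse q q≉0

  q^q⁻^ : ∀ k → q ^ k * q⁻ ^ k ≈ 1#
  q^q⁻^ zero    = *-identityˡ 1#
  q^q⁻^ (suc k) = trans (*-interchange q (q ^ k) q⁻ (q⁻ ^ k))
    (trans (*-cong qq⁻ (q^q⁻^ k)) (*-identityˡ 1#))

  q^≉0 : ∀ k → ¬ q ^ k ≈ 0#
  q^≉0 k h = 1≉0 (trans (sym (q^q⁻^ k)) (trans (*-congʳ h) (zeroˡ _)))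

module Rooks {c ℓ} (F : QField c ℓ) where
  open QField F renaming (commutativeRing to K)
  open Sums K
  open IntegerSolver K
  open Powers F
  open Relation.Binary.Reasoning.Setoid setoid
  private
    variable
      n m : ℕ

  -- The q-rook numbers.
  R : ℕ → Partition n m → Carrier
  R k ν = ∑ (placements k ν) (λ p → q ^ inv ν p)

  -- The power of q whose exponent is the number of elements of a subset of Fin m.
  q^[_] : {P : Fin m → Set} → (∀ j → Dec (P j)) → Carrier
  q^[ P? ] = product λ j → choose (P? j) q 1#

  -- The sum over the elements of a subset of Fin m of the powers of q whose
  -- exponents are the numbers of larger elements is a geometric sum.
  geometric : {P : Fin m → Set} (P? : ∀ j → Dec (P j)) →
    (1# - q) * sum (λ i → χ (P? i) * q^[ (λ j → P? j ×-dec i Fin.<? j) ]) ≈ 1# - q^[ P? ]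
  geometric {m = zero}  P? = solve 1 (λ q → (con (+ 1) :- q) :* con (+ 0) := con (+ 1) :- con (+ 1)) refl q
  geometric {m = suc m} P? = begin
    (1# - q) * (χ (P? zero) * q^[ above zero ] + sum (λ i → χ (P? (suc i)) * q^[ above (suc i) ]))
      ≈⟨ *-congˡ (+-cong (*-congˡ first) (sum-cong λ i → *-congˡ (rest i))) ⟩
    (1# - q) * (χ (P? zero) * Q + S)
      ≈⟨ distribˡ _ _ _ ⟩
    (1# - q) * (χ (P? zero) * Q) + (1# - q) * S
      ≈⟨ +-congˡ (geometric (P? ∘ suc)) ⟩
    (1# - q) * (χ (P? zero) * Q) + (1# - Q)
      ≈⟨ combine (P? zero) ⟩
    1# - choose (P? zero) q 1# * Q
      ∎
    where
    above : ∀ i j → Dec _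
    above i j = P? j ×-dec i Fin.<? j

    Q S : Carrier
    Q = q^[ P? ∘ suc ]
    S = sum (λ i → χ (P? (suc i)) * q^[ (λ j → P? (suc j) ×-dec i Fin.<? j) ])

    first : q^[ above zero ] ≈ Q
    first = trans (*-cong (choose-no (above zero zero) λ ())
      (product-cong λ j → choose-⇔ (above zero (suc j)) (P? (suc j)) proj₁ (_, ℕ.z<s))) (*-identityˡ _)

    rest : ∀ i → q^[ above (suc i) ] ≈ q^[ (λ j → P? (suc j) ×-dec i Fin.<? j) ]
    rest i = trans (*-cong (choose-no (above (suc i) zero) λ ())
      (product-cong λ j → choose-⇔ (above (suc i) (suc j)) (P? (suc j) ×-dec i Fin.<? j)
        (λ (h , l) → h , ℕ.s<s⁻¹ l) (λ (h , l) → h , ℕ.s<s l))) (*-identityˡ _)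

    combine : ∀ {P : Set} (d : Dec P) →
      (1# - q) * (χ d * Q) + (1# - Q) ≈ 1# - choose d q 1# * Q
    combine (yes _) = solve 2 (λ q Q → (con (+ 1) :- q) :* (con (+ 1) :* Q) :+ (con (+ 1) :- Q) :=
      con (+ 1) :- q :* Q) refl q Q
    combine (no _) = solve 2 (λ q Q → (con (+ 1) :- q) :* (con (+ 0) :* Q) :+ (con (+ 1) :- Q) :=
      con (+ 1) :- con (+ 1) :* Q) refl q Q

  -- An initial segment of Fin m.
  q^[<] : ∀ m l → l ℕ.≤ m → q^[ (λ (j : Fin m) → toℕ j ℕ.<? l) ] ≈ q ^ l
  q^[<] zero    zero    _   = refl
  q^[<] (suc m) zero    _   = product-1 {suc m} λ j → refl
  q^[<] (suc m) (suc l) l≤m = *-congˡ (trans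
    (product-cong {m} λ j → choose-⇔ (suc (toℕ j) ℕ.<? suc l) (toℕ j ℕ.<? l) ℕ.s<s⁻¹ ℕ.s<s)
    (q^[<] m l (ℕ.s≤s⁻¹ l≤m)))

  -- The partition without its first row.
  tailPartition : Partition (suc n) m → Partition n m
  tailPartition ν = record
    { part       = part ν ∘ suc
    ; decreasing = λ i≤j → decreasing ν (ℕ.s≤s i≤j)
    ; bounded    = bounded ν ∘ suc
    }

  -- The columns that hold a rook.
  Occupied : Placement n m → Fin m → Set
  Occupied p j = ∃ λ i → HasRook p (i , j)

  occupied? : (p : Placement n m) (j : Fin m) → Dec (Occupied p j)
  occupied? p j = Fin.any? λ i → hasRook? p (i , j)

  q^occupied : (p : Placement n m) → NonAttacking p → q^[ occupied? p ] ≈ q ^ rookCount p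
  q^occupied {m = m} []            _  = product-1 {m} λ j → refl
  q^occupied {m = m} (nothing ∷ p) na = trans
    (product-cong {m} λ j → choose-⇔ (occupied? (nothing ∷ p) j) (occupied? p j)
      (λ { (suc i , h) → i , h }) (λ (i , h) → suc i , h))
    (q^occupied p λ i k j h h′ → Fin.suc-injective (na (suc i) (suc k) j h h′))
  q^occupied {m = m} (just c ∷ p) na = trans
    (product-insert c _ (λ j → choose (occupied? p j) q 1#)
      (λ j j≢c → choose-⇔ (occupied? (just c ∷ p) j) (occupied? p j)
        (λ { (zero , h) → contradiction (≡.sym (just-injective h)) j≢c ; (suc i , h) → i , h })
        (λ (i , h) → suc i , h))
      (choose-no (occupied? p c) λ (i , h) → contradiction (na zero (suc i) c ≡.refl h) λ ()))
    (*-cong (choose-yes (occupied? (just c ∷ p) c) (zero , ≡.refl))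
      (q^occupied p λ i k j h h′ → Fin.suc-injective (na (suc i) (suc k) j h h′)))

  module _ (ν : Partition n m) where

    Valid : ℕ → Placement n m → Set
    Valid k p = OnBoard ν p × NonAttacking p × rookCount p ≡ k

    valid? : ∀ k p → Dec (Valid k p)
    valid? k p = onBoard? ν p ×-dec nonAttacking? p ×-dec (rookCount p ℕ.≟ k)

    -- The cells that are counted by inv.
    remains? : ∀ p (x : Cell n m) → Dec (x ∈ ν × ¬ Cancelled p x)
    remains? p x = x ∈? ν ×-dec ¬? (cancelled? p x)

    -- The possible contents of a row: no rook, or a rook in some column.
    options : List (Maybe (Fin m))
    options = nothing ∷ map just (allFin m)

    q^inv : ∀ p → q ^ inv ν p ≈ product (λ i → q^[ (λ j → remains? p (i , j)) ])
    q^inv p = begin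
      q ^ inv ν p
        ≈⟨ ^-length-filter q (¬? ∘ cancelled? p) (cells ν) ⟩
      ∏ (cells ν) (λ x → choose (¬? (cancelled? p x)) q 1#)
        ≈⟨ ∏-filter (_∈? ν) (cartesianProduct (allFin n) (allFin m)) _ ⟩
      ∏ (cartesianProduct (allFin n) (allFin m))
        (λ x → choose (x ∈? ν) (choose (¬? (cancelled? p x)) q 1#) 1#)
        ≈⟨ ∏-cong (cartesianProduct (allFin n) (allFin m))
             (λ x → choose-× (x ∈? ν) (¬? (cancelled? p x))) ⟩
      ∏ (cartesianProduct (allFin n) (allFin m)) (λ x → choose (remains? p x) q 1#)
        ≈⟨ ∏-allPairs (λ x → choose (remains? p x) q 1#) ⟩
      product (λ i → q^[ (λ j → remains? p (i , j)) ])
        ∎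
      where
      choose-× : ∀ {P Q : Set} (d : Dec P) (d′ : Dec Q) {x y} →
        choose d (choose d′ x y) y ≈ choose (d ×-dec d′) x y
      choose-× (yes _) d′ = refl
      choose-× (no _)  d′ = refl

    q^∣∣ : q ^ ∣ ν ∣ ≈ product (λ i → q ^ part ν i)
    q^∣∣ = begin
      q ^ ∣ ν ∣
        ≈⟨ ^-length-filter q (_∈? ν) (cartesianProduct (allFin n) (allFin m)) ⟩
      ∏ (cartesianProduct (allFin n) (allFin m)) (λ x → choose (x ∈? ν) q 1#)
        ≈⟨ ∏-allPairs (λ x → choose (x ∈? ν) q 1#) ⟩
      product (λ i → q^[ (λ j → (i , j) ∈? ν) ])
        ≈⟨ product-cong (λ i → q^[<] m (part ν i) (bounded ν i)) ⟩
      product (λ i → q ^ part ν i)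
        ∎

    -- The contribution of p, which is 0 unless p is a valid placement of k rooks.
    term : ℕ → Placement n m → Carrier
    term k p = χ (valid? k p) * q ^ inv ν p

    R-terms : ∀ k → R k ν ≈ ∑ (vectors options n) (term k)
    R-terms k = ∑-filter (valid? k) (vectors options n) (λ p → q ^ inv ν p)

  module _ (ν : Partition (suc n) m) where
    private
      ν′ : Partition n m
      ν′ = tailPartition ν

    -- The cells of the first row that are not cancelled by the rooks below it.
    free? : ∀ (p : Placement n m) (j : Fin m) → Dec (toℕ j ℕ.< part ν zero × ¬ Occupied p j)
    free? p j = toℕ j ℕ.<? part ν zero ×-dec ¬? (occupied? p j)

    -- The k rooks below occupy k different columns of the first row.
    q^free : ∀ k (p : Placement n m) → Valid ν′ k p → q^[ free? p ] * q ^ k ≈ q ^ part ν zero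
    q^free k p (onBoard , nonAttacking , ≡.refl) = begin
      q^[ free? p ] * q ^ rookCount p
        ≈⟨ *-congˡ (q^occupied p nonAttacking) ⟨
      q^[ free? p ] * q^[ occupied? p ]
        ≈⟨ product-* (λ j → choose (free? p j) q 1#) (λ j → choose (occupied? p j) q 1#) ⟨
      product (λ j → choose (free? p j) q 1# * choose (occupied? p j) q 1#)
        ≈⟨ product-cong (λ j → split (toℕ j ℕ.<? part ν zero) (occupied? p j)
             λ (i , h) → ℕ.<-≤-trans (onBoard i j h) (decreasing ν ℕ.z≤n)) ⟩
      q^[ (λ (j : Fin m) → toℕ j ℕ.<? part ν zero) ]
        ≈⟨ q^[<] m (part ν zero) (bounded ν zero) ⟩
      q ^ part ν zero
        ∎
      where
      split : ∀ {P Q : Set} (d : Dec P) (d′ : Dec Q) → (Q → P) →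
        choose (d ×-dec ¬? d′) q 1# * choose d′ q 1# ≈ choose d q 1#
      split (yes _) (yes _) _ = *-identityˡ q
      split (yes _) (no _)  _ = *-identityʳ q
      split (no ¬p) (yes h) f = contradiction (f h) ¬p
      split (no _)  (no _)  _ = *-identityˡ 1#

    q^free⁻ : ∀ k (p : Placement n m) → Valid ν′ k p → q^[ free? p ] ≈ q ^ part ν zero * q⁻ ^ k
    q^free⁻ k p v = begin
      q^[ free? p ]                         ≈⟨ *-identityʳ _ ⟨
      q^[ free? p ] * 1#                    ≈⟨ *-congˡ (q^q⁻^ k) ⟨
      q^[ free? p ] * (q ^ k * q⁻ ^ k)      ≈⟨ *-assoc _ _ _ ⟨
      q^[ free? p ] * q ^ k * q⁻ ^ k        ≈⟨ *-congʳ (q^free k p v) ⟩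
      q ^ part ν zero * q⁻ ^ k              ∎

    private
      lower-rows : ∀ x (p : Placement n m) i → q^[ (λ j → remains? ν (x ∷ p) (suc i , j)) ] ≈
        q^[ (λ j → remains? ν′ p (i , j)) ]
      lower-rows x p i = product-cong {m} λ j →
        choose-⇔ (remains? ν (x ∷ p) (suc i , j)) (remains? ν′ p (i , j))
          (λ (h , ¬c) → h , ¬c ∘ up j) (λ (h , ¬c) → h , ¬c ∘ down j)
        where
        up : ∀ j → Cancelled p (i , j) → Cancelled (x ∷ p) (suc i , j)
        up j (r , c , h , inj₁ (j≡c , i≤r)) = suc r , c , h , inj₁ (j≡c , ℕ.s≤s i≤r)
        up j (r , c , h , inj₂ (i≡r , j≤c)) = suc r , c , h , inj₂ (≡.cong suc i≡r , j≤c)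
        down : ∀ j → Cancelled (x ∷ p) (suc i , j) → Cancelled p (i , j)
        down j (suc r , c , h , inj₁ (j≡c , i≤r)) = r , c , h , inj₁ (j≡c , ℕ.s≤s⁻¹ i≤r)
        down j (suc r , c , h , inj₂ (i≡r , j≤c)) = r , c , h , inj₂ (Fin.suc-injective i≡r , j≤c)

    q^inv-nothing : ∀ (p : Placement n m) → q ^ inv ν (nothing ∷ p) ≈ q^[ free? p ] * q ^ inv ν′ p
    q^inv-nothing p = begin
      q ^ inv ν (nothing ∷ p)
        ≈⟨ q^inv ν (nothing ∷ p) ⟩
      product (λ i → q^[ (λ j → remains? ν (nothing ∷ p) (i , j)) ])
        ≈⟨ *-cong
             (product-cong {m} λ j → choose-⇔ (remains? ν (nothing ∷ p) (zero , j)) (free? p j)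
               (λ (h , ¬c) → h , λ (i , o) → ¬c (suc i , j , o , inj₁ (≡.refl , ℕ.z≤n)))
               (λ (h , ¬o) → h , λ { (suc i , _ , o , inj₁ (≡.refl , _)) → ¬o (i , o) }))
             (product-cong {n} (lower-rows nothing p)) ⟩
      q^[ free? p ] * product (λ i → q^[ (λ j → remains? ν′ p (i , j)) ])
        ≈⟨ *-congˡ (q^inv ν′ p) ⟨
      q^[ free? p ] * q ^ inv ν′ p
        ∎

    q^inv-just : ∀ (c : Fin m) (p : Placement n m) → q ^ inv ν (just c ∷ p) ≈
      q^[ (λ j → free? p j ×-dec c Fin.<? j) ] * q ^ inv ν′ p
    q^inv-just c p = begin
      q ^ inv ν (just c ∷ p)
        ≈⟨ q^inv ν (just c ∷ p) ⟩
      product (λ i → q^[ (λ j → remains? ν (just c ∷ p) (i , j)) ])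
        ≈⟨ *-cong
             (product-cong {m} λ j → choose-⇔ (remains? ν (just c ∷ p) (zero , j))
                 (free? p j ×-dec c Fin.<? j)
               (λ (h , ¬c) → (h , λ (i , o) → ¬c (suc i , j , o , inj₁ (≡.refl , ℕ.z≤n))) ,
                 ℕ.≰⇒> (λ j≤c → ¬c (zero , c , ≡.refl , inj₂ (≡.refl , j≤c))))
               (λ ((h , ¬o) , c<j) → h , λ
                 { (zero  , d , e , inj₁ (j≡d , _)) → Fin.<-irrefl (≡.trans (just-injective e) (≡.sym j≡d)) c<j
                 ; (zero  , d , e , inj₂ (_ , j≤d)) → ℕ.<⇒≱ c<j (≡.subst (j Fin.≤_) (≡.sym (just-injective e)) j≤d)
                 ; (suc i , _ , o , inj₁ (≡.refl , _)) → ¬o (i , o)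
                 }))
             (product-cong {n} (lower-rows (just c) p)) ⟩
      q^[ (λ j → free? p j ×-dec c Fin.<? j) ] * product (λ i → q^[ (λ j → remains? ν′ p (i , j)) ])
        ≈⟨ *-congˡ (q^inv ν′ p) ⟨
      q^[ (λ j → free? p j ×-dec c Fin.<? j) ] * q ^ inv ν′ p
        ∎

    valid-nothing : ∀ k (p : Placement n m) → χ (valid? ν k (nothing ∷ p)) ≈ χ (valid? ν′ k p)
    valid-nothing k p = choose-⇔ (valid? ν k (nothing ∷ p)) (valid? ν′ k p)
      (λ (on , na , eq) → (λ i j h → on (suc i) j h) ,
        (λ i k j h h′ → Fin.suc-injective (na (suc i) (suc k) j h h′)) , eq)
      (λ (on , na , eq) → (λ { (suc i) j h → on i j h }) ,
        (λ { (suc i) (suc k) j h h′ → ≡.cong suc (na i k j h h′) }) , eq)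

    valid-just : ∀ k (c : Fin m) (p : Placement n m) → χ (valid? ν (suc k) (just c ∷ p)) ≈ χ (free? p c) * χ (valid? ν′ k p)
    valid-just k c p = trans
      (choose-⇔ (valid? ν (suc k) (just c ∷ p)) (free? p c ×-dec valid? ν′ k p) to from)
      (χ-× (free? p c) (valid? ν′ k p))
      where
      to : Valid ν (suc k) (just c ∷ p) → (toℕ c ℕ.< part ν zero × ¬ Occupied p c) × Valid ν′ k p
      to (on , na , eq) =
        (on zero c ≡.refl , λ (i , o) → contradiction (na zero (suc i) c ≡.refl o) λ ()) ,
        (λ i j h → on (suc i) j h) ,
        (λ i k j h h′ → Fin.suc-injective (na (suc i) (suc k) j h h′)) , ℕ.suc-injective eq
      from : (toℕ c ℕ.< part ν zero × ¬ Occupied p c) × Valid ν′ k p → Valid ν (suc k) (just c ∷ p)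
      from ((c<λ , ¬o) , on , na , eq) =
        (λ { zero j h → ≡.subst (λ j → toℕ j ℕ.< part ν zero) (just-injective h) c<λ
           ; (suc i) j h → on i j h }) ,
        (λ { zero zero j h h′ → ≡.refl
           ; zero (suc k) j h h′ → contradiction (k , ≡.trans h′ (≡.sym h)) ¬o
           ; (suc i) zero j h h′ → contradiction (i , ≡.trans h (≡.sym h′)) ¬o
           ; (suc i) (suc k) j h h′ → ≡.cong suc (na i k j h h′) }) ,
        ≡.cong suc eq

    private
      L : ℕ
      L = part ν zero
      vs : List (Placement n m)
      vs = vectors (options ν) n

    term-nothing : ∀ k (p : Placement n m) → term ν k (nothing ∷ p) ≈ q ^ L * q⁻ ^ k * term ν′ k p
    term-nothing k p = begin
      χ (valid? ν k (nothing ∷ p)) * q ^ inv ν (nothing ∷ p)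
        ≈⟨ *-cong (valid-nothing k p) (q^inv-nothing p) ⟩
      χ (valid? ν′ k p) * (q^[ free? p ] * q ^ inv ν′ p)
        ≈⟨ *-assoc _ _ _ ⟨
      χ (valid? ν′ k p) * q^[ free? p ] * q ^ inv ν′ p
        ≈⟨ *-congʳ (χ-free (valid? ν′ k p)) ⟩
      χ (valid? ν′ k p) * (q ^ L * q⁻ ^ k) * q ^ inv ν′ p
        ≈⟨ solve 3 (λ x y z → x :* y :* z := y :* (x :* z)) refl
             (χ (valid? ν′ k p)) (q ^ L * q⁻ ^ k) (q ^ inv ν′ p) ⟩
      q ^ L * q⁻ ^ k * term ν′ k p
        ∎
      where
      χ-free : (d : Dec (Valid ν′ k p)) → χ d * q^[ free? p ] ≈ χ d * (q ^ L * q⁻ ^ k)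
      χ-free (no _)  = trans (zeroˡ _) (sym (zeroˡ _))
      χ-free (yes v) = *-congˡ (q^free⁻ k p v)

    -- The free columns of the first row contribute a geometric sum.
    terms-just : ∀ k (p : Placement n m) →
      ∑ (allFin m) (λ c → term ν (suc k) (just c ∷ p)) ≈ (1# - q ^ L * q⁻ ^ k) * s * term ν′ k p
    terms-just k p = begin
      ∑ (allFin m) (λ c → term ν (suc k) (just c ∷ p))
        ≈⟨ ∑-cong (allFin m) (λ c → trans (*-cong (valid-just k c p) (q^inv-just c p))
             (solve 4 (λ f v a i → f :* v :* (a :* i) := v :* i :* (f :* a)) refl
               (χ (free? p c)) V (q^[ (λ j → free? p j ×-dec c Fin.<? j) ]) (q ^ inv ν′ p))) ⟩
      ∑ (allFin m) (λ c → V * I * (χ (free? p c) * q^[ (λ j → free? p j ×-dec c Fin.<? j) ]))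
        ≈⟨ ∑-* (V * I) (allFin m) _ ⟩
      V * I * ∑ (allFin m) (λ c → χ (free? p c) * q^[ (λ j → free? p j ×-dec c Fin.<? j) ])
        ≈⟨ *-congˡ (∑-tabulate {m} id (λ c → χ (free? p c) * q^[ (λ j → free? p j ×-dec c Fin.<? j) ])) ⟩
      V * I * G
        ≈⟨ *-identityˡ _ ⟨
      1# * (V * I * G)
        ≈⟨ *-congʳ [1-q]s ⟨
      (1# - q) * s * (V * I * G)
        ≈⟨ solve 5 (λ a s v i g → a :* s :* (v :* i :* g) := v :* (a :* g) :* (s :* i)) refl
             (1# - q) s V I G ⟩
      V * ((1# - q) * G) * (s * I)
        ≈⟨ *-congʳ (*-congˡ (geometric (free? p))) ⟩
      V * (1# - q^[ free? p ]) * (s * I)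
        ≈⟨ *-congʳ (χ-free (valid? ν′ k p)) ⟩
      V * (1# - q ^ L * q⁻ ^ k) * (s * I)
        ≈⟨ solve 4 (λ v x s i → v :* x :* (s :* i) := x :* s :* (v :* i)) refl
             V (1# - q ^ L * q⁻ ^ k) s I ⟩
      (1# - q ^ L * q⁻ ^ k) * s * term ν′ k p
        ∎
      where
      V I G : Carrier
      V = χ (valid? ν′ k p)
      I = q ^ inv ν′ p
      G = sum (λ c → χ (free? p c) * q^[ (λ j → free? p j ×-dec c Fin.<? j) ])
      χ-free : (d : Dec (Valid ν′ k p)) → χ d * (1# - q^[ free? p ]) ≈ χ d * (1# - q ^ L * q⁻ ^ k)
      χ-free (no _)  = trans (zeroˡ _) (sym (zeroˡ _))
      χ-free (yes v) = *-congˡ (+-congˡ (-‿cong (q^free⁻ k p v)))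

    -- Sum over the rook in the first row.
    R-split : ∀ k → R k ν ≈
      ∑ vs (λ p → term ν k (nothing ∷ p) + ∑ (allFin m) (λ c → term ν k (just c ∷ p)))
    R-split k = begin
      R k ν
        ≈⟨ R-terms ν k ⟩
      ∑ (vectors (options ν) (suc n)) (term ν k)
        ≈⟨ ∑-vectors-suc (options ν) n (term ν k) ⟩
      ∑ (options ν) (λ x → ∑ vs (λ p → term ν k (x ∷ p)))
        ≈⟨ ∑-swap (options ν) vs (λ x p → term ν k (x ∷ p)) ⟩
      ∑ vs (λ p → ∑ (options ν) (λ x → term ν k (x ∷ p)))
        ≈⟨ ∑-cong vs (λ p → +-congˡ (∑-map just (allFin m) (λ x → term ν k (x ∷ p)))) ⟩
      ∑ vs (λ p → term ν k (nothing ∷ p) + ∑ (allFin m) (λ c → term ν k (just c ∷ p)))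
        ∎

    R-zero : R 0 ν ≈ q ^ L * R 0 ν′
    R-zero = begin
      R 0 ν
        ≈⟨ R-split 0 ⟩
      ∑ vs (λ p → term ν 0 (nothing ∷ p) + ∑ (allFin m) (λ c → term ν 0 (just c ∷ p)))
        ≈⟨ ∑-cong vs (λ p → +-cong
             (trans (term-nothing 0 p) (*-congʳ (*-identityʳ _)))
             (∑-0 (allFin m) λ c → trans (*-congʳ (choose-no (valid? ν 0 (just c ∷ p)) λ ()))
               (zeroˡ _))) ⟩
      ∑ vs (λ p → q ^ L * term ν′ 0 p + 0#)
        ≈⟨ ∑-cong vs (λ p → +-identityʳ _) ⟩
      ∑ vs (λ p → q ^ L * term ν′ 0 p)
        ≈⟨ ∑-* (q ^ L) vs (term ν′ 0) ⟩
      q ^ L * ∑ vs (term ν′ 0)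
        ≈⟨ *-congˡ (R-terms ν′ 0) ⟨
      q ^ L * R 0 ν′
        ∎

    R-suc : ∀ k → R (suc k) ν ≈
      q ^ L * q⁻ ^ suc k * R (suc k) ν′ + (1# - q ^ L * q⁻ ^ k) * s * R k ν′
    R-suc k = begin
      R (suc k) ν
        ≈⟨ R-split (suc k) ⟩
      ∑ vs (λ p → term ν (suc k) (nothing ∷ p) + ∑ (allFin m) (λ c → term ν (suc k) (just c ∷ p)))
        ≈⟨ ∑-cong vs (λ p → +-cong (term-nothing (suc k) p) (terms-just k p)) ⟩
      ∑ vs (λ p → q ^ L * q⁻ ^ suc k * term ν′ (suc k) p + (1# - q ^ L * q⁻ ^ k) * s * term ν′ k p)
        ≈⟨ ∑-+ vs _ _ ⟩
      ∑ vs (λ p → q ^ L * q⁻ ^ suc k * term ν′ (suc k) p) +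
      ∑ vs (λ p → (1# - q ^ L * q⁻ ^ k) * s * term ν′ k p)
        ≈⟨ +-cong (∑-* _ vs (term ν′ (suc k))) (∑-* _ vs (term ν′ k)) ⟩
      q ^ L * q⁻ ^ suc k * ∑ vs (term ν′ (suc k)) + (1# - q ^ L * q⁻ ^ k) * s * ∑ vs (term ν′ k)
        ≈⟨ +-cong (*-congˡ (R-terms ν′ (suc k))) (*-congˡ (R-terms ν′ k)) ⟨
      q ^ L * q⁻ ^ suc k * R (suc k) ν′ + (1# - q ^ L * q⁻ ^ k) * s * R k ν′
        ∎

  -- The k-th rook number of the partition with the given row lengths, divided by
  -- the power of q whose exponent is the size of the partition.  The recursion
  -- makes sense for every list of row lengths.
  ρ : List ℕ → ℕ → Carrier
  ρ []      zero    = 1#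
  ρ []      (suc k) = 0#
  ρ (x ∷ l) zero    = ρ l zero
  ρ (x ∷ l) (suc k) = q⁻ ^ suc k * ρ l (suc k) + (q⁻ ^ x - q⁻ ^ k) * s * ρ l k

  parts : Partition n m → List ℕ
  parts ν = List.tabulate (part ν)

  R-ρ : (ν : Partition n m) → ∀ k → R k ν ≈ product (λ i → q ^ part ν i) * ρ (parts ν) k
  R-ρ {zero}  ν zero    = trans (R-terms ν 0) (+-identityʳ _)
  R-ρ {zero}  ν (suc k) = trans (R-terms ν (suc k))
    (trans (+-identityʳ _) (trans (zeroˡ _) (sym (zeroʳ _))))
  R-ρ {suc n} ν zero    = trans (R-zero ν)
    (trans (*-congˡ (R-ρ (tailPartition ν) zero)) (sym (*-assoc _ _ _)))
  R-ρ {suc n} ν (suc k) = begin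
    R (suc k) ν
      ≈⟨ R-suc ν k ⟩
    Y * A * R (suc k) ν′ + (1# - Y * B) * s * R k ν′
      ≈⟨ +-cong (*-congˡ (R-ρ ν′ (suc k)))
           (*-cong (*-congʳ (+-congʳ (sym (q^q⁻^ (part ν zero))))) (R-ρ ν′ k)) ⟩
    Y * A * (P * ρ l (suc k)) + (Y * Z - Y * B) * s * (P * ρ l k)
      ≈⟨ solve 8 (λ y a p r z b s t → y :* a :* (p :* r) :+ (y :* z :- y :* b) :* s :* (p :* t) :=
           y :* p :* (a :* r :+ (z :- b) :* s :* t)) refl Y A P (ρ l (suc k)) Z B s (ρ l k) ⟩
    Y * P * (A * ρ l (suc k) + (Z - B) * s * ρ l k)
      ∎
    where
    ν′ : Partition n _
    ν′ = tailPartition ν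
    l : List ℕ
    l = parts ν′
    P Y Z A B : Carrier
    P = product (λ i → q ^ part ν′ i)
    Y = q ^ part ν zero
    Z = q⁻ ^ part ν zero
    A = q⁻ ^ suc k
    B = q⁻ ^ k

  R-normalized : (ν : Partition n m) → ∀ k → (q ^ ∣ ν ∣) ⁻¹ * R k ν ≈ ρ (parts ν) k
  R-normalized ν k = begin
    (q ^ ∣ ν ∣) ⁻¹ * R k ν
      ≈⟨ *-congˡ (trans (R-ρ ν k) (*-congʳ (sym (q^∣∣ ν)))) ⟩
    (q ^ ∣ ν ∣) ⁻¹ * (q ^ ∣ ν ∣ * ρ (parts ν) k)
      ≈⟨ *-assoc _ _ _ ⟨
    (q ^ ∣ ν ∣) ⁻¹ * q ^ ∣ ν ∣ * ρ (parts ν) k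
      ≈⟨ *-congʳ (*-inverseˡ (q ^ ∣ ν ∣) (q^≉0 ∣ ν ∣)) ⟩
    1# * ρ (parts ν) k
      ≈⟨ *-identityˡ _ ⟩
    ρ (parts ν) k
      ∎

-- Functions of partitions with the modular law

-- Decreasing lists with entries at most u.
data Decreasing : ℕ → List ℕ → Set where
  []  : ∀ {u} → Decreasing u []
  _∷_ : ∀ {u x l} → x ≤ u → Decreasing x l → Decreasing u (x ∷ l)

Decreasing-weaken : ∀ {u v l} → u ≤ v → Decreasing u l → Decreasing v l
Decreasing-weaken u≤v []          = []
Decreasing-weaken u≤v (x≤u ∷ dec) = ℕ.≤-trans x≤u u≤v ∷ dec

Decreasing-replicate : ∀ j u → Decreasing u (replicate j u)
Decreasing-replicate zero    u = []
Decreasing-replicate (suc j) u = ℕ.≤-refl ∷ Decreasing-replicate j u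

Decreasing-0 : ∀ {l} → Decreasing 0 l → l ≡ replicate (length l) 0
Decreasing-0 []          = ≡.refl
Decreasing-0 (z≤n ∷ dec) = ≡.cong (0 ∷_) (Decreasing-0 dec)

module ModularFunctions {c ℓ} (F : QField c ℓ) where
  open QField F renaming (commutativeRing to K)
  open Sums K
  open IntegerSolver K
  open Powers F
  open Relation.Binary.Reasoning.Setoid setoid

  -- The modular law for three values of a function.
  Law : Carrier → Carrier → Carrier → Set ℓ
  Law f₀ f₁ f₂ = (1# + q) * f₁ ≈ q * f₂ + f₀

  -- The modular laws for a function of the row lengths, from top to bottom, of the
  -- partitions with at most n rows of length at most m.  A missing row is an empty
  -- row.  The row law makes no assumption on the other rows, and for the column
  -- law the case of a last row is sufficient.
  record Modular (n m : ℕ) (f : List ℕ → Carrier) : Set ℓ where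
    field
      rowLaw : ∀ α x β → length (α ++ x ∷ x ∷ β) ≤ n → x < m →
        Law (f (α ++ x ∷ x ∷ β)) (f (α ++ suc x ∷ x ∷ β)) (f (α ++ suc x ∷ suc x ∷ β))
      columnLaw : ∀ α x → length α < n → suc x < m → All (suc (suc x) ≤_) α →
        Law (f (α ++ x ∷ [])) (f (α ++ suc x ∷ [])) (f (α ++ suc (suc x) ∷ []))
      emptyRow : ∀ α → f (α ++ 0 ∷ []) ≈ f α

  law-0 : ∀ {f₀ f₁ f₂} → Law f₀ f₁ f₂ → f₁ ≈ 0# → f₂ ≈ 0# → f₀ ≈ 0#
  law-0 {f₀} {f₁} {f₂} law f₁≈0 f₂≈0 = begin
    f₀                ≈⟨ +-identityˡ f₀ ⟨
    0# + f₀           ≈⟨ +-congʳ (trans (*-congˡ f₂≈0) (zeroʳ q)) ⟨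
    q * f₂ + f₀       ≈⟨ law ⟨
    (1# + q) * f₁     ≈⟨ trans (*-congˡ f₁≈0) (zeroʳ _) ⟩
    0#                ∎

  -- For a solution f of the recurrence with first value 0, the product of f x and
  -- the power of q with exponent x is q f 1 times the q-analogue of x.
  module _ (f : ℕ → Carrier) (u : ℕ) (f-0 : f 0 ≈ 0#)
           (law : ∀ x → suc x < u → Law (f x) (f (suc x)) (f (suc (suc x)))) where

    private
      closed : ℕ → Set ℓ
      closed x = (1# - q) * (q ^ x * f x) ≈ q * (1# - q ^ x) * f 1

      closed-step : ∀ x → suc x < u → closed x → closed (suc x) → closed (suc (suc x))
      closed-step x x<u h h′ = begin
        (1# - q) * (q * (q * Q) * f (suc (suc x)))
          ≈⟨ solve 3 (λ q Q f → (con (+ 1) :- q) :* (q :* (q :* Q) :* f) :=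
               (con (+ 1) :- q) :* (q :* Q) :* (q :* f)) refl q Q (f (suc (suc x))) ⟩
        (1# - q) * (q * Q) * (q * f (suc (suc x)))
          ≈⟨ *-congˡ (solve 2 (λ a b → a := (a :+ b) :- b) refl _ _) ⟩
        (1# - q) * (q * Q) * (q * f (suc (suc x)) + f x - f x)
          ≈⟨ *-congˡ (+-congʳ (sym (law x x<u))) ⟩
        (1# - q) * (q * Q) * ((1# + q) * f (suc x) - f x)
          ≈⟨ solve 4 (λ q Q f f′ → (con (+ 1) :- q) :* (q :* Q) :* ((con (+ 1) :+ q) :* f′ :- f) :=
               (con (+ 1) :+ q) :* ((con (+ 1) :- q) :* (q :* Q :* f′)) :- q :* ((con (+ 1) :- q) :* (Q :* f)))
               refl q Q (f x) (f (suc x)) ⟩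
        (1# + q) * ((1# - q) * (q * Q * f (suc x))) - q * ((1# - q) * (Q * f x))
          ≈⟨ +-cong (*-congˡ h′) (-‿cong (*-congˡ h)) ⟩
        (1# + q) * (q * (1# - q * Q) * f 1) - q * (q * (1# - Q) * f 1)
          ≈⟨ solve 3 (λ q Q f → (con (+ 1) :+ q) :* (q :* (con (+ 1) :- q :* Q) :* f) :-
               q :* (q :* (con (+ 1) :- Q) :* f) :=
               q :* (con (+ 1) :- q :* (q :* Q)) :* f) refl q Q (f 1) ⟩
        q * (1# - q * (q * Q)) * f 1
          ∎
        where
        Q : Carrier
        Q = q ^ x

      closed-all : ∀ x → suc x ≤ u → closed x × closed (suc x)
      closed-all zero x<u =
        trans (trans (*-congˡ (trans (*-congˡ f-0) (zeroʳ _))) (zeroʳ _))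
          (solve 2 (λ q f → con (+ 0) := q :* (con (+ 1) :- con (+ 1)) :* f) refl q (f 1)) ,
        solve 2 (λ q f → (con (+ 1) :- q) :* (q :* con (+ 1) :* f) :=
          q :* (con (+ 1) :- q :* con (+ 1)) :* f) refl q (f 1)
      closed-all (suc x) x<u =
        let h , h′ = closed-all x (ℕ.<⇒≤ x<u) in h′ , closed-step x x<u h h′

    -- A solution that vanishes at 0 and at u vanishes in between, since no
    -- power of q is 1.
    interpolate : f u ≈ 0# → ∀ x → x ≤ u → f x ≈ 0#
    interpolate f-u zero    x≤u = f-0
    interpolate f-u (suc x) x≤u = cancel-≉0 (q ^ suc x) (f (suc x)) (q^≉0 (suc x))
      (cancel-≉0 (1# - q) _ 1-q≉0 (begin
        (1# - q) * (q ^ suc x * f (suc x))   ≈⟨ proj₂ (closed-all x x≤u) ⟩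
        q * (1# - q ^ suc x) * f 1           ≈⟨ *-congˡ (f-1 u f-u x≤u (closed-all)) ⟩
        q * (1# - q ^ suc x) * 0#            ≈⟨ zeroʳ _ ⟩
        0#                                   ∎))
      where
      f-1 : ∀ v → f v ≈ 0# → suc x ≤ v → (∀ x → suc x ≤ v → closed x × closed (suc x)) → f 1 ≈ 0#
      f-1 (suc v) f-v _ all = cancel-≉0 (q * (1# - q ^ suc v)) (f 1) (*-≉0 q _ q≉0 (1-q^≉0 v)) (begin
        q * (1# - q ^ suc v) * f 1           ≈⟨ proj₂ (all v ℕ.≤-refl) ⟨
        (1# - q) * (q ^ suc v * f (suc v))   ≈⟨ *-congˡ (trans (*-congˡ f-v) (zeroʳ _)) ⟩
        (1# - q) * 0#                        ≈⟨ zeroʳ _ ⟩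
        0#                                   ∎)

  module _ {n m : ℕ} {f : List ℕ → Carrier} (modular : Modular n m f) where
    open Modular modular

    private
      snoc : ∀ (α : List ℕ) x β → (α ++ x ∷ []) ++ β ≡ α ++ x ∷ β
      snoc α x β = List.++-assoc α (x ∷ []) β

      length-snoc : ∀ (α : List ℕ) {x} N → length α ℕ.+ suc N ≤ n → length (α ++ x ∷ []) ℕ.+ N ≤ n
      length-snoc α N h = ℕ.≤-trans (ℕ.≤-reflexive
        (≡.trans (≡.cong (ℕ._+ N) (List.length-++ α)) (ℕ.+-assoc (length α) 1 N))) h

    -- If f vanishes on the rectangles of width u below the rows α, then it
    -- vanishes on all partitions of width u with at most N rows below α.
    Claim : ℕ → ℕ → Set ℓ
    Claim N u = ∀ α → length α ℕ.+ N ≤ n → u ≤ m → All (u ≤_) α →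
      (∀ j → j ≤ N → f (α ++ replicate j u) ≈ 0#) →
      ∀ β → Decreasing u β → length β ≤ N → f (α ++ β) ≈ 0#

    -- Partitions of width u + 1 have fewer rows, or a first row of length u + 1,
    -- or width u.  In the last case the rectangle with N + 2 rows of length u has
    -- to be dealt with, by the row law for its first two rows.
    widen : ∀ {N u} → Claim (suc N) (suc u) → Claim (suc (suc N)) u → Claim (suc (suc N)) (suc u)
    widen {N} {u} claim claim′ α len u≤m α≥u h = all
      where
      shorter : ∀ β → Decreasing (suc u) β → length β ≤ suc N → f (α ++ β) ≈ 0#
      shorter = claim α
        (ℕ.≤-trans (ℕ.+-monoʳ-≤ (length α) (ℕ.n≤1+n (suc N))) len) u≤m α≥u
        (λ j j≤N → h j (ℕ.m≤n⇒m≤1+n j≤N))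

      full : ∀ β → Decreasing (suc u) β → length β ≤ suc N → f (α ++ suc u ∷ β) ≈ 0#
      full β dec β≤N = trans (reflexive (≡.cong f (≡.sym (snoc α (suc u) β))))
        (claim (α ++ suc u ∷ []) (length-snoc α (suc N) len) u≤m
          (All.++⁺ α≥u (ℕ.≤-refl ∷ []))
          (λ j j≤N → trans (reflexive (≡.cong f (snoc α (suc u) (replicate j (suc u)))))
            (h (suc j) (s≤s j≤N)))
          β dec β≤N)

      block : List ℕ
      block = replicate N u

      block≤N : length block ≤ N
      block≤N = ℕ.≤-reflexive (List.length-replicate N)

      u≤1+u : u ≤ suc u
      u≤1+u = ℕ.n≤1+n u

      dec-block : Decreasing u block
      dec-block = Decreasing-replicate N u

      rectangles : ∀ j → j ≤ suc (suc N) → f (α ++ replicate j u) ≈ 0#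
      rectangles j j≤N with ℕ.m≤n⇒m<n∨m≡n j≤N
      ... | inj₁ j<N = shorter (replicate j u) (Decreasing-weaken u≤1+u (Decreasing-replicate j u))
        (ℕ.≤-trans (ℕ.≤-reflexive (List.length-replicate j)) (ℕ.s≤s⁻¹ j<N))
      ... | inj₂ ≡.refl = law-0 (rowLaw α u block len′ u≤m)
        (full (u ∷ block) (u≤1+u ∷ dec-block) (s≤s block≤N))
        (full (suc u ∷ block) (ℕ.≤-refl ∷ Decreasing-weaken u≤1+u dec-block) (s≤s block≤N))
        where
        len′ : length (α ++ u ∷ u ∷ block) ≤ n
        len′ = ℕ.≤-trans (ℕ.≤-reflexive (≡.trans (List.length-++ α)
          (≡.cong (λ k → length α ℕ.+ suc (suc k)) (List.length-replicate N)))) len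

      narrower : ∀ β → Decreasing u β → length β ≤ suc (suc N) → f (α ++ β) ≈ 0#
      narrower = claim′ α len (ℕ.≤-trans u≤1+u u≤m)
        (All.map (ℕ.≤-trans u≤1+u) α≥u) rectangles

      all : ∀ β → Decreasing (suc u) β → length β ≤ suc (suc N) → f (α ++ β) ≈ 0#
      all []      dec         β≤N = shorter [] [] z≤n
      all (x ∷ β) (x≤u ∷ dec) β≤N with ℕ.m≤n⇒m<n∨m≡n x≤u
      ... | inj₁ x<1+u  = narrower (x ∷ β) (ℕ.s≤s⁻¹ x<1+u ∷ dec) β≤N
      ... | inj₂ ≡.refl = full β dec (ℕ.s≤s⁻¹ β≤N)

    vanishes : ∀ N u → Claim N u
    vanishes zero       u α len u≤m α≥u h [] dec β≤N = h 0 z≤n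
    vanishes (suc zero) u α len u≤m α≥u h [] dec β≤N = h 0 z≤n
    vanishes (suc zero) u α len u≤m α≥u h (x ∷ []) (x≤u ∷ _) β≤N = interpolate
      (λ x → f (α ++ x ∷ [])) u
      (trans (emptyRow α) (trans (reflexive (≡.cong f (≡.sym (List.++-identityʳ α)))) (h 0 z≤n)))
      (λ x x<u → columnLaw α x (ℕ.≤-trans (ℕ.≤-reflexive (ℕ.+-comm 1 (length α))) len)
        (ℕ.<-≤-trans x<u u≤m) (All.map (ℕ.≤-trans x<u) α≥u))
      (h 1 ℕ.≤-refl) x x≤u
    vanishes (suc zero) u α len u≤m α≥u h (_ ∷ _ ∷ _) dec (s≤s ())
    vanishes (suc (suc N)) zero    α len u≤m α≥u h β dec β≤N =
      trans (reflexive (≡.cong (λ β → f (α ++ β)) (Decreasing-0 dec))) (h (length β) β≤N)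
    vanishes (suc (suc N)) (suc u) = widen (vanishes (suc N) (suc u)) (vanishes (suc (suc N)) u)

    vanishes-on-rectangles : (∀ j → j ≤ n → f (replicate j m) ≈ 0#) →
      ∀ β → Decreasing m β → length β ≤ n → f β ≈ 0#
    vanishes-on-rectangles = vanishes n m [] ℕ.≤-refl ℕ.≤-refl []

-- Hit numbers

binomial-suc : ∀ k → suc k C 2 ≡ k ℕ.+ k C 2
binomial-suc k = ≡.trans (≡.sym (nCk+nC[k+1]≡[n+1]C[k+1] k 1)) (≡.cong (ℕ._+ k C 2) (nC1≡n k))

binomial≤ : ∀ m k → k ≤ m → k C 2 ≤ m ℕ.* k
binomial≤ m zero    _   = z≤n
binomial≤ m (suc k) k<m = ℕ.≤-trans (ℕ.≤-reflexive (binomial-suc k))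
  (ℕ.≤-trans (ℕ.+-mono-≤ (ℕ.<⇒≤ k<m) (binomial≤ m k (ℕ.<⇒≤ k<m)))
    (ℕ.≤-reflexive (≡.sym (ℕ.*-suc m k))))

-- The truncated subtractions are exact.
exponent-suc : ∀ m k → suc k ≤ m →
  (m ℕ.* suc k ∸ suc k C 2) ℕ.+ k ≡ m ℕ.+ (m ℕ.* k ∸ k C 2)
exponent-suc m k k<m = begin
  (m ℕ.* suc k ∸ suc k C 2) ℕ.+ k
    ≡⟨ ℕ.+-∸-comm k (binomial≤ m (suc k) k<m) ⟨
  m ℕ.* suc k ℕ.+ k ∸ suc k C 2
    ≡⟨ ≡.cong₂ _∸_ (ℕ.+-comm (m ℕ.* suc k) k) (binomial-suc k) ⟩
  (k ℕ.+ m ℕ.* suc k) ∸ (k ℕ.+ k C 2)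
    ≡⟨ ℕ.[m+n]∸[m+o]≡n∸o k (m ℕ.* suc k) (k C 2) ⟩
  m ℕ.* suc k ∸ k C 2
    ≡⟨ ≡.cong (_∸ k C 2) (ℕ.*-suc m k) ⟩
  m ℕ.+ m ℕ.* k ∸ k C 2
    ≡⟨ ℕ.+-∸-assoc m (binomial≤ m k (ℕ.<⇒≤ k<m)) ⟩
  m ℕ.+ (m ℕ.* k ∸ k C 2)
    ∎
  where open ≡.≡-Reasoning

module RookLaws {c ℓ} (F : QField c ℓ) where
  open QField F renaming (commutativeRing to K)
  open Sums K
  open IntegerSolver K
  open Powers F
  open Rooks F using (ρ)
  open ModularFunctions F
  open Relation.Binary.Reasoning.Setoid setoid

  ρ-emptyRow : ∀ α k → ρ (α ++ 0 ∷ []) k ≈ ρ α k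
  ρ-emptyRow (a ∷ α) zero    = ρ-emptyRow α zero
  ρ-emptyRow (a ∷ α) (suc k) = +-cong (*-congˡ (ρ-emptyRow α (suc k))) (*-congˡ (ρ-emptyRow α k))
  ρ-emptyRow []      zero    = refl
  ρ-emptyRow []      (suc zero) = solve 2 (λ a s → a :* con (+ 0) :+
    (con (+ 1) :- con (+ 1)) :* s :* con (+ 1) := con (+ 0)) refl (q⁻ ^ 1) s
  ρ-emptyRow []      (suc (suc k)) = solve 3 (λ a b s → a :* con (+ 0) :+
    (con (+ 1) :- b) :* s :* con (+ 0) := con (+ 0)) refl (q⁻ ^ suc (suc k)) (q⁻ ^ suc k) s

  ρ-long : ∀ l k → length l < k → ρ l k ≈ 0#
  ρ-long []      (suc k) _         = refl
  ρ-long (a ∷ l) (suc k) (s≤s l<k) = trans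
    (+-cong (trans (*-congˡ (ρ-long l (suc k) (ℕ.m<n⇒m<1+n l<k))) (zeroʳ _))
      (trans (*-congˡ (ρ-long l k l<k)) (zeroʳ _)))
    (+-identityˡ 0#)

  -- The recursion of ρ is linear.
  law-prefix : ∀ α {l₀ l₁ l₂} → (∀ k → Law (ρ l₀ k) (ρ l₁ k) (ρ l₂ k)) →
    ∀ k → Law (ρ (α ++ l₀) k) (ρ (α ++ l₁) k) (ρ (α ++ l₂) k)
  law-prefix []      h k       = h k
  law-prefix (a ∷ α) h zero    = law-prefix α h zero
  law-prefix (a ∷ α) {l₀} {l₁} {l₂} h (suc k) = begin
    (1# + q) * (A * ρ (α ++ l₁) (suc k) + B * ρ (α ++ l₁) k)
      ≈⟨ solve 5 (λ q A B x y → (con (+ 1) :+ q) :* (A :* x :+ B :* y) :=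
           A :* ((con (+ 1) :+ q) :* x) :+ B :* ((con (+ 1) :+ q) :* y)) refl q A B _ _ ⟩
    A * ((1# + q) * ρ (α ++ l₁) (suc k)) + B * ((1# + q) * ρ (α ++ l₁) k)
      ≈⟨ +-cong (*-congˡ (law-prefix α h (suc k))) (*-congˡ (law-prefix α h k)) ⟩
    A * (q * ρ (α ++ l₂) (suc k) + ρ (α ++ l₀) (suc k)) + B * (q * ρ (α ++ l₂) k + ρ (α ++ l₀) k)
      ≈⟨ solve 7 (λ q A B x y x′ y′ → A :* (q :* x :+ x′) :+ B :* (q :* y :+ y′) :=
           q :* (A :* x :+ B :* y) :+ (A :* x′ :+ B :* y′)) refl q A B _ _ _ _ ⟩
    q * (A * ρ (α ++ l₂) (suc k) + B * ρ (α ++ l₂) k) + (A * ρ (α ++ l₀) (suc k) + B * ρ (α ++ l₀) k)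
      ∎
    where
    A B : Carrier
    A = q⁻ ^ suc k
    B = (q⁻ ^ a - q⁻ ^ k) * s

  private
    -- An identity follows from one up to a multiple of q q⁻ - 1, with cofactor z.
    by-inverse : ∀ {x y} z → x ≈ y + (q * q⁻ - 1#) * z → x ≈ y
    by-inverse {x} {y} z h = begin
      x                        ≈⟨ h ⟩
      y + (q * q⁻ - 1#) * z    ≈⟨ +-congˡ (*-congʳ (trans (+-congʳ qq⁻) (-‿inverseʳ 1#))) ⟩
      y + 0# * z               ≈⟨ trans (+-congˡ (zeroˡ z)) (+-identityʳ y) ⟩
      y                        ∎

    one+q : ∀ r → (1# + q) * r ≈ q * r + r
    one+q r = trans (distribʳ _ _ _) (trans (+-comm _ _) (+-congˡ (*-identityˡ r)))

  column-law : ∀ x l k → Law (ρ (x ∷ l) k) (ρ (suc x ∷ l) k) (ρ (suc (suc x) ∷ l) k)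
  column-law x l zero    = one+q (ρ l zero)
  column-law x l (suc k) = by-inverse ((X - q⁻ * X) * s * ρ l k)
    (solve 8 (λ q p X A B s r r′ →
      (con (+ 1) :+ q) :* (A :* r :+ (p :* X :- B) :* s :* r′) :=
      (q :* (A :* r :+ (p :* (p :* X) :- B) :* s :* r′) :+ (A :* r :+ (X :- B) :* s :* r′)) :+
      (q :* p :- con (+ 1)) :* ((X :- p :* X) :* s :* r′))
      refl q q⁻ X (q⁻ ^ suc k) (q⁻ ^ k) s (ρ l (suc k)) (ρ l k))
    where
    X : Carrier
    X = q⁻ ^ x

  row-law : ∀ x l k →
    Law (ρ (x ∷ x ∷ l) k) (ρ (suc x ∷ x ∷ l) k) (ρ (suc x ∷ suc x ∷ l) k)
  row-law x l zero       = one+q (ρ l zero)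
  row-law x l (suc zero) = by-inverse ((X - q⁻ * X) * s * ρ l 0)
    (solve 6 (λ q p X s r₀ r₁ →
      (con (+ 1) :+ q) :* (p :* con (+ 1) :* (p :* con (+ 1) :* r₁ :+ (X :- con (+ 1)) :* s :* r₀) :+
        (p :* X :- con (+ 1)) :* s :* r₀) :=
      (q :* (p :* con (+ 1) :* (p :* con (+ 1) :* r₁ :+ (p :* X :- con (+ 1)) :* s :* r₀) :+
        (p :* X :- con (+ 1)) :* s :* r₀) :+
      (p :* con (+ 1) :* (p :* con (+ 1) :* r₁ :+ (X :- con (+ 1)) :* s :* r₀) :+
        (X :- con (+ 1)) :* s :* r₀)) :+
      (q :* p :- con (+ 1)) :* ((X :- p :* X) :* s :* r₀))
      refl q q⁻ X s (ρ l 0) (ρ l 1))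
    where
    X : Carrier
    X = q⁻ ^ x
  row-law x l (suc (suc k)) = by-inverse
    ((X - q⁻ * X) * (q⁻ * A) * s * ρ l (suc k) + s * s * ρ l k * (X * X - q⁻ * X * X - A * (X - q⁻ * X)))
    (solve 8 (λ q p X A s r₀ r₁ r₂ →
      let T = λ a b → p :* (p :* A) :* (p :* (p :* A) :* r₂ :+ (b :- p :* A) :* s :* r₁) :+
                (a :- p :* A) :* s :* (p :* A :* r₁ :+ (b :- A) :* s :* r₀)
      in (con (+ 1) :+ q) :* T (p :* X) X :=
      (q :* T (p :* X) (p :* X) :+ T X X) :+
      (q :* p :- con (+ 1)) :* ((X :- p :* X) :* (p :* A) :* s :* r₁ :+
        s :* s :* r₀ :* (X :* X :- p :* X :* X :- A :* (X :- p :* X))))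
      refl q q⁻ X A s (ρ l k) (ρ l (suc k)) (ρ l (suc (suc k))))
    where
    X A : Carrier
    X = q⁻ ^ x
    A = q⁻ ^ k

  -- The q-analogues of natural numbers, falling factorials and factorials.
  [_] : ℕ → Carrier
  [ x ] = (1# - q ^ x) * s

  [_]↓_ : ℕ → ℕ → Carrier
  [ a ]↓ k = product {k} λ i → [ a ∸ toℕ i ]

  [_]! : ℕ → Carrier
  [ a ]! = [ a ]↓ a

  [suc]≉0 : ∀ a → ¬ [ suc a ] ≈ 0#
  [suc]≉0 a = *-≉0 (1# - q ^ suc a) s (1-q^≉0 a) (⁻¹-≉0 (1# - q) 1-q≉0)

  ↓≉0 : ∀ a k → k ≤ a → ¬ [ a ]↓ k ≈ 0#
  ↓≉0 a       zero    _         = 1≉0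
  ↓≉0 (suc a) (suc k) (s≤s k≤a) = *-≉0 [ suc a ] ([ a ]↓ k) ([suc]≉0 a) (↓≉0 a k k≤a)

  !-split : ∀ a k → k ≤ a → [ a ]! ≈ [ a ]↓ k * [ a ∸ k ]!
  !-split a       zero    _         = sym (*-identityˡ _)
  !-split (suc a) (suc k) (s≤s k≤a) = trans (*-congˡ (!-split a k k≤a)) (sym (*-assoc _ _ _))

  module _ (m : ℕ) where

    -- The coefficient with which the k-th rook number enters the hit polynomial,
    -- besides the q-Pochhammer symbol.
    hitWeight : ℕ → Carrier
    hitWeight k = [ m ∸ k ]! * (- 1#) ^ k * q ^ (m ℕ.* k ∸ k C 2)

    hitWeight-zero : hitWeight 0 ≈ [ m ]!
    hitWeight-zero = trans
      (*-cong (*-identityʳ _) (reflexive (≡.cong (λ e → q ^ (e ∸ 0 C 2)) (ℕ.*-zeroʳ m))))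
      (*-identityʳ _)

    -- The factor on the left is the one with which a first row of length m enters
    -- the recursion of ρ.
    hitWeight-suc : ∀ k → k < m →
      (q⁻ ^ m - q⁻ ^ k) * s * hitWeight (suc k) ≈ - (q⁻ ^ k * hitWeight k)
    hitWeight-suc k k<m = begin
      (Z - P) * s * (N * (- 1# * S) * E′)
        ≈⟨ *-congˡ (*-congˡ E′≈) ⟩
      (Z - P) * s * (N * (- 1# * S) * (Y * D * P * E))
        ≈⟨ solve 8 (λ Z P s N S Y D E →
             (Z :- P) :* s :* (N :* (:- con (+ 1) :* S) :* (Y :* D :* P :* E)) :=
             :- (P :* (((Y :* D) :* Z :- D :* (Y :* P)) :* s :* N :* S :* E)))
             refl Z P s N S Y D E ⟩
      - (P * ((Y * D * Z - D * (Y * P)) * s * N * S * E))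
        ≈⟨ -‿cong (*-congˡ (*-congʳ (*-congʳ (*-congʳ (*-congʳ
             (+-cong YDZ (-‿cong (trans (*-congˡ (q^q⁻^ k)) (*-identityʳ D))))))))) ⟩
      - (P * ((1# - D) * s * N * S * E))
        ≡⟨ ≡.cong (λ a → - (P * (a * S * E))) (≡.cong [_]! (≡.sym m∸k)) ⟩
      - (P * ([ m ∸ k ]! * S * E))
        ∎
      where
      d : ℕ
      d = m ∸ k
      m∸k : m ∸ k ≡ suc (m ∸ suc k)
      m∸k = ℕ.+-∸-assoc 1 k<m
      Z P Y D S N E E′ : Carrier
      Z  = q⁻ ^ m
      P  = q⁻ ^ k
      Y  = q ^ k
      D  = q ^ suc (m ∸ suc k)
      S  = (- 1#) ^ k
      N  = [ m ∸ suc k ]!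
      E  = q ^ (m ℕ.* k ∸ k C 2)
      E′ = q ^ (m ℕ.* suc k ∸ suc k C 2)

      YD : q ^ m ≈ Y * D
      YD = trans (reflexive (≡.cong (q ^_) (≡.trans (≡.sym (ℕ.m+[n∸m]≡n (ℕ.<⇒≤ k<m)))
        (≡.cong (k ℕ.+_) m∸k)))) (^-homo-* q k (suc (m ∸ suc k)))

      YDZ : Y * D * Z ≈ 1#
      YDZ = trans (*-congʳ (sym YD)) (q^q⁻^ m)

      E′≈ : E′ ≈ Y * D * P * E
      E′≈ = begin
        E′                    ≈⟨ *-identityʳ E′ ⟨
        E′ * 1#               ≈⟨ *-congˡ (q^q⁻^ k) ⟨
        E′ * (Y * P)          ≈⟨ *-assoc _ _ _ ⟨
        E′ * Y * P            ≈⟨ *-congʳ (^-homo-* q (m ℕ.* suc k ∸ suc k C 2) k) ⟨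
        q ^ ((m ℕ.* suc k ∸ suc k C 2) ℕ.+ k) * P
                              ≡⟨ ≡.cong (λ e → q ^ e * P) (exponent-suc m k k<m) ⟩
        q ^ (m ℕ.+ (m ℕ.* k ∸ k C 2)) * P
                              ≈⟨ *-congʳ (^-homo-* q m (m ℕ.* k ∸ k C 2)) ⟩
        q ^ m * E * P         ≈⟨ *-congʳ (*-congʳ YD) ⟩
        Y * D * E * P         ≈⟨ solve 3 (λ a b c → a :* b :* c := a :* c :* b) refl (Y * D) E P ⟩
        Y * D * P * E         ∎

module HitNumbers {c ℓ} (F : QField c ℓ) where
  open QField F renaming (commutativeRing to K)
  open Sums K
  open IntegerSolver K
  open Powers F
  open Rooks F
  open ModularFunctions F
  open RookLaws F
  open Algebra.Properties.Ring ring using (x∙y⁻¹≈ε⇒x≈y)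
  open Relation.Binary.Reasoning.Setoid setoid
  module Poly = PolynomialRing K
  open Poly using (coeff; const; var; _⊕_; _⊛_; _≃_; at)
  private
    module PolyRing = CommutativeRing Poly.commutativeRing
    module PolySum = Algebra.Properties.CommutativeMonoid.Sum PolyRing.+-commutativeMonoid
    module PolyProduct = Algebra.Properties.CommutativeMonoid.Sum PolyRing.*-commutativeMonoid

  coeff-sum : ∀ n (f : Fin n → Poly.Poly) j →
    coeff (PolySum.sum f) j ≈ sum (λ i → coeff (f i) j)
  coeff-sum zero    f j = refl
  coeff-sum (suc n) f j = trans (Poly.coeff-⊕ (f zero) (PolySum.sum (f ∘ suc)) j)
    (+-congˡ (coeff-sum n (f ∘ suc) j))

  -- The factors of the q-Pochhammer symbols, and the symbols.
  pochhammerFactor : ℕ → Poly.Poly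
  pochhammerFactor k = PolyRing.1# PolyRing.+ (PolyRing.- (var PolyRing.* const (q ^ k)))

  pochhammer : ℕ → Poly.Poly
  pochhammer k = PolyProduct.sum {k} λ i → pochhammerFactor (toℕ i)

  pochhammer-suc : ∀ k → pochhammer (suc k) ≃ pochhammer k ⊛ pochhammerFactor k
  pochhammer-suc k = PolyRing.trans
    (PolyProduct.sum-init-last {k} (λ i → pochhammerFactor (toℕ i)))
    (PolyRing.reflexive (≡.cong₂ _⊛_
      (PolyProduct.sum-cong-≗ {k} (λ i → ≡.cong pochhammerFactor (Fin.toℕ-inject₁ i)))
      (≡.cong pochhammerFactor (Fin.toℕ-fromℕ k))))

  -- Multiplication by 1 - a x, where a is the power of q with exponent k.
  times-factor : ∀ p k → p ⊛ pochhammerFactor k ≃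
    p PolyRing.- (const (q ^ k) ⊛ (0# ∷ p))
  times-factor p k = PolyRing.trans (PolyRing.distribˡ p PolyRing.1# (PolyRing.- (var ⊛ const a)))
    (PolyRing.+-cong (PolyRing.*-identityʳ p) (PolyRing.trans
      (PolyRing.sym (-‿distribʳ-* p (var ⊛ const a)))
      (PolyRing.-‿cong (PolyRing.trans (PolyRing.sym (PolyRing.*-assoc p var (const a)))
        (PolyRing.trans (PolyRing.*-comm (p ⊛ var) (const a))
          (PolyRing.*-congˡ {const a} (PolyRing.trans (PolyRing.*-comm p var) var-⊛)))))))
    where
    open Algebra.Properties.Ring PolyRing.ring using (-‿distribʳ-*)
    a : Carrier
    a = q ^ k
    var-⊛ : var ⊛ p ≃ 0# ∷ p
    var-⊛ = PolyRing.trans (Poly.0∷-⊛ PolyRing.1# p) (Poly.∷-cong refl (PolyRing.*-identityˡ p))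

  -- The coefficients of the q-Pochhammer symbols.
  γ : ℕ → ℕ → Carrier
  γ k j = coeff (pochhammer k) j

  private
    γ-suc : ∀ k j → γ (suc k) j ≈ γ k j - q ^ k * coeff (0# ∷ pochhammer k) j
    γ-suc k j = begin
      γ (suc k) j
        ≈⟨ at (PolyRing.trans (pochhammer-suc k) (times-factor (pochhammer k) k)) j ⟩
      coeff (pochhammer k PolyRing.- (const (q ^ k) ⊛ (0# ∷ pochhammer k))) j
        ≈⟨ Poly.coeff-⊕ (pochhammer k) _ j ⟩
      γ k j + coeff (PolyRing.- (const (q ^ k) ⊛ (0# ∷ pochhammer k))) j
        ≈⟨ +-congˡ (trans (Poly.coeff-neg (const (q ^ k) ⊛ (0# ∷ pochhammer k)) j)
             (-‿cong (Poly.coeff-const-⊛ (q ^ k) (0# ∷ pochhammer k) j))) ⟩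
      γ k j - q ^ k * coeff (0# ∷ pochhammer k) j
        ∎

  γ-suc-zero : ∀ k → γ (suc k) 0 ≈ γ k 0
  γ-suc-zero k = trans (γ-suc k 0) (solve 2 (λ a b → a :- b :* con (+ 0) := a) refl (γ k 0) (q ^ k))

  γ-suc-suc : ∀ k j → γ (suc k) (suc j) ≈ γ k (suc j) - q ^ k * γ k j
  γ-suc-suc k j = γ-suc k (suc j)

  -- The sum of f over 0, …, n - 1.
  Σ< : ℕ → (ℕ → Carrier) → Carrier
  Σ< n f = sum {n} (λ i → f (toℕ i))

  Σ<-last : ∀ n f → Σ< (suc n) f ≈ Σ< n f + f n
  Σ<-last zero    f = +-comm _ _
  Σ<-last (suc n) f = trans (+-congˡ (Σ<-last n (f ∘ suc))) (sym (+-assoc _ _ _))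

  Σ<-cong : ∀ n {f g} → (∀ k → k < n → f k ≈ g k) → Σ< n f ≈ Σ< n g
  Σ<-cong n h = sum-cong {n} λ i → h (toℕ i) (Fin.toℕ<n i)

  Σ<-truncate : ∀ n f → f n ≈ 0# → Σ< (suc n) f ≈ Σ< n f
  Σ<-truncate n f h = trans (Σ<-last n f) (trans (+-congˡ h) (+-identityʳ _))

  module _ (m n : ℕ) (n≤m : n ≤ m) where

    -- The coefficient with exponent j of the hit polynomial of the partition with
    -- rows l, without the denominator [m - n]!.
    unscaledHit : ℕ → List ℕ → Carrier
    unscaledHit j l = Σ< (suc n) λ k → ρ l k * (hitWeight m k * γ k j)

    -- The Kronecker symbol.
    δ : ℕ → ℕ → Carrier
    δ i j = χ (i ℕ.≟ j)

    -- The coefficients of x times the polynomial with coefficients f.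
    shift : (ℕ → Carrier) → ℕ → Carrier
    shift f zero    = 0#
    shift f (suc j) = f j

    -- A full row on top multiplies the hit polynomial by x: after a summation by
    -- parts, the term with index k contains the difference of two consecutive
    -- q-Pochhammer symbols.
    unscaledHit-full-row : ∀ l → length l < n → ∀ j →
      unscaledHit j (m ∷ l) ≈ shift (λ j → unscaledHit j l) j
    unscaledHit-full-row l l<n j = begin
      ρ l 0 * (hitWeight m 0 * γ 0 j) + Σ< n (λ k → ρ (m ∷ l) (suc k) * (hitWeight m (suc k) * γ (suc k) j))
        ≈⟨ +-cong (trans (sym (*-identityˡ _)) (sym (*-assoc _ _ _))) (Σ<-cong n step) ⟩
      A 0 * (hitWeight m 0 * γ 0 j) + Σ< n (λ k → A (suc k) * (hitWeight m (suc k) * γ (suc k) j) -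
        A k * (hitWeight m k * γ (suc k) j))
        ≈⟨ +-congˡ (Σ<-sub n (B ∘ suc) D) ⟩
      A 0 * (hitWeight m 0 * γ 0 j) + (Σ< n (λ k → A (suc k) * (hitWeight m (suc k) * γ (suc k) j)) -
        Σ< n (λ k → A k * (hitWeight m k * γ (suc k) j)))
        ≈⟨ +-assoc _ _ _ ⟨
      Σ< (suc n) (λ k → A k * (hitWeight m k * γ k j)) - Σ< n (λ k → A k * (hitWeight m k * γ (suc k) j))
        ≈⟨ +-congʳ (Σ<-truncate n (λ k → A k * (hitWeight m k * γ k j))
             (trans (*-congʳ (trans (*-congˡ last) (zeroʳ _))) (zeroˡ _))) ⟩
      Σ< n (λ k → A k * (hitWeight m k * γ k j)) - Σ< n (λ k → A k * (hitWeight m k * γ (suc k) j))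
        ≈⟨ Σ<-sub n B D ⟨
      Σ< n (λ k → A k * (hitWeight m k * γ k j) - A k * (hitWeight m k * γ (suc k) j))
        ≈⟨ finish j ⟩
      shift (λ j → unscaledHit j l) j
        ∎
      where
      A : ℕ → Carrier
      A k = q⁻ ^ k * ρ l k

      B D : ℕ → Carrier
      B k = A k * (hitWeight m k * γ k j)
      D k = A k * (hitWeight m k * γ (suc k) j)

      last : ρ l n ≈ 0#
      last = ρ-long l n l<n

      Σ<-sub : ∀ n f g → Σ< n (λ k → f k - g k) ≈ Σ< n f - Σ< n g
      Σ<-sub zero    f g = sym (-‿inverseʳ 0#)
      Σ<-sub (suc n) f g = trans (+-congˡ (Σ<-sub n (f ∘ suc) (g ∘ suc)))
        (solve 4 (λ a b c d → (a :- b) :+ (c :- d) := (a :+ c) :- (b :+ d)) refl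
          (f 0) (g 0) (Σ< n (f ∘ suc)) (Σ< n (g ∘ suc)))

      step : ∀ k → k < n → ρ (m ∷ l) (suc k) * (hitWeight m (suc k) * γ (suc k) j) ≈
        A (suc k) * (hitWeight m (suc k) * γ (suc k) j) - A k * (hitWeight m k * γ (suc k) j)
      step k k<n = begin
        (A (suc k) + (q⁻ ^ m - q⁻ ^ k) * s * ρ l k) * (hitWeight m (suc k) * γ (suc k) j)
          ≈⟨ solve 5 (λ a b r w g → (a :+ b :* r) :* (w :* g) := a :* (w :* g) :+ r :* g :* (b :* w))
               refl (A (suc k)) ((q⁻ ^ m - q⁻ ^ k) * s) (ρ l k) (hitWeight m (suc k)) (γ (suc k) j) ⟩
        A (suc k) * (hitWeight m (suc k) * γ (suc k) j) +
        ρ l k * γ (suc k) j * ((q⁻ ^ m - q⁻ ^ k) * s * hitWeight m (suc k))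
          ≈⟨ +-congˡ (*-congˡ (hitWeight-suc m k (ℕ.<-≤-trans k<n n≤m))) ⟩
        A (suc k) * (hitWeight m (suc k) * γ (suc k) j) +
        ρ l k * γ (suc k) j * - (q⁻ ^ k * hitWeight m k)
          ≈⟨ +-congˡ (solve 4 (λ r g p w → r :* g :* :- (p :* w) := :- (p :* r :* (w :* g)))
               refl (ρ l k) (γ (suc k) j) (q⁻ ^ k) (hitWeight m k)) ⟩
        A (suc k) * (hitWeight m (suc k) * γ (suc k) j) - A k * (hitWeight m k * γ (suc k) j)
          ∎

      finish : ∀ j → Σ< n (λ k → A k * (hitWeight m k * γ k j) - A k * (hitWeight m k * γ (suc k) j)) ≈
        shift (λ j → unscaledHit j l) j
      finish zero = sum-0 {n} λ i → trans
        (+-congˡ (-‿cong (*-congˡ (*-congˡ (γ-suc-zero (toℕ i)))))) (-‿inverseʳ _)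
      finish (suc j) = begin
        Σ< n (λ k → A k * (hitWeight m k * γ k (suc j)) - A k * (hitWeight m k * γ (suc k) (suc j)))
          ≈⟨ Σ<-cong n (λ k _ → begin
               A k * (hitWeight m k * γ k (suc j)) - A k * (hitWeight m k * γ (suc k) (suc j))
                 ≈⟨ +-congˡ (-‿cong (*-congˡ (*-congˡ (γ-suc-suc k j)))) ⟩
               A k * (hitWeight m k * γ k (suc j)) - A k * (hitWeight m k * (γ k (suc j) - q ^ k * γ k j))
                 ≈⟨ solve 6 (λ p r w g g′ Q →
                      p :* r :* (w :* g) :- p :* r :* (w :* (g :- Q :* g′)) := Q :* p :* (r :* (w :* g′)))
                      refl (q⁻ ^ k) (ρ l k) (hitWeight m k) (γ k (suc j)) (γ k j) (q ^ k) ⟩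
               q ^ k * q⁻ ^ k * (ρ l k * (hitWeight m k * γ k j))
                 ≈⟨ trans (*-congʳ (q^q⁻^ k)) (*-identityˡ _) ⟩
               ρ l k * (hitWeight m k * γ k j)
                 ∎) ⟩
        Σ< n (λ k → ρ l k * (hitWeight m k * γ k j))
          ≈⟨ Σ<-truncate n (λ k → ρ l k * (hitWeight m k * γ k j)) (trans (*-congʳ last) (zeroˡ _)) ⟨
        unscaledHit j l
          ∎

    unscaledHit-rectangle : ∀ i → i ≤ n → ∀ j → unscaledHit j (replicate i m) ≈ [ m ]! * δ i j
    unscaledHit-rectangle (suc i) i<n j = trans
      (unscaledHit-full-row (replicate i m) (ℕ.≤-trans (ℕ.≤-reflexive (≡.cong suc (List.length-replicate i))) i<n) j)
      (shifted j)
      where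
      shifted : ∀ j → shift (λ j → unscaledHit j (replicate i m)) j ≈ [ m ]! * δ (suc i) j
      shifted zero    = sym (zeroʳ _)
      shifted (suc j) = trans (unscaledHit-rectangle i (ℕ.<⇒≤ i<n) j)
        (*-congˡ (choose-⇔ (i ℕ.≟ j) (suc i ℕ.≟ suc j) (≡.cong suc) ℕ.suc-injective))
    unscaledHit-rectangle zero i≤n j = begin
      1# * (hitWeight m 0 * γ 0 j) + Σ< n (λ k → 0# * (hitWeight m (suc k) * γ (suc k) j))
        ≈⟨ +-cong (*-identityˡ _) (sum-0 {n} λ i → zeroˡ _) ⟩
      hitWeight m 0 * γ 0 j + 0#
        ≈⟨ +-identityʳ _ ⟩
      hitWeight m 0 * γ 0 j
        ≈⟨ *-cong (hitWeight-zero m) (γ-zero j) ⟩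
      [ m ]! * δ 0 j
        ∎
      where
      γ-zero : ∀ j → γ 0 j ≈ δ 0 j
      γ-zero zero    = refl
      γ-zero (suc j) = refl

    -- The hit numbers, as functions of the row lengths.
    hit : ℕ → List ℕ → Carrier
    hit j l = [ m ∸ n ]! ⁻¹ * unscaledHit j l

    !≉0 : ∀ a → ¬ [ a ]! ≈ 0#
    !≉0 a = ↓≉0 a a ℕ.≤-refl

    hit-rectangle : ∀ i → i ≤ n → ∀ j → hit j (replicate i m) ≈ [ m ]↓ n * δ i j
    hit-rectangle i i≤n j = begin
      [ m ∸ n ]! ⁻¹ * unscaledHit j (replicate i m)
        ≈⟨ *-congˡ (trans (unscaledHit-rectangle i i≤n j) (*-congʳ (!-split m n n≤m))) ⟩
      [ m ∸ n ]! ⁻¹ * ([ m ]↓ n * [ m ∸ n ]! * δ i j)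
        ≈⟨ solve 4 (λ a b c d → a :* (b :* c :* d) := a :* c :* (b :* d)) refl
             ([ m ∸ n ]! ⁻¹) ([ m ]↓ n) ([ m ∸ n ]!) (δ i j) ⟩
      [ m ∸ n ]! ⁻¹ * [ m ∸ n ]! * ([ m ]↓ n * δ i j)
        ≈⟨ trans (*-congʳ (*-inverseˡ _ (!≉0 (m ∸ n)))) (*-identityˡ _) ⟩
      [ m ]↓ n * δ i j
        ∎

  module _ (m n : ℕ) (n≤m : n ≤ m) where

    -- The hit polynomial of a partition, in terms of its rook numbers.
    hitPolynomial : Partition n m → Poly.Poly
    hitPolynomial ν =
      const ((q ^ ∣ ν ∣) ⁻¹ * [ m ∸ n ]! ⁻¹) PolyRing.*
      PolySum.sum {suc n} (λ i → let k = toℕ i in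
        const (R k ν * [ m ∸ k ]! * (- 1#) ^ k * q ^ (m ℕ.* k ∸ k C 2)) PolyRing.* pochhammer k)

    coeff-hitPolynomial : ∀ ν j → coeff (hitPolynomial ν) j ≈ hit m n n≤m j (parts ν)
    coeff-hitPolynomial ν j = begin
      coeff (hitPolynomial ν) j
        ≈⟨ Poly.coeff-const-⊛ ((q ^ ∣ ν ∣) ⁻¹ * [ m ∸ n ]! ⁻¹) (PolySum.sum {suc n} f) j ⟩
      (q ^ ∣ ν ∣) ⁻¹ * [ m ∸ n ]! ⁻¹ * coeff (PolySum.sum {suc n} f) j
        ≈⟨ *-congˡ (trans (coeff-sum (suc n) f j) (sum-cong {suc n} λ i →
             Poly.coeff-const-⊛ (a (toℕ i)) (pochhammer (toℕ i)) j)) ⟩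
      (q ^ ∣ ν ∣) ⁻¹ * [ m ∸ n ]! ⁻¹ * sum {suc n} (λ i → a (toℕ i) * γ (toℕ i) j)
        ≈⟨ trans (*-congʳ (*-comm _ _)) (*-assoc _ _ _) ⟩
      [ m ∸ n ]! ⁻¹ * ((q ^ ∣ ν ∣) ⁻¹ * sum {suc n} (λ i → a (toℕ i) * γ (toℕ i) j))
        ≈⟨ *-congˡ (*-distribˡ-sum {suc n} ((q ^ ∣ ν ∣) ⁻¹) (λ i → a (toℕ i) * γ (toℕ i) j)) ⟩
      [ m ∸ n ]! ⁻¹ * sum {suc n} (λ i → (q ^ ∣ ν ∣) ⁻¹ * (a (toℕ i) * γ (toℕ i) j))
        ≈⟨ *-congˡ (sum-cong {suc n} λ i → normalize (toℕ i)) ⟩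
      hit m n n≤m j (parts ν)
        ∎
      where
      a : ℕ → Carrier
      a k = R k ν * [ m ∸ k ]! * (- 1#) ^ k * q ^ (m ℕ.* k ∸ k C 2)
      f : Fin (suc n) → Poly.Poly
      f i = const (a (toℕ i)) PolyRing.* pochhammer (toℕ i)
      normalize : ∀ k → (q ^ ∣ ν ∣) ⁻¹ * (a k * γ k j) ≈ ρ (parts ν) k * (hitWeight m k * γ k j)
      normalize k = trans
        (solve 6 (λ Q r f s E g → Q :* (r :* f :* s :* E :* g) := Q :* r :* (f :* s :* E :* g)) refl
          ((q ^ ∣ ν ∣) ⁻¹) (R k ν) ([ m ∸ k ]!) ((- 1#) ^ k) (q ^ (m ℕ.* k ∸ k C 2)) (γ k j))
        (*-congʳ (R-normalized ν k))

  -- The modular law is linear.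
  law-* : ∀ a {f₀ f₁ f₂} → Law f₀ f₁ f₂ → Law (a * f₀) (a * f₁) (a * f₂)
  law-* a {f₀} {f₁} {f₂} h = trans (x*[y*z]≈y*[x*z] _ _ _) (trans (*-congˡ h)
    (solve 4 (λ a q f f′ → a :* (q :* f :+ f′) := q :* (a :* f) :+ a :* f′) refl a q f₂ f₀))

  law-*ʳ : ∀ a {f₀ f₁ f₂} → Law f₀ f₁ f₂ → Law (f₀ * a) (f₁ * a) (f₂ * a)
  law-*ʳ a h = trans (*-congˡ (*-comm _ _)) (trans (law-* a h)
    (+-cong (*-congˡ (*-comm _ _)) (*-comm _ _)))

  law-+ : ∀ {f₀ f₁ f₂ g₀ g₁ g₂} → Law f₀ f₁ f₂ → Law g₀ g₁ g₂ → Law (f₀ + g₀) (f₁ + g₁) (f₂ + g₂)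
  law-+ {f₀} {f₁} {f₂} {g₀} {g₁} {g₂} h h′ = trans (distribˡ _ _ _) (trans (+-cong h h′)
    (solve 5 (λ q a b c d → (q :* a :+ b) :+ (q :* c :+ d) := q :* (a :+ c) :+ (b :+ d)) refl
      q f₂ f₀ g₂ g₀))

  law-neg : ∀ {f₀ f₁ f₂} → Law f₀ f₁ f₂ → Law (- f₀) (- f₁) (- f₂)
  law-neg {f₀} {f₁} {f₂} h = trans (solve 2 (λ q f → (con (+ 1) :+ q) :* :- f := :- ((con (+ 1) :+ q) :* f)) refl q f₁)
    (trans (-‿cong h) (solve 3 (λ q f f′ → :- (q :* f :+ f′) := q :* :- f :+ :- f′) refl q f₂ f₀))

  law-sum : ∀ n {f₀ f₁ f₂ : Fin n → Carrier} → (∀ i → Law (f₀ i) (f₁ i) (f₂ i)) →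
    Law (sum f₀) (sum f₁) (sum f₂)
  law-sum zero    h = trans (zeroʳ _) (sym (trans (+-identityʳ _) (zeroʳ q)))
  law-sum (suc n) h = law-+ (h zero) (law-sum n (h ∘ suc))

  -- A sum with only one term different from zero.
  sum-single : ∀ {n} (i : Fin n) (f : Fin n → Carrier) → (∀ j → j ≢ i → f j ≈ 0#) → sum f ≈ f i
  sum-single zero    f h = trans (+-congˡ (sum-0 λ j → h (suc j) λ ())) (+-identityʳ _)
  sum-single (suc i) f h = trans
    (+-cong (h zero λ ()) (sum-single i (f ∘ suc) λ j j≢i → h (suc j) (j≢i ∘ Fin.suc-injective)))
    (+-identityˡ _)

  module _ {m n : ℕ} (n≤m : n ≤ m) {f : List ℕ → Carrier} (modular : Modular n m f) where
    open Modular modular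

    private
      N : Carrier
      N = [ m ]↓ n

      -- The right-hand side of the theorem without the factor 1 / [m]ₙ, with f in
      -- place of the chromatic function.
      expansion : List ℕ → Carrier
      expansion l = sum {suc n} (λ j → hit m n n≤m (toℕ j) l * f (replicate (toℕ j) m))

      difference : List ℕ → Carrier
      difference l = N * f l - expansion l

      law-hit : ∀ {l₀ l₁ l₂} → (∀ k → Law (ρ l₀ k) (ρ l₁ k) (ρ l₂ k)) →
        ∀ j → Law (hit m n n≤m j l₀) (hit m n n≤m j l₁) (hit m n n≤m j l₂)
      law-hit h j = law-* ([ m ∸ n ]! ⁻¹) (law-sum (suc n) λ k →
        law-*ʳ (hitWeight m (toℕ k) * γ (toℕ k) j) (h (toℕ k)))

      hit-emptyRow : ∀ α j → hit m n n≤m j (α ++ 0 ∷ []) ≈ hit m n n≤m j α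
      hit-emptyRow α j = *-congˡ (sum-cong {suc n} λ k →
        *-congʳ {hitWeight m (toℕ k) * γ (toℕ k) j} (ρ-emptyRow α (toℕ k)))

      difference-law : ∀ {l₀ l₁ l₂} → Law (f l₀) (f l₁) (f l₂) →
        (∀ k → Law (ρ l₀ k) (ρ l₁ k) (ρ l₂ k)) →
        Law (difference l₀) (difference l₁) (difference l₂)
      difference-law {l₀} {l₁} {l₂} h h′ = law-+ (law-* N h) (law-neg (law-sum (suc n) λ j →
        law-*ʳ (f (replicate (toℕ j) m)) (law-hit {l₀} {l₁} {l₂} h′ (toℕ j))))

      difference-modular : Modular n m difference
      difference-modular = record
        { rowLaw    = λ α x β len x<m → difference-law (rowLaw α x β len x<m)
            (law-prefix α (row-law x β))
        ; columnLaw = λ α x len x<m α≥x → difference-law (columnLaw α x len x<m α≥x)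
            (law-prefix α (column-law x []))
        ; emptyRow  = λ α → +-cong (*-congˡ (emptyRow α)) (-‿cong (sum-cong {suc n} λ j →
            *-congʳ {f (replicate (toℕ j) m)} (hit-emptyRow α (toℕ j))))
        }

      expansion-rectangle : ∀ i → i ≤ n → expansion (replicate i m) ≈ N * f (replicate i m)
      expansion-rectangle i i≤n = begin
        expansion (replicate i m)
          ≈⟨ sum-single i′ (λ j → hit m n n≤m (toℕ j) (replicate i m) * f (replicate (toℕ j) m))
               (λ j j≢i → trans (*-congʳ (trans (hit-rectangle m n n≤m i i≤n (toℕ j))
                 (trans (*-congˡ (choose-no (i ℕ.≟ toℕ j) λ i≡j →
                   j≢i (Fin.toℕ-injective (≡.trans (≡.sym i≡j) (≡.sym i≡)))))
                   (zeroʳ N)))) (zeroˡ _)) ⟩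
        hit m n n≤m (toℕ i′) (replicate i m) * f (replicate (toℕ i′) m)
          ≡⟨ ≡.cong (λ k → hit m n n≤m k (replicate i m) * f (replicate k m)) i≡ ⟩
        hit m n n≤m i (replicate i m) * f (replicate i m)
          ≈⟨ *-congʳ (trans (hit-rectangle m n n≤m i i≤n i)
               (trans (*-congˡ (choose-yes (i ℕ.≟ i) ≡.refl)) (*-identityʳ N))) ⟩
        N * f (replicate i m)
          ∎
        where
        i′ : Fin (suc n)
        i′ = fromℕ< (s≤s i≤n)
        i≡ : toℕ i′ ≡ i
        i≡ = Fin.toℕ-fromℕ< (s≤s i≤n)

    -- A modular function is the combination of its values on rectangles with the
    -- hit numbers as coefficients, up to the factor 1 / [m]ₙ.
    hit-expansion : ∀ l → Decreasing m l → length l ≤ n →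
      f l ≈ N ⁻¹ * sum {suc n} (λ j → hit m n n≤m (toℕ j) l * f (replicate (toℕ j) m))
    hit-expansion l dec l≤n = begin
      f l                    ≈⟨ *-identityˡ _ ⟨
      1# * f l               ≈⟨ *-congʳ (*-inverseˡ N (↓≉0 m n n≤m)) ⟨
      N ⁻¹ * N * f l         ≈⟨ *-assoc _ _ _ ⟩
      N ⁻¹ * (N * f l)       ≈⟨ *-congˡ (x∙y⁻¹≈ε⇒x≈y _ _
        (vanishes-on-rectangles difference-modular
          (λ j j≤n → trans (+-congˡ (-‿cong (expansion-rectangle j j≤n))) (-‿inverseʳ _))
          l dec l≤n)) ⟩
      N ⁻¹ * expansion l     ∎

-- The expansion of chromatic functions

-- The entry of a list at a position, and 0 beyond the end.
entry : List ℕ → ℕ → ℕ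
entry []      k       = 0
entry (x ∷ l) zero    = x
entry (x ∷ l) (suc k) = entry l k

entry-at : ∀ α x β → entry (α ++ x ∷ β) (length α) ≡ x
entry-at []      x β = ≡.refl
entry-at (_ ∷ α) x β = entry-at α x β

entry-after : ∀ α x y β → entry (α ++ x ∷ y ∷ β) (suc (length α)) ≡ y
entry-after []      x y β = ≡.refl
entry-after (_ ∷ α) x y β = entry-after α x y β

entry-off : ∀ α x x′ β k → k ≢ length α → entry (α ++ x ∷ β) k ≡ entry (α ++ x′ ∷ β) k
entry-off []      x x′ β zero    k≢ = contradiction ≡.refl k≢
entry-off []      x x′ β (suc k) k≢ = ≡.refl
entry-off (_ ∷ α) x x′ β zero    k≢ = ≡.refl
entry-off (_ ∷ α) x x′ β (suc k) k≢ = entry-off α x x′ β k (k≢ ∘ ≡.cong suc)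

entry-off₂ : ∀ α x y x′ y′ β k → k ≢ length α → k ≢ suc (length α) →
  entry (α ++ x ∷ y ∷ β) k ≡ entry (α ++ x′ ∷ y′ ∷ β) k
entry-off₂ []      x y x′ y′ β zero          k≢ k≢′ = contradiction ≡.refl k≢
entry-off₂ []      x y x′ y′ β (suc zero)    k≢ k≢′ = contradiction ≡.refl k≢′
entry-off₂ []      x y x′ y′ β (suc (suc k)) k≢ k≢′ = ≡.refl
entry-off₂ (_ ∷ α) x y x′ y′ β zero          k≢ k≢′ = ≡.refl
entry-off₂ (_ ∷ α) x y x′ y′ β (suc k)       k≢ k≢′ =
  entry-off₂ α x y x′ y′ β k (k≢ ∘ ≡.cong suc) (k≢′ ∘ ≡.cong suc)

entry-emptyRow : ∀ α k → entry (α ++ 0 ∷ []) k ≡ entry α k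
entry-emptyRow []      zero    = ≡.refl
entry-emptyRow []      (suc k) = ≡.refl
entry-emptyRow (_ ∷ α) zero    = ≡.refl
entry-emptyRow (_ ∷ α) (suc k) = entry-emptyRow α k

-- If all entries but the one at the end are at least x + 2, then no other entry
-- is x + 1.
entry-no-end : ∀ {x} y {α} → All (suc (suc x) ≤_) α → ∀ k → k ≢ length α →
  x < entry (α ++ y ∷ []) k → suc x < entry (α ++ y ∷ []) k
entry-no-end y []        zero    k≢ x< = contradiction ≡.refl k≢
entry-no-end y (a≥ ∷ α≥) zero    k≢ x< = a≥
entry-no-end y (a≥ ∷ α≥) (suc k) k≢ x< = entry-no-end y α≥ k (k≢ ∘ ≡.cong suc) x<

entry-tabulate : ∀ {n} (f : Fin n → ℕ) i → entry (List.tabulate f) (toℕ i) ≡ f i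
entry-tabulate f zero    = ≡.refl
entry-tabulate f (suc i) = entry-tabulate (f ∘ suc) i

entry-replicate-< : ∀ j m k → k < j → entry (replicate j m) k ≡ m
entry-replicate-< (suc j) m zero    _         = ≡.refl
entry-replicate-< (suc j) m (suc k) (s≤s k<j) = entry-replicate-< j m k k<j

entry-replicate-≥ : ∀ j m k → j ≤ k → entry (replicate j m) k ≡ 0
entry-replicate-≥ zero    m k       _         = ≡.refl
entry-replicate-≥ (suc j) m (suc k) (s≤s j≤k) = entry-replicate-≥ j m k j≤k

part-rectangle : ∀ {n m} j (i : Fin n) → part (rectangle {n} {m} j) i ≡ entry (replicate j m) (toℕ i)
part-rectangle {m = m} j i with toℕ i ℕ.<? j
... | yes i<j = ≡.sym (entry-replicate-< j m (toℕ i) i<j)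
... | no  i≮j = ≡.sym (entry-replicate-≥ j m (toℕ i) (ℕ.≮⇒≥ i≮j))

Decreasing-tabulate : ∀ {n u} (f : Fin n → ℕ) → (∀ {i j} → i Fin.≤ j → f j ≤ f i) → (∀ i → f i ≤ u) →
  Decreasing u (List.tabulate f)
Decreasing-tabulate {zero}  f dec f≤u = []
Decreasing-tabulate {suc n} f dec f≤u =
  f≤u zero ∷ Decreasing-tabulate (f ∘ suc) (λ i≤j → dec (s≤s i≤j)) (λ i → dec z≤n)

opposite-inject₁ : ∀ {n} (i : Fin n) → opposite (inject₁ i) ≡ suc (opposite i)
opposite-inject₁ zero    = ≡.refl
opposite-inject₁ (suc i) = ≡.cong inject₁ (opposite-inject₁ i)

opposite-injective : ∀ {n} {i j : Fin n} → opposite i ≡ opposite j → i ≡ j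
opposite-injective {i = i} {j} eq = ≡.trans (≡.sym (Fin.opposite-involutive i))
  (≡.trans (≡.cong opposite eq) (Fin.opposite-involutive j))

-- The expansion of the coefficient of a fixed monomial e, over any field with a
-- parameter q.
module Expansion {c ℓ} (F : QField c ℓ) (e : List ℕ) where
  open QField F renaming (commutativeRing to K)
  open Sums K
  open ModularFunctions F
  open Rooks F using (parts)
  open RookLaws F using ([_]↓_)
  open HitNumbers F
  open Relation.Binary.Reasoning.Setoid setoid

  -- The lengths of the rows from bottom to top.
  rows : (n : ℕ) → List ℕ → Fin n → ℕ
  rows n l b = entry l (toℕ (opposite b))

  -- The coefficient of e in the chromatic function of the partition with rows l.
  chromaticSum : ℕ → ℕ → List ℕ → Carrier
  chromaticSum m n l = TwoCliques.coloringSum F e m n (rows n l)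

  chromaticSum-rowLaw : ∀ m n α x β → length (α ++ x ∷ x ∷ β) ≤ n → x < m →
    Law (chromaticSum m n (α ++ x ∷ x ∷ β)) (chromaticSum m n (α ++ suc x ∷ x ∷ β))
        (chromaticSum m n (α ++ suc x ∷ suc x ∷ β))
  chromaticSum-rowLaw m zero α x β len x<m = contradiction
    (ℕ.≤-trans (ℕ.≤-reflexive (≡.sym (List.length-++ α))) len) λ h →
      contradiction (ℕ.≤-trans (ℕ.m≤n+m _ (length α)) h) λ ()
  chromaticSum-rowLaw m (suc n) α x β len x<m =
    RowLaw.coloringSum-rowLaw F e m n _ _ _ i (fromℕ< x<m) (record
      { off₁   = λ b b≢ b≢′ → entry-off₂ α (suc x) x x x β _ (off b b≢′) (off′ b b≢)
      ; off₂   = λ b b≢ b≢′ → entry-off₂ α (suc x) (suc x) x x β _ (off b b≢′) (off′ b b≢)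
      ; lower₀ = lower x x x≡
      ; upper₀ = upper x x x≡
      ; lower₁ = lower (suc x) x x≡
      ; upper₁ = upper (suc x) x (≡.cong suc x≡)
      ; lower₂ = lower (suc x) (suc x) (≡.cong suc x≡)
      ; upper₂ = upper (suc x) (suc x) (≡.cong suc x≡)
      })
    where
    α<n : length α < n
    α<n = ℕ.s≤s⁻¹ (ℕ.≤-trans
      (ℕ.≤-trans (ℕ.≤-trans (ℕ.≤-reflexive (ℕ.+-comm 2 (length α)))
        (ℕ.+-monoʳ-≤ (length α) (ℕ.m≤m+n 2 (length β))))
        (ℕ.≤-reflexive (≡.sym (List.length-++ α)))) len)

    i : Fin n
    i = opposite (fromℕ< α<n)

    toℕ-i : toℕ (opposite i) ≡ length α
    toℕ-i = ≡.trans (≡.cong toℕ (Fin.opposite-involutive (fromℕ< α<n))) (Fin.toℕ-fromℕ< α<n)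

    upper-index : toℕ (opposite (suc i)) ≡ length α
    upper-index = ≡.trans (Fin.toℕ-inject₁ (opposite i)) toℕ-i

    lower-index : toℕ (opposite (inject₁ i)) ≡ suc (length α)
    lower-index = ≡.trans (≡.cong toℕ (opposite-inject₁ i)) (≡.cong suc toℕ-i)

    x≡ : x ≡ toℕ (fromℕ< x<m)
    x≡ = ≡.sym (Fin.toℕ-fromℕ< x<m)

    off : ∀ b → b ≢ suc i → toℕ (opposite b) ≢ length α
    off b b≢ eq = b≢ (opposite-injective (Fin.toℕ-injective (≡.trans eq (≡.sym upper-index))))

    off′ : ∀ b → b ≢ inject₁ i → toℕ (opposite b) ≢ suc (length α)
    off′ b b≢ eq = b≢ (opposite-injective (Fin.toℕ-injective (≡.trans eq (≡.sym lower-index))))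

    lower : ∀ y z {w} → z ≡ w → rows (suc n) (α ++ y ∷ z ∷ β) (inject₁ i) ≡ w
    lower y z eq = ≡.trans (≡.cong (entry (α ++ y ∷ z ∷ β)) lower-index)
      (≡.trans (entry-after α y z β) eq)

    upper : ∀ y z {w} → y ≡ w → rows (suc n) (α ++ y ∷ z ∷ β) (suc i) ≡ w
    upper y z eq = ≡.trans (≡.cong (entry (α ++ y ∷ z ∷ β)) upper-index)
      (≡.trans (entry-at α y (z ∷ β)) eq)

  chromaticSum-columnLaw : ∀ m n α x → length α < n → suc x < m → All (suc (suc x) ≤_) α →
    Law (chromaticSum m n (α ++ x ∷ [])) (chromaticSum m n (α ++ suc x ∷ []))
        (chromaticSum m n (α ++ suc (suc x) ∷ []))
  chromaticSum-columnLaw (suc m) n α x α<n (s≤s x<m) α≥x =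
    ColumnLaw.coloringSum-columnLaw F e m n _ _ _ b (fromℕ< x<m) (record
      { off₁    = λ k k≢b → entry-off α (suc x) x [] _ (off k k≢b)
      ; off₂    = λ k k≢b → entry-off α (suc (suc x)) x [] _ (off k k≢b)
      ; no-end  = λ k k≢b → ≡.subst (λ y → y < rows n (α ++ x ∷ []) k → suc y < rows n (α ++ x ∷ []) k)
          x≡ (entry-no-end x α≥x (toℕ (opposite k)) (off k k≢b))
      ; length₀ = at x x≡
      ; length₁ = at (suc x) (≡.cong suc x≡)
      ; length₂ = at (suc (suc x)) (≡.cong (λ y → suc (suc y)) x≡)
      })
    where
    b : Fin n
    b = opposite (fromℕ< α<n)

    index : toℕ (opposite b) ≡ length α
    index = ≡.trans (≡.cong toℕ (Fin.opposite-involutive (fromℕ< α<n))) (Fin.toℕ-fromℕ< α<n)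

    x≡ : x ≡ toℕ (fromℕ< x<m)
    x≡ = ≡.sym (Fin.toℕ-fromℕ< x<m)

    off : ∀ k → k ≢ b → toℕ (opposite k) ≢ length α
    off k k≢b eq = k≢b (opposite-injective (Fin.toℕ-injective (≡.trans eq (≡.sym index))))

    at : ∀ y {w} → y ≡ w → rows n (α ++ y ∷ []) b ≡ w
    at y eq = ≡.trans (≡.cong (entry (α ++ y ∷ [])) index) (≡.trans (entry-at α y []) eq)

  chromaticSum-modular : ∀ m n → Modular n m (chromaticSum m n)
  chromaticSum-modular m n = record
    { rowLaw    = chromaticSum-rowLaw m n
    ; columnLaw = chromaticSum-columnLaw m n
    ; emptyRow  = λ α → TwoCliques.coloringSum-cong F e m n λ b → entry-emptyRow α (toℕ (opposite b))
    }

  -- The coefficient of e in the chromatic function, as it is defined for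
  -- partitions.
  X : ∀ {n m} → Partition n m → Carrier
  X {n} {m} ν = ∑ (filter (λ κ → proper? ν κ ×-dec hasMonomial? e κ)
    (vectors (allFin (length e)) (m ℕ.+ n))) (λ κ → q ^ asc ν κ)

  X-chromaticSum : ∀ {n m} (ν : Partition n m) l → (∀ i → part ν i ≡ entry l (toℕ i)) →
    X ν ≈ chromaticSum m n l
  X-chromaticSum {n} {m} ν l h = trans (Chromatic.chromatic F e m n ν)
    (TwoCliques.coloringSum-cong F e m n λ b → h (opposite b))

  X-expansion : ∀ m n (n≤m : n ≤ m) (ν : Partition n m) →
    X ν ≈ ([ m ]↓ n) ⁻¹ * sum {suc n} (λ j →
      Poly.coeff (hitPolynomial m n n≤m ν) (toℕ j) * X (rectangle {n} {m} (toℕ j)))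
  X-expansion m n n≤m ν = begin
    X ν
      ≈⟨ X-chromaticSum ν (parts ν) (λ i → ≡.sym (entry-tabulate (part ν) i)) ⟩
    chromaticSum m n (parts ν)
      ≈⟨ hit-expansion n≤m (chromaticSum-modular m n) (parts ν)
           (Decreasing-tabulate (part ν) (decreasing ν) (bounded ν))
           (ℕ.≤-reflexive (List.length-tabulate (part ν))) ⟩
    ([ m ]↓ n) ⁻¹ * sum {suc n} (λ j → hit m n n≤m (toℕ j) (parts ν) * chromaticSum m n (replicate (toℕ j) m))
      ≈⟨ *-congˡ (sum-cong {suc n} λ j → *-cong
           (coeff-hitPolynomial m n n≤m ν (toℕ j))
           (X-chromaticSum (rectangle {n} {m} (toℕ j)) (replicate (toℕ j) m) (part-rectangle (toℕ j)))) ⟨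
    ([ m ]↓ n) ⁻¹ * sum {suc n} (λ j →
      Poly.coeff (hitPolynomial m n n≤m ν) (toℕ j) * X (rectangle {n} {m} (toℕ j)))
      ∎

open import Defs

theorem1p3 : (m n : ℕ) → n ≤ m → (ν : Partition n m) →
    X ν ≋ ([ m ]↓ n) ⁻¹ • sumSeries {suc n} (λ j → H (toℕ j) ν • X {n} {m} (rectangle (toℕ j)))
theorem1p3 m n n≤m ν e = Expansion.X-expansion ℚ⟨q⟩-Ring.qField e m n n≤m ν
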